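{- Let $r\ge 1$ be an integer and let $G$ be a finite simple connected non-bipartite graph with $m$ edges, where $m \geq (240r)^2$, and with spectral radius $\rho=\rho(G)$. Suppose that $G$ is $B_{r+1}$-free. Then $$\rho^2 < m - 1 + \frac{2}{\rho - 1},$$ unless $G \cong S^{+}_{m,s}$ for some $s \in \{1, 2, \ldots, r\}$.
   Context: All graphs are finite, simple and connected, and have no isolated vertices. For a graph $G$, $\rho(G)$ denotes its spectral radius, i.e. the largest eigenvalue of its adjacency matrix. For an integer $k\ge 1$, the book of size $k$, denoted $B_k$, is the graph formed by $k$ triangles sharing a common edge. A graph is $B_k$-free if it does not contain $B_k$ as a (not necessarily induced) subgraph. For a positive integer $s$ dividing $m-1$, $S^{+}_{m,s}$ denotes the graph with $m$ edges obtained from the complete bipartite graph $K_{s,(m-1)/s}$ by adding one edge between two vertices of the part of size $\frac{1}{s}(m-1)$ (in particular, $S^{+}_{m,1}$ is the star $K_{1,m-1}$ with one edge added between two leaves). The graph $S^{+}_{m,s}$ is defined only when $s$ divides $m-1$. -}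

module Defs where

open import Level using (Level; _⊔_; suc)
open import Algebra.Bundles using (CommutativeRing)
open import Data.Bool using (Bool; true; false; T; if_then_else_)
open import Data.Bool.Properties using (T?)
open import Data.Fin as Fin using (Fin; toℕ; splitAt)
import Data.Fin.Properties as Fin
open import Data.List using (List; length; filter; cartesianProduct; allFin)
open import Data.Nat as ℕ using (ℕ; zero; suc; _∸_)
open import Data.Nat.Divisibility using (_∣_; quotient)
open import Data.Product using (∃; _×_; _,_; proj₁)
open import Data.Sum using (_⊎_; inj₁; inj₂)
open import Data.Vec.Functional using (Vector)
open import Function using (_↔_; Inverse)
open import Function.Definitions using (Injective)
open import Relation.Binary.Construct.Closure.ReflexiveTransitive using (Star)
import Relation.Binary.Construct.StrictToNonStrict as NonStrict
open import Relation.Binary.Core using (Rel)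
open import Relation.Binary.PropositionalEquality using (_≡_; _≢_; refl)
open import Relation.Binary.Structures using (IsStrictTotalOrder)
open import Relation.Nullary using (¬_; yes; no)
open import Relation.Nullary.Decidable using (_×-dec_)
open import Relation.Unary using (Pred)

-- The library has no real numbers. They are characterised, uniquely up to
-- isomorphism, by the usual axioms of a complete ordered field. The reading is
-- the classical one: the order is trichotomous.

record CompleteOrderedField c ℓ₁ ℓ₂ : Set (Level.suc (c ⊔ ℓ₁ ⊔ ℓ₂)) where
  field
    commutativeRing : CommutativeRing c ℓ₁

  open CommutativeRing commutativeRing public

  infix 4 _<_

  field
    _<_                : Rel Carrier ℓ₂
    isStrictTotalOrder : IsStrictTotalOrder _≈_ _<_

  open IsStrictTotalOrder isStrictTotalOrder public
    using (compare; _≟_; _<?_; <-resp-≈)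
    renaming (irrefl to <-irrefl; trans to <-trans)

  open NonStrict _≈_ _<_ public using (_≤_)

  UpperBound : ∀ {p} → Pred Carrier p → Carrier → Set (c ⊔ ℓ₁ ⊔ ℓ₂ ⊔ p)
  UpperBound P b = ∀ x → P x → x ≤ b

  field
    0<1        : 0# < 1#
    +-monoʳ-<  : ∀ x {y z} → y < z → x + y < x + z
    *-positive : ∀ {x y} → 0# < x → 0# < y → 0# < x * y
    invertible : ∀ x → ¬ (x ≈ 0#) → ∃ λ y → x * y ≈ 1#
    supremum   : (P : Pred Carrier (c ⊔ ℓ₁ ⊔ ℓ₂)) → ∃ P → ∃ (UpperBound P) →
                 ∃ λ s → UpperBound P s × (∀ b → UpperBound P b → s ≤ b)

  infix  8 _⁻¹
  infixl 7 _/_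

  -- The value at 0# is a dummy.
  _⁻¹ : Carrier → Carrier
  x ⁻¹ with x ≟ 0#
  ... | yes _   = 0#
  ... | no  x≉0 = proj₁ (invertible x x≉0)

  _/_ : Carrier → Carrier → Carrier
  x / y = x * y ⁻¹

  open import Algebra.Definitions.RawMonoid +-rawMonoid public using (sum)
  open import Algebra.Definitions.RawMonoid +-rawMonoid using () renaming (_×_ to _×ℕ_)

  fromℕ : ℕ → Carrier
  fromℕ n = n ×ℕ 1#

  SquareMatrix : ℕ → Set c
  SquareMatrix n = Vector (Vector Carrier n) n

  IsEigenvalue : ∀ {n} → SquareMatrix n → Carrier → Set (c ⊔ ℓ₁)
  IsEigenvalue {n} A μ = ∃ λ (x : Vector Carrier n) →
    (∃ λ i → ¬ (x i ≈ 0#)) ×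
    (∀ i → sum (λ j → A i j * x j) ≈ μ * x i)

  IsLargestEigenvalue : ∀ {n} → SquareMatrix n → Carrier → Set (c ⊔ ℓ₁ ⊔ ℓ₂)
  IsLargestEigenvalue A ρ = IsEigenvalue A ρ × (∀ μ → IsEigenvalue A μ → μ ≤ ρ)

record Graph : Set where
  field
    order  : ℕ
    adj    : Fin order → Fin order → Bool
    sym    : ∀ u v → adj u v ≡ adj v u
    irrefl : ∀ v → adj v v ≡ false

  Vertex : Set
  Vertex = Fin order

  Edge : Rel Vertex _
  Edge u v = T (adj u v)

  -- Each edge {u , v} is listed once, as the pair with u < v.
  edges : List (Vertex × Vertex)
  edges = filter (λ (u , v) → u Fin.<? v ×-dec T? (adj u v))
                 (cartesianProduct (allFin order) (allFin order))

  size : ℕ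
  size = length edges

open Graph using (Vertex; Edge; size)

Connected : Graph → Set
Connected G = ∀ u v → Star (Edge G) u v

Bipartite : Graph → Set
Bipartite G = ∃ λ (side : Vertex G → Bool) → ∀ u v → Edge G u v → side u ≢ side v

record _≅_ (G H : Graph) : Set where
  field
    bijection : Vertex G ↔ Vertex H
    adj-≡     : ∀ u v → Graph.adj G u v ≡
                        Graph.adj H (Inverse.to bijection u) (Inverse.to bijection v)

-- H occurs in G as a subgraph, not necessarily induced.
record _⊑_ (H G : Graph) : Set where
  field
    embed     : Vertex H → Vertex G
    injective : Injective _≡_ _≡_ embed
    edge      : ∀ u v → Edge H u v → Edge G (embed u) (embed v)

_-Free : Graph → Graph → Set
(H -Free) G = ¬ (H ⊑ G)

-- The two vertices in Fin 2 span the common edge; each vertex in Fin k is the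
-- apex of one triangle.

bookAdj : ∀ {k} → Fin 2 ⊎ Fin k → Fin 2 ⊎ Fin k → Bool
bookAdj (inj₁ Fin.zero)           (inj₁ Fin.zero)           = false
bookAdj (inj₁ Fin.zero)           (inj₁ (Fin.suc Fin.zero)) = true
bookAdj (inj₁ (Fin.suc Fin.zero)) (inj₁ Fin.zero)           = true
bookAdj (inj₁ (Fin.suc Fin.zero)) (inj₁ (Fin.suc Fin.zero)) = false
bookAdj (inj₁ _)                  (inj₂ _)                  = true
bookAdj (inj₂ _)                  (inj₁ _)                  = true
bookAdj (inj₂ _)                  (inj₂ _)                  = false

bookAdj-sym : ∀ {k} (u v : Fin 2 ⊎ Fin k) → bookAdj u v ≡ bookAdj v u
bookAdj-sym (inj₁ Fin.zero)           (inj₁ Fin.zero)           = refl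
bookAdj-sym (inj₁ Fin.zero)           (inj₁ (Fin.suc Fin.zero)) = refl
bookAdj-sym (inj₁ (Fin.suc Fin.zero)) (inj₁ Fin.zero)           = refl
bookAdj-sym (inj₁ (Fin.suc Fin.zero)) (inj₁ (Fin.suc Fin.zero)) = refl
bookAdj-sym (inj₁ Fin.zero)           (inj₂ _)                  = refl
bookAdj-sym (inj₁ (Fin.suc Fin.zero)) (inj₂ _)                  = refl
bookAdj-sym (inj₂ _)                  (inj₁ Fin.zero)           = refl
bookAdj-sym (inj₂ _)                  (inj₁ (Fin.suc Fin.zero)) = refl
bookAdj-sym (inj₂ _)                  (inj₂ _)                  = refl

bookAdj-irrefl : ∀ {k} (v : Fin 2 ⊎ Fin k) → bookAdj v v ≡ false
bookAdj-irrefl (inj₁ Fin.zero)           = refl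
bookAdj-irrefl (inj₁ (Fin.suc Fin.zero)) = refl
bookAdj-irrefl (inj₂ _)                  = refl

book : ℕ → Graph
book k = record
  { order  = 2 ℕ.+ k
  ; adj    = λ u v → bookAdj (splitAt 2 u) (splitAt 2 v)
  ; sym    = λ u v → bookAdj-sym (splitAt 2 u) (splitAt 2 v)
  ; irrefl = λ v → bookAdj-irrefl (splitAt 2 v)
  }

-- K_{s,t} with an edge added between vertices 0 and 1 of the part of size t.
-- (For t < 2 there is no such pair, and nothing is added.)

extraEdge : ℕ → ℕ → Bool
extraEdge 0 1 = true
extraEdge 1 0 = true
extraEdge _ _ = false

S⁺Adj : ∀ {s t} → Fin s ⊎ Fin t → Fin s ⊎ Fin t → Bool
S⁺Adj (inj₁ _) (inj₁ _) = false
S⁺Adj (inj₁ _) (inj₂ _) = true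
S⁺Adj (inj₂ _) (inj₁ _) = true
S⁺Adj (inj₂ a) (inj₂ b) = extraEdge (toℕ a) (toℕ b)

extraEdge-sym : ∀ a b → extraEdge a b ≡ extraEdge b a
extraEdge-sym 0             0             = refl
extraEdge-sym 0             1             = refl
extraEdge-sym 0             (suc (suc _)) = refl
extraEdge-sym 1             0             = refl
extraEdge-sym 1             1             = refl
extraEdge-sym 1             (suc (suc _)) = refl
extraEdge-sym (suc (suc _)) 0             = refl
extraEdge-sym (suc (suc _)) 1             = refl
extraEdge-sym (suc (suc _)) (suc (suc _)) = refl

extraEdge-irrefl : ∀ a → extraEdge a a ≡ false
extraEdge-irrefl 0             = refl
extraEdge-irrefl 1             = refl
extraEdge-irrefl (suc (suc _)) = refl

S⁺Adj-sym : ∀ {s t} (u v : Fin s ⊎ Fin t) → S⁺Adj u v ≡ S⁺Adj v u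
S⁺Adj-sym (inj₁ _) (inj₁ _) = refl
S⁺Adj-sym (inj₁ _) (inj₂ _) = refl
S⁺Adj-sym (inj₂ _) (inj₁ _) = refl
S⁺Adj-sym (inj₂ a) (inj₂ b) = extraEdge-sym (toℕ a) (toℕ b)

S⁺Adj-irrefl : ∀ {s t} (v : Fin s ⊎ Fin t) → S⁺Adj v v ≡ false
S⁺Adj-irrefl (inj₁ _) = refl
S⁺Adj-irrefl (inj₂ a) = extraEdge-irrefl (toℕ a)

S⁺ : (m s : ℕ) → s ∣ m ∸ 1 → Graph
S⁺ m s s∣m-1 = record
  { order  = s ℕ.+ quotient s∣m-1
  ; adj    = λ u v → S⁺Adj (splitAt s u) (splitAt s v)
  ; sym    = λ u v → S⁺Adj-sym {s} (splitAt s u) (splitAt s v)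
  ; irrefl = λ v → S⁺Adj-irrefl {s} (splitAt s v)
  }

module _ {c ℓ₁ ℓ₂} (ℝ : CompleteOrderedField c ℓ₁ ℓ₂) where
  open CompleteOrderedField ℝ

  adjacencyMatrix : (G : Graph) → SquareMatrix (Graph.order G)
  adjacencyMatrix G u v = if Graph.adj G u v then 1# else 0#

  IsSpectralRadius : Graph → Carrier → Set (c ⊔ ℓ₁ ⊔ ℓ₂)
  IsSpectralRadius G ρ = IsLargestEigenvalue (adjacencyMatrix G) ρ

{-# OPTIONS --safe #-}
-- Completeness makes the supremum of the Rayleigh quotients an eigenvalue, so the largest eigenvalue ρ
-- bounds all quotients and has an eigenvector x ≥ 0, scaled to have maximum x_e = 1. Suppose ρ² > m - 1,
-- let N be the neighbourhood of e and A its complement (which contains e), and let d_N(u) count the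
-- neighbours of u in N. Expanding ρ² = ρ² x_e over walks of length two and comparing with m gives
--   2 Σ_{u ∈ A} d_N(u) (1 - x_u) + 2 e(A) < 2 + Σ (x_u + x_v - 1),
-- the last sum over the ordered edges inside N.
-- If N is independent, then e(A) < 1 and the graph is bipartite. Otherwise put p_u = Σ_{v ∈ N ∩ N(u)} x_v,
-- T = Σ_A p and T_v = Σ_{u ∈ A ∩ N(v)} p_u. Then Σ_{v ∈ N} x_v (T - T_v) = Σ_{u ∈ A} p_u (ρ - p_u) is at most
-- (ρ + r) times half the left-hand side above, while T_u + T_v ≤ T + rρ for every edge uv, because an edge
-- has at most r common neighbours. So every edge inside N has an endpoint with T - T_v large, which must
-- have a small x_v. An edge with x_u + x_v > 1 turns out to be too expensive; without such edges A is
-- independent, T < ρ²/7, and all x_v on the edges inside N are at most 3/20. Then only one edge fits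
-- inside N, and a single missing edge between N and A would already violate the inequality.

module Submission where

open import Defs
open import Algebra.Solver.Ring.AlmostCommutativeRing using (AlmostCommutativeRing; fromCommutativeRing; _-Raw-AlmostCommutative⟶_)
import Algebra.Properties.AbelianGroup as AbelianGroupProperties
import Algebra.Properties.Ring as RingProperties
import Algebra.Properties.Semiring.Mult as Mult
import Algebra.Properties.Semiring.Sum as SumProperties
import Algebra.Solver.Ring as RingSolver
open import Data.Bool using (Bool; true; false; not; if_then_else_; T; _∧_)
import Data.Bool.Properties as Bool
open import Data.Empty using (⊥; ⊥-elim)
open import Data.Fin as Fin using (Fin; zero; suc; toℕ; splitAt; inject≤)
open import Data.Fin.Permutation using (Permutation; transpose; _∘ₚ_; _⟨$⟩ʳ_)
import Data.Fin.Properties as Fin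
open import Data.Integer as ℤ using (ℤ; +_; -[1+_])
import Data.Integer.Properties as ℤₚ
open import Data.List using (List; []; _∷_; _++_; length; filter; map; foldr; tabulate; allFin; cartesianProduct)
open import Data.Maybe using (Maybe; just; nothing)
open import Data.Nat as ℕ using (ℕ; zero; suc; _∸_)
open import Data.Nat.Divisibility using (_∣_; divides)
import Data.Nat.Properties as ℕₚ
open import Data.Product using (∃; ∃₂; Σ; _×_; _,_; proj₁; proj₂)
open import Data.Sum using (_⊎_; inj₁; inj₂; [_,_]′) renaming (map to ⊎-map)
open import Data.Sum.Properties using (inj₁-injective; inj₂-injective)
open import Data.Vec.Functional using (Vector)
open import Function using (_∘_; id; _↔_; Inverse; mk↔ₛ′; Equivalence)
import Level
open import Relation.Binary.Construct.Closure.ReflexiveTransitive as Star using (Star; _◅_)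
import Relation.Binary.Construct.StrictToNonStrict as NonStrict
open import Relation.Binary.Definitions using (tri<; tri≈; tri>)
open import Relation.Binary.PropositionalEquality as ≡ using (_≡_; _≢_)
open import Relation.Nullary using (¬_; Dec; yes; no; contradiction; does)
open import Relation.Nullary.Decidable using (dec-true; dec-false; _×-dec_)
open import Relation.Unary using (Pred; Decidable)

-- The estimates run on a budget. Once the covering vertices have total value O(1/ρ), the left-hand
-- side of the first inequality is at most about 2, so the weighted sum of the T - T_v is at most
-- about ρ. Every v in N has x_v ≥ 1/ρ, because e is its neighbour; so a difference T - T_v of order
-- ρ² overdraws the budget only by a bounded factor, and explicit constants are unavoidable. They
-- come from ρ ≥ 239 r, which is what m ≥ (240 r)² leaves after passing to m - 1. The threshold 1/7
-- meets two demands: if T ≥ ρ²/7, an edge inside N makes a product close to (ρ²/7)² smaller than 4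
-- r ρ³, which is absurd since 1/49 > 4/239; if T < ρ²/7, the values on N are at most 1/7 + 1/239 <
-- 3/20. With values up to 3/20 each ordered edge inside N costs at least 7/10 out of 2, so fewer
-- than three ordered edges fit. In the linear algebra the obstacle is that the supremum of the
-- Rayleigh quotients has to be attained. Elimination by Schur complements takes the place of
-- compactness: it produces either a nonzero vector with nonpositive form or a uniform positive
-- lower bound.

module OrderedField {c ℓ₁ ℓ₂} (ℝ : CompleteOrderedField c ℓ₁ ℓ₂) where
  open CompleteOrderedField ℝ public hiding (sum; zero)

  open NonStrict _≈_ _<_ public using (<⇒≤)
  open RingProperties ring using (-0#≈0#; -‿distribˡ-*; -‿distribʳ-*; -‿involutive)
  open AbelianGroupProperties +-abelianGroup using (⁻¹-∙-comm)

  ≤-refl : ∀ {x} → x ≤ x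
  ≤-refl = inj₂ refl

  ≈⇒≤ : ∀ {x y} → x ≈ y → x ≤ y
  ≈⇒≤ = inj₂

  ≤-trans : ∀ {x y z} → x ≤ y → y ≤ z → x ≤ z
  ≤-trans = NonStrict.trans _≈_ _<_ isEquivalence <-resp-≈ <-trans

  <-≤-trans : ∀ {x y z} → x < y → y ≤ z → x < z
  <-≤-trans = NonStrict.<-≤-trans _≈_ _<_ <-trans (proj₁ <-resp-≈)

  ≤-<-trans : ∀ {x y z} → x ≤ y → y < z → x < z
  ≤-<-trans = NonStrict.≤-<-trans _≈_ _<_ sym <-trans (proj₂ <-resp-≈)

  ≤-antisym : ∀ {x y} → x ≤ y → y ≤ x → x ≈ y
  ≤-antisym = NonStrict.antisym _≈_ _<_ isEquivalence <-trans <-irrefl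

  ≤-total : ∀ x y → x ≤ y ⊎ y ≤ x
  ≤-total = NonStrict.total _≈_ _<_ compare

  <-or-≥ : ∀ x y → x < y ⊎ y ≤ x
  <-or-≥ x y with compare x y
  ... | tri< x<y _ _ = inj₁ x<y
  ... | tri≈ _ x≈y _ = inj₂ (inj₂ (sym x≈y))
  ... | tri> _ _ y<x = inj₂ (inj₁ y<x)

  ≤⇒≯ : ∀ {x y} → x ≤ y → ¬ (y < x)
  ≤⇒≯ x≤y y<x = <-irrefl refl (≤-<-trans x≤y y<x)

  ≮⇒≥ : ∀ {x y} → ¬ (x < y) → y ≤ x
  ≮⇒≥ {x} {y} x≮y with <-or-≥ x y
  ... | inj₁ x<y = ⊥-elim (x≮y x<y)
  ... | inj₂ y≤x = y≤x

  ≤-resp-≈ : ∀ {x x′ y y′} → x ≈ x′ → y ≈ y′ → x ≤ y → x′ ≤ y′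
  ≤-resp-≈ x≈x′ y≈y′ x≤y = ≤-trans (inj₂ (sym x≈x′)) (≤-trans x≤y (inj₂ y≈y′))

  <-resp : ∀ {x x′ y y′} → x ≈ x′ → y ≈ y′ → x < y → x′ < y′
  <-resp x≈x′ y≈y′ x<y = ≤-<-trans (inj₂ (sym x≈x′)) (<-≤-trans x<y (inj₂ y≈y′))

  +-monoʳ-≤ : ∀ x {y z} → y ≤ z → x + y ≤ x + z
  +-monoʳ-≤ x (inj₁ y<z) = inj₁ (+-monoʳ-< x y<z)
  +-monoʳ-≤ x (inj₂ y≈z) = inj₂ (+-congˡ y≈z)

  +-monoˡ-≤ : ∀ x {y z} → y ≤ z → y + x ≤ z + x
  +-monoˡ-≤ x y≤z = ≤-resp-≈ (+-comm x _) (+-comm x _) (+-monoʳ-≤ x y≤z)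

  +-monoˡ-< : ∀ x {y z} → y < z → y + x < z + x
  +-monoˡ-< x y<z = <-resp (+-comm x _) (+-comm x _) (+-monoʳ-< x y<z)

  +-mono-≤ : ∀ {w x y z} → w ≤ x → y ≤ z → w + y ≤ x + z
  +-mono-≤ {w} {x} {y} {z} w≤x y≤z = ≤-trans (+-monoˡ-≤ y w≤x) (+-monoʳ-≤ x y≤z)

  infixl 6 _⊕_ _⊕⁺_
  infixl 7 _⊗_

  _⊕_ : ∀ {x y} → 0# ≤ x → 0# ≤ y → 0# ≤ x + y
  0≤x ⊕ 0≤y = ≤-trans (inj₂ (sym (+-identityʳ 0#))) (+-mono-≤ 0≤x 0≤y)

  _⊕⁺_ : ∀ {x y} → 0# ≤ x → 0# < y → 0# < x + y
  _⊕⁺_ {x} 0≤x 0<y = ≤-<-trans 0≤x (<-resp (+-identityʳ x) refl (+-monoʳ-< x 0<y))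

  _⊗_ : ∀ {x y} → 0# ≤ x → 0# ≤ y → 0# ≤ x * y
  inj₁ 0<x ⊗ inj₁ 0<y = inj₁ (*-positive 0<x 0<y)
  inj₁ 0<x ⊗ inj₂ 0≈y = inj₂ (trans (sym (zeroʳ _)) (*-congˡ 0≈y))
  inj₂ 0≈x ⊗ _        = inj₂ (trans (sym (zeroˡ _)) (*-congʳ 0≈x))

  ⌊_⌋ : ∀ {x y} → x ≤ y → 0# ≤ y - x
  ⌊_⌋ {x} x≤y = ≤-trans (inj₂ (sym (-‿inverseʳ x))) (+-monoˡ-≤ (- x) x≤y)

  ⌊_⌋⁺ : ∀ {x y} → x < y → 0# < y - x
  ⌊_⌋⁺ {x} x<y = ≤-<-trans (inj₂ (sym (-‿inverseʳ x))) (+-monoˡ-< (- x) x<y)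

  private
    cancel : ∀ x y → (y - x) + x ≈ y
    cancel x y = trans (+-assoc y (- x) x) (trans (+-congˡ (-‿inverseˡ x)) (+-identityʳ y))

  -- A certificate for x ≤ y is an expression of y - x as a nonnegative term.
  ≤-by : ∀ {z x y} → 0# ≤ z → z ≈ y - x → x ≤ y
  ≤-by {z} {x} {y} 0≤z z≈y-x = ≤-resp-≈ (+-identityˡ x) (trans (+-congʳ z≈y-x) (cancel x y)) (+-monoˡ-≤ x 0≤z)

  <-by : ∀ {z x y} → 0# < z → z ≈ y - x → x < y
  <-by {z} {x} {y} 0<z z≈y-x = <-resp (+-identityˡ x) (trans (+-congʳ z≈y-x) (cancel x y)) (+-monoˡ-< x 0<z)

  square-nonneg : ∀ x → 0# ≤ x * x
  square-nonneg x with ≤-total 0# x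
  ... | inj₁ 0≤x = 0≤x ⊗ 0≤x
  ... | inj₂ x≤0 = ≤-resp-≈ refl square (0≤-x ⊗ 0≤-x)
    where
    0≤-x : 0# ≤ - x
    0≤-x = ≤-resp-≈ refl (+-identityˡ (- x)) ⌊ x≤0 ⌋
    square : - x * - x ≈ x * x
    square = trans (sym (-‿distribˡ-* x (- x))) (trans (-‿cong (sym (-‿distribʳ-* x x))) (-‿involutive (x * x)))

  -- Numerals are opaque so that the type checker never unfolds them into sums;
  -- 0 and 1 are exempt so that they agree with the constants of the ring.
  opaque
    numeral : ℕ → Carrier
    numeral n = fromℕ n

    numeral≡fromℕ : ∀ n → numeral n ≡ fromℕ n
    numeral≡fromℕ n = ≡.refl

  infix 9 #_
  #_ : ℕ → Carrier
  # 0               = 0#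
  # 1               = 1#
  # n@(suc (suc _)) = numeral n

  #≈fromℕ : ∀ n → # n ≈ fromℕ n
  #≈fromℕ 0               = refl
  #≈fromℕ 1               = sym (+-identityʳ 1#)
  #≈fromℕ n@(suc (suc _)) = reflexive (numeral≡fromℕ n)

  #-+ : ∀ m n → # (m ℕ.+ n) ≈ # m + # n
  #-+ m n = trans (#≈fromℕ (m ℕ.+ n)) (trans (Mult.×-homo-+ semiring 1# m n) (sym (+-cong (#≈fromℕ m) (#≈fromℕ n))))

  #-* : ∀ m n → # (m ℕ.* n) ≈ # m * # n
  #-* m n = trans (#≈fromℕ (m ℕ.* n)) (trans (Mult.×1-homo-* semiring m n) (sym (*-cong (#≈fromℕ m) (#≈fromℕ n))))

  #-suc : ∀ n → # (suc n) ≈ 1# + # n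
  #-suc n = #-+ 1 n

  0≤1 : 0# ≤ 1#
  0≤1 = inj₁ 0<1

  #≥0 : ∀ n → 0# ≤ # n
  #≥0 zero    = ≤-refl
  #≥0 (suc n) = ≤-resp-≈ refl (sym (#-suc n)) (0≤1 ⊕ #≥0 n)

  #>0 : ∀ n → 0# < # (suc n)
  #>0 n = <-resp refl (sym (trans (#-suc n) (+-comm _ _))) (#≥0 n ⊕⁺ 0<1)

  #-∸ : ∀ m n → # (m ℕ.+ n) - # m ≈ # n
  #-∸ m n = trans (+-congʳ (trans (#-+ m n) (+-comm _ _)))
           (trans (+-assoc _ _ _) (trans (+-congˡ (-‿inverseʳ _)) (+-identityʳ _)))

  #-mono-≤ : ∀ {m n} → m ℕ.≤ n → # m ≤ # n
  #-mono-≤ {m} {n} m≤n = ≤-by (#≥0 (n ∸ m)) (trans (sym (#-∸ m (n ∸ m)))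
    (+-congʳ (reflexive (≡.cong #_ (ℕₚ.m+[n∸m]≡n m≤n)))))

  #-mono-< : ∀ {m n} → m ℕ.< n → # m < # n
  #-mono-< {m} {n} m<n = <-≤-trans (<-by (#>0 0) (trans (sym (#-∸ m 1)) (+-congʳ (reflexive (≡.cong #_ (ℕₚ.+-comm m 1))))))
                                  (#-mono-≤ m<n)

  #-cancel-≤ : ∀ {m n} → # m ≤ # n → m ℕ.≤ n
  #-cancel-≤ {m} {n} #m≤#n with ℕₚ.≤-<-connex m n
  ... | inj₁ m≤n = m≤n
  ... | inj₂ n<m = ⊥-elim (≤⇒≯ #m≤#n (#-mono-< n<m))

  private
    ⟦_⟧ᶻ : ℤ → Carrier
    ⟦ + n ⟧ᶻ      = # n
    ⟦ -[1+ n ] ⟧ᶻ = - (# suc n)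

    neg-homo : ∀ i → ⟦ ℤ.- i ⟧ᶻ ≈ - ⟦ i ⟧ᶻ
    neg-homo (+ zero)   = sym -0#≈0#
    neg-homo (+ suc n)  = refl
    neg-homo (-[1+ n ]) = sym (-‿involutive _)

    sub-homo : ∀ m n → ⟦ m ℤ.⊖ n ⟧ᶻ ≈ # m - # n
    sub-homo m       zero    = sym (trans (+-congˡ -0#≈0#) (+-identityʳ _))
    sub-homo zero    (suc n) = sym (+-identityˡ _)
    sub-homo (suc m) (suc n) = trans (reflexive (≡.cong ⟦_⟧ᶻ (ℤₚ.[1+m]⊖[1+n]≡m⊖n m n)))
      (trans (sub-homo m n) (sym (trans (+-cong (#-suc m) (-‿cong (#-suc n))) shift)))
      where
      shift : (1# + # m) - (1# + # n) ≈ # m - # n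
      shift = trans (+-cong (+-comm _ _) (sym (⁻¹-∙-comm 1# (# n))))
             (trans (+-assoc _ _ _) (+-congˡ (trans (sym (+-assoc _ _ _))
             (trans (+-congʳ (-‿inverseʳ 1#)) (+-identityˡ _)))))

    +-homo : ∀ i j → ⟦ i ℤ.+ j ⟧ᶻ ≈ ⟦ i ⟧ᶻ + ⟦ j ⟧ᶻ
    +-homo (+ m)      (+ n)      = #-+ m n
    +-homo (+ m)      (-[1+ n ]) = sub-homo m (suc n)
    +-homo (-[1+ m ]) (+ n)      = trans (sub-homo n (suc m)) (+-comm _ _)
    +-homo (-[1+ m ]) (-[1+ n ]) =
      trans (-‿cong (trans (reflexive (≡.cong #_ (≡.sym (ℕₚ.+-suc (suc m) n)))) (#-+ (suc m) (suc n))))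
            (sym (⁻¹-∙-comm _ _))

    *-homo⁺ : ∀ m j → ⟦ + m ℤ.* j ⟧ᶻ ≈ # m * ⟦ j ⟧ᶻ
    *-homo⁺ m (+ n)      = trans (reflexive (≡.cong ⟦_⟧ᶻ (≡.sym (ℤₚ.pos-* m n)))) (#-* m n)
    *-homo⁺ m (-[1+ n ]) =
      trans (reflexive (≡.cong ⟦_⟧ᶻ (≡.trans (≡.sym (ℤₚ.neg-distribʳ-* (+ m) (+ suc n))) (≡.cong ℤ.-_ (≡.sym (ℤₚ.pos-* m (suc n)))))))
     (trans (neg-homo (+ (m ℕ.* suc n))) (trans (-‿cong (#-* m (suc n))) (-‿distribʳ-* _ _)))

    *-homo : ∀ i j → ⟦ i ℤ.* j ⟧ᶻ ≈ ⟦ i ⟧ᶻ * ⟦ j ⟧ᶻ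
    *-homo (+ m)      j = *-homo⁺ m j
    *-homo (-[1+ m ]) j =
      trans (reflexive (≡.cong ⟦_⟧ᶻ (≡.sym (ℤₚ.neg-distribˡ-* (+ suc m) j))))
     (trans (neg-homo (+ suc m ℤ.* j)) (trans (-‿cong (*-homo⁺ (suc m) j)) (-‿distribˡ-* _ _)))

    solverRing : AlmostCommutativeRing c ℓ₁
    solverRing = fromCommutativeRing commutativeRing

    integers : ℤ.+-*-rawRing -Raw-AlmostCommutative⟶ solverRing
    integers = record
      { ⟦_⟧ = ⟦_⟧ᶻ ; +-homo = +-homo ; *-homo = *-homo ; -‿homo = neg-homo
      ; 0-homo = refl ; 1-homo = refl }

    coefficient-≟ : ∀ i j → Maybe (⟦ i ⟧ᶻ ≈ ⟦ j ⟧ᶻ)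
    coefficient-≟ i j with i ℤ.≟ j
    ... | yes i≡j = just (reflexive (≡.cong ⟦_⟧ᶻ i≡j))
    ... | no  _   = nothing

  -- With integers as coefficients, identities whose constants reach the millions are settled by
  -- integer arithmetic instead of by unfolding numerals into sums of `1#`.
  module Solver = RingSolver ℤ.+-*-rawRing solverRing integers coefficient-≟

  open Solver using (solve; _:=_; _:+_; _:*_; _:-_; :-_; Polynomial) renaming (con to :con)

  :# : ∀ {n} → ℕ → Polynomial n
  :# k = :con (+ k)

  impossible : ∀ {z} → 0# < z → z ≈ 0# → ⊥
  impossible 0<z z≈0 = <-irrefl (sym z≈0) 0<z

  *-monoˡ-≤ : ∀ {k x y} → 0# ≤ k → x ≤ y → k * x ≤ k * y
  *-monoˡ-≤ {k} {x} {y} 0≤k x≤y = ≤-by (0≤k ⊗ ⌊ x≤y ⌋) (solve 3 (λ k x y → k :* (y :- x) := k :* y :- k :* x) refl k x y)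

  *-cancelˡ-< : ∀ {k x y} → 0# < k → k * x < k * y → x < y
  *-cancelˡ-< {x = x} {y} 0<k kx<ky with <-or-≥ x y
  ... | inj₁ x<y = x<y
  ... | inj₂ y≤x = ⊥-elim (≤⇒≯ (*-monoˡ-≤ (<⇒≤ 0<k) y≤x) kx<ky)

  *-cancelˡ-≤ : ∀ {k x y} → 0# < k → k * x ≤ k * y → x ≤ y
  *-cancelˡ-≤ {k} {x} {y} 0<k kx≤ky with <-or-≥ y x
  ... | inj₂ x≤y = x≤y
  ... | inj₁ y<x = ⊥-elim (≤⇒≯ kx≤ky (<-by (*-positive 0<k ⌊ y<x ⌋⁺)
          (solve 3 (λ k x y → k :* (x :- y) := k :* x :- k :* y) refl k x y)))

-- Finite sums over the field.

module Sums {c ℓ₁ ℓ₂} (ℝ : CompleteOrderedField c ℓ₁ ℓ₂) where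
  open OrderedField ℝ public
  open SumProperties semiring using (sum-cong-≋; ∑-distrib-+; *-distribˡ-sum; sum-replicate-zero) renaming (∑-comm to sum-comm)
  open Solver using (solve; _:=_; _:+_; _:*_; _:-_; :-_)

  -- Opaque, so that unification can read off the summand.
  opaque
    ∑ : ∀ {n} → (Fin n → Carrier) → Carrier
    ∑ = CompleteOrderedField.sum ℝ

    ∑≡sum : ∀ {n} (f : Fin n → Carrier) → ∑ f ≡ CompleteOrderedField.sum ℝ f
    ∑≡sum f = ≡.refl

    ∑-empty : (f : Fin 0 → Carrier) → ∑ f ≡ 0#
    ∑-empty f = ≡.refl

    ∑-suc : ∀ {n} (f : Fin (suc n) → Carrier) → ∑ f ≡ f zero + ∑ (λ i → f (suc i))
    ∑-suc f = ≡.refl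

    ∑-cong : ∀ {n} {f g : Fin n → Carrier} → (∀ i → f i ≈ g i) → ∑ f ≈ ∑ g
    ∑-cong = sum-cong-≋

    ∑-+ : ∀ {n} (f g : Fin n → Carrier) → ∑ (λ i → f i + g i) ≈ ∑ f + ∑ g
    ∑-+ = ∑-distrib-+

    ∑-* : ∀ {n} k (f : Fin n → Carrier) → ∑ (λ i → k * f i) ≈ k * ∑ f
    ∑-* k f = sym (*-distribˡ-sum k f)

    ∑-comm : ∀ {m n} (f : Fin m → Fin n → Carrier) → ∑ (λ i → ∑ (f i)) ≈ ∑ (λ j → ∑ (λ i → f i j))
    ∑-comm = sum-comm

  opaque
    unfolding ∑

    ∑-0 : ∀ {n} {f : Fin n → Carrier} → (∀ i → f i ≈ 0#) → ∑ f ≈ 0#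
    ∑-0 {n} f≈0 = trans (∑-cong f≈0) (sum-replicate-zero n)

    ∑-mono : ∀ {n} {f g : Fin n → Carrier} → (∀ i → f i ≤ g i) → ∑ f ≤ ∑ g
    ∑-mono {zero}  f≤g = ≤-refl
    ∑-mono {suc n} f≤g = +-mono-≤ (f≤g zero) (∑-mono (λ i → f≤g (suc i)))

    ∑-nonneg : ∀ {n} {f : Fin n → Carrier} → (∀ i → 0# ≤ f i) → 0# ≤ ∑ f
    ∑-nonneg {zero}  0≤f = ≤-refl
    ∑-nonneg {suc n} 0≤f = 0≤f zero ⊕ ∑-nonneg (λ i → 0≤f (suc i))

    term≤∑ : ∀ {n} {f : Fin n → Carrier} → (∀ i → 0# ≤ f i) → ∀ i → f i ≤ ∑ f
    term≤∑ {f = f} 0≤f zero    = ≤-by (∑-nonneg (λ i → 0≤f (suc i))) (solve 2 (λ x y → y := (x :+ y) :- x) refl (f zero) _)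
    term≤∑ {f = f} 0≤f (suc i) = ≤-trans (term≤∑ (λ i → 0≤f (suc i)) i) (≤-by (0≤f zero) (solve 2 (λ x y → x := (x :+ y) :- y) refl (f zero) _))

    twoTerms≤∑ : ∀ {n} {f : Fin n → Carrier} → (∀ i → 0# ≤ f i) → ∀ {i j} → ¬ (i ≡ j) → f i + f j ≤ ∑ f
    twoTerms≤∑ 0≤f {zero}  {zero}  i≢j = ⊥-elim (i≢j ≡.refl)
    twoTerms≤∑ 0≤f {zero}  {suc j} i≢j = +-monoʳ-≤ _ (term≤∑ (λ i → 0≤f (suc i)) j)
    twoTerms≤∑ 0≤f {suc i} {zero}  i≢j = ≤-resp-≈ (+-comm _ _) refl (+-monoʳ-≤ _ (term≤∑ (λ i → 0≤f (suc i)) i))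
    twoTerms≤∑ {f = f} 0≤f {suc i} {suc j} i≢j = ≤-trans (twoTerms≤∑ (λ i → 0≤f (suc i)) {i} {j} (λ i≡j → i≢j (≡.cong suc i≡j)))
      (≤-by (0≤f zero) (solve 2 (λ x y → x := (x :+ y) :- y) refl (f zero) _))

    ∃-positive-term : ∀ {n} {f : Fin n → Carrier} → 0# < ∑ f → ∃ λ i → 0# < f i
    ∃-positive-term {zero}  0<0 = ⊥-elim (<-irrefl refl 0<0)
    ∃-positive-term {suc n} {f} 0<∑ with <-or-≥ 0# (f zero)
    ... | inj₁ 0<f₀ = zero , 0<f₀
    ... | inj₂ f₀≤0 with ∃-positive-term {f = λ i → f (suc i)}
                           (<-by (⌊ f₀≤0 ⌋ ⊕⁺ 0<∑) (solve 2 (λ x y → (:# 0 :- x) :+ (x :+ y) := y :- :# 0) refl _ _))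
    ...   | i , 0<fᵢ = suc i , 0<fᵢ

  ∑-- : ∀ {n} (f g : Fin n → Carrier) → ∑ (λ i → f i - g i) ≈ ∑ f - ∑ g
  ∑-- f g = trans (∑-cong λ i → solve 2 (λ x y → x :- y := x :+ (:- :# 1) :* y) refl (f i) (g i))
           (trans (∑-+ f _) (trans (+-congˡ (∑-* (- 1#) g)) (solve 2 (λ x y → x :+ (:- :# 1) :* y := x :- y) refl (∑ f) (∑ g))))

  ∑≈0⇒≈0 : ∀ {n} {f : Fin n → Carrier} → (∀ i → 0# ≤ f i) → ∑ f ≤ 0# → ∀ i → f i ≈ 0#
  ∑≈0⇒≈0 0≤f ∑f≤0 i = ≤-antisym (≤-trans (term≤∑ 0≤f i) ∑f≤0) (0≤f i)

-- Quadratic forms, Schur complements and definiteness.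

module QuadraticForms {c ℓ₁ ℓ₂} (ℝ : CompleteOrderedField c ℓ₁ ℓ₂) where
  open Sums ℝ public
  open Solver using (solve; _:=_; _:+_; _:*_; _:-_; :-_)

  infix 9 _·_
  _·_ : ∀ {m n} → (Fin m → Fin n → Carrier) → Vector Carrier n → Vector Carrier m
  (M · x) i = ∑ λ j → M i j * x j

  ⟨_,_⟩ : ∀ {n} → Vector Carrier n → Vector Carrier n → Carrier
  ⟨ x , y ⟩ = ∑ λ i → x i * y i

  ∥_∥² : ∀ {n} → Vector Carrier n → Carrier
  ∥ x ∥² = ⟨ x , x ⟩

  form : ∀ {n} → SquareMatrix n → Vector Carrier n → Carrier
  form M x = ⟨ x , M · x ⟩

  Symmetric : ∀ {n} → SquareMatrix n → Set _
  Symmetric M = ∀ i j → M i j ≈ M j i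

  norm-nonneg : ∀ {n} (x : Vector Carrier n) → 0# ≤ ∥ x ∥²
  norm-nonneg x = ∑-nonneg λ i → square-nonneg (x i)

  square≈0⇒≈0 : ∀ {x} → x * x ≈ 0# → x ≈ 0#
  square≈0⇒≈0 {x} x²≈0 with compare 0# x
  ... | tri≈ _ 0≈x _ = sym 0≈x
  ... | tri< 0<x _ _ = ⊥-elim (<-irrefl (sym x²≈0) (*-positive 0<x 0<x))
  ... | tri> _ _ x<0 = ⊥-elim (<-irrefl (sym x²≈0) (<-resp refl
          (solve 1 (λ x → (:# 0 :- x) :* (:# 0 :- x) := x :* x) refl x) (*-positive ⌊ x<0 ⌋⁺ ⌊ x<0 ⌋⁺)))

  norm≈0⇒≈0 : ∀ {n} {x : Vector Carrier n} → ∥ x ∥² ≤ 0# → ∀ i → x i ≈ 0#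
  norm≈0⇒≈0 {x = x} ∥x∥²≤0 i = square≈0⇒≈0 (∑≈0⇒≈0 (λ i → square-nonneg (x i)) ∥x∥²≤0 i)

  nonzero⇒norm>0 : ∀ {n} {x : Vector Carrier n} → (∃ λ i → ¬ (x i ≈ 0#)) → 0# < ∥ x ∥²
  nonzero⇒norm>0 {x = x} (i , xᵢ≉0) with <-or-≥ 0# ∥ x ∥²
  ... | inj₁ 0<∥x∥² = 0<∥x∥²
  ... | inj₂ ∥x∥²≤0 = ⊥-elim (xᵢ≉0 (norm≈0⇒≈0 ∥x∥²≤0 i))

  norm>0⇒nonzero : ∀ {n} {x : Vector Carrier n} → 0# < ∥ x ∥² → ∃ λ i → ¬ (x i ≈ 0#)
  norm>0⇒nonzero 0<∥x∥² with ∃-positive-term 0<∥x∥²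
  ... | i , 0<xᵢ² = i , λ xᵢ≈0 → <-irrefl (sym (trans (*-congˡ xᵢ≈0) (zeroʳ _))) 0<xᵢ²

  symmetric-adjoint : ∀ {n} {M : SquareMatrix n} → Symmetric M → ∀ x y → ⟨ x , M · y ⟩ ≈ ⟨ M · x , y ⟩
  symmetric-adjoint {M = M} M-sym x y =
    trans (∑-cong λ i → sym (∑-* (x i) _))
   (trans (∑-comm _)
   (∑-cong λ j → trans (∑-cong λ i → trans (*-congˡ (*-congʳ (M-sym i j)))
      (solve 3 (λ x m y → x :* (m :* y) := y :* (m :* x)) refl (x i) (M j i) (y j)))
      (trans (∑-* (y j) _) (*-comm _ _))))

  opaque
    unfolding ∑

    -- A crude form of Cauchy-Schwarz: (b₀x₀ + s)² ≤ 2(b₀x₀)² + 2s² carries the induction. The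
    -- constant doubles with every coordinate, but only its existence matters.
    dot-bound : ∀ {n} (b : Vector Carrier n) → ∃ λ K → 0# ≤ K × (∀ x → ⟨ b , x ⟩ * ⟨ b , x ⟩ ≤ K * ∥ x ∥²)
    dot-bound {zero}  b = 0# , ≤-refl , λ x → ≤-refl
    dot-bound {suc n} b with dot-bound (λ i → b (suc i))
    ... | K , 0≤K , bound = # 2 * (b₀ * b₀ + K) , #≥0 2 ⊗ (square-nonneg b₀ ⊕ 0≤K) , λ x →
      let x₀ = x zero
          x′ = λ i → x (suc i)
          s  = ⟨ (λ i → b (suc i)) , x′ ⟩
      in ≤-by (square-nonneg (b₀ * x₀ - s) ⊕ #≥0 2 ⊗ ⌊ bound x′ ⌋ ⊕ #≥0 2 ⊗ (square-nonneg b₀ ⊗ norm-nonneg x′)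
                ⊕ #≥0 2 ⊗ (0≤K ⊗ square-nonneg x₀))
              (solve 5 (λ b x s K N → (b :* x :- s) :* (b :* x :- s) :+ :# 2 :* (K :* N :- s :* s) :+ :# 2 :* (b :* b :* N) :+ :# 2 :* (K :* (x :* x))
                   := :# 2 :* (b :* b :+ K) :* (x :* x :+ N) :- (b :* x :+ s) :* (b :* x :+ s)) refl b₀ x₀ s K ∥ x′ ∥²)
      where
      b₀ : Carrier
      b₀ = b zero

    image-bound : ∀ {m n} (M : Fin m → Fin n → Carrier) → ∃ λ K → 0# ≤ K × (∀ x → ∥ M · x ∥² ≤ K * ∥ x ∥²)
    image-bound {zero}  M = 0# , ≤-refl , λ x → ≈⇒≤ (sym (zeroˡ _))
    image-bound {suc m} M with dot-bound (M zero) | image-bound (λ i → M (suc i))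
    ... | K , 0≤K , bound | L , 0≤L , bound′ = K + L , 0≤K ⊕ 0≤L , λ x →
      ≤-trans (+-mono-≤ (bound x) (bound′ x)) (≈⇒≤ (sym (distribʳ _ K L)))

    norm-empty : (x : Vector Carrier 0) → ∥ x ∥² ≈ 0#
    norm-empty x = refl

    norm-suc : ∀ {n} (x : Vector Carrier (suc n)) → ∥ x ∥² ≈ x zero * x zero + ∥ (λ i → x (suc i)) ∥²
    norm-suc x = refl

    form-empty : (M : SquareMatrix 0) (x : Vector Carrier 0) → form M x ≈ 0#
    form-empty M x = refl

    form-suc : ∀ {n} (M : SquareMatrix (suc n)) (x : Vector Carrier (suc n)) →
      form M x ≈ x zero * (M zero zero * x zero + ∑ (λ j → M zero (suc j) * x (suc j)))
               + ∑ (λ i → x (suc i) * (M (suc i) zero * x zero + ∑ (λ j → M (suc i) (suc j) * x (suc j))))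
    form-suc M x = refl

  2xy≤x²+y² : ∀ x y → # 2 * (x * y) ≤ x * x + y * y
  2xy≤x²+y² x y = ≤-by (square-nonneg (x - y))
    (solve 2 (λ x y → (x :- y) :* (x :- y) := (x :* x :+ y :* y) :- :# 2 :* (x :* y)) refl x y)

  opaque
    -- Twice ⟨x , Mx⟩ is at most ∥x∥² + ∥Mx∥². Adding 1 to the constant of `image-bound` makes it
    -- positive, so that it can be cancelled later.
    form-bound : ∀ {n} (M : SquareMatrix n) → ∃ λ K → 0# < K × (∀ x → form M x ≤ K * ∥ x ∥²)
    form-bound M with image-bound M
    ... | K , 0≤K , bound = # 1 + K , <-resp refl (+-comm _ _) (0≤K ⊕⁺ 0<1) , λ x →
      *-cancelˡ-≤ (#>0 1) (≤-trans (≤-trans (≈⇒≤ (sym (∑-* (# 2) _))) (≤-trans (∑-mono λ i → 2xy≤x²+y² (x i) ((M · x) i)) (≈⇒≤ (∑-+ _ _))))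
        (≤-by (⌊ bound x ⌋ ⊕ #≥0 1 ⊗ (norm-nonneg x) ⊕ 0≤K ⊗ norm-nonneg x)
          (solve 3 (λ K N I → (K :* N :- I) :+ :# 1 :* N :+ K :* N := :# 2 :* ((:# 1 :+ K) :* N) :- (N :+ I)) refl K ∥ x ∥² ∥ M · x ∥²)))

  -- A uniform bound ε / δ below all Rayleigh quotients, stronger on its face than positivity at
  -- each vector. Two constants keep division out of the induction that produces it.
  PositiveDefinite : ∀ {n} → SquareMatrix n → Set _
  PositiveDefinite M = ∃₂ λ ε δ → 0# < ε × 0# < δ × (∀ x → ε * ∥ x ∥² ≤ δ * form M x)

  -- Completing the square: with u = a x₀ + ⟨b , x′⟩, the form of a bordered
  -- matrix times its corner a is u² plus the form of the Schur complement.
  module Schur {n} (M : SquareMatrix (suc n)) (M-sym : Symmetric M) where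
    a = M zero zero
    b = λ j → M zero (suc j)
    C = λ i j → M (suc i) (suc j)

    complement : SquareMatrix n
    complement i j = a * C i j - b i * b j

    complement-sym : Symmetric complement
    complement-sym i j = +-cong (*-congˡ (M-sym (suc i) (suc j))) (-‿cong (*-comm (b i) (b j)))

    form-complement : ∀ y → form complement y ≈ a * form C y - ⟨ b , y ⟩ * ⟨ b , y ⟩
    form-complement y =
      trans (∑-cong λ i → trans (*-congˡ (row i))
               (solve 5 (λ y a c b s → y :* (a :* c :- b :* s) := a :* (y :* c) :+ (:- s) :* (b :* y)) refl (y i) a ((C · y) i) (b i) s))
     (trans (∑-+ _ _)
     (trans (+-cong (∑-* a _) (∑-* (- s) _))
            (solve 2 (λ s q → q :+ (:- s) :* s := q :- s :* s) refl s (a * form C y))))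
      where
      s = ⟨ b , y ⟩
      row : ∀ i → (complement · y) i ≈ a * (C · y) i - b i * s
      row i = trans (∑-cong λ j → solve 5 (λ a c b b′ y → (a :* c :- b :* b′) :* y := a :* (c :* y) :- b :* (b′ :* y)) refl a (C i j) (b i) (b j) (y j))
             (trans (∑-- _ _) (+-cong (∑-* a _) (-‿cong (∑-* (b i) _))))

    form-expand : ∀ x₀ y (x : Vector Carrier (suc n)) → x zero ≈ x₀ → (∀ i → x (suc i) ≈ y i) →
                  form M x ≈ x₀ * (a * x₀ + ⟨ b , y ⟩) + (x₀ * ⟨ b , y ⟩ + form C y)
    form-expand x₀ y x x0≈ x≈y = trans (form-suc M x) (+-cong
      (*-cong x0≈ (+-cong (*-congˡ x0≈) (∑-cong λ j → *-congˡ (x≈y j))))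
      (trans (∑-cong λ i → trans (*-cong (x≈y i) (+-cong (*-cong (M-sym (suc i) zero) x0≈) (∑-cong λ j → *-congˡ (x≈y j))))
                (solve 4 (λ y b x c → y :* (b :* x :+ c) := x :* (b :* y) :+ y :* c) refl (y i) (b i) x₀ ((C · y) i)))
      (trans (∑-+ _ _) (+-congʳ (∑-* x₀ _)))))

    complete-square : ∀ x₀ y (x : Vector Carrier (suc n)) → x zero ≈ x₀ → (∀ i → x (suc i) ≈ y i) →
      a * form M x ≈ (a * x₀ + ⟨ b , y ⟩) * (a * x₀ + ⟨ b , y ⟩) + form complement y
    complete-square x₀ y x x0≈ x≈y = trans (*-congˡ (form-expand x₀ y x x0≈ x≈y))
      (trans (solve 4 (λ a x s q → a :* (x :* (a :* x :+ s) :+ (x :* s :+ q)) := (a :* x :+ s) :* (a :* x :+ s) :+ (a :* q :- s :* s)) refl a x₀ ⟨ b , y ⟩ (form C y))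
             (+-congˡ (sym (form-complement y))))

  form-scale : ∀ {n} (M : SquareMatrix n) k x → form M (λ i → k * x i) ≈ k * k * form M x
  form-scale M k x = trans (∑-cong λ i → trans (*-congˡ (trans (∑-cong λ j →
      solve 3 (λ m k x → m :* (k :* x) := k :* (m :* x)) refl (M i j) k (x j)) (∑-* k _)))
      (solve 3 (λ k x s → k :* x :* (k :* s) := k :* k :* (x :* s)) refl k (x i) ((M · x) i))) (∑-* (k * k) _)

  norm-scale : ∀ {n} k (x : Vector Carrier n) → ∥ (λ i → k * x i) ∥² ≈ k * k * ∥ x ∥²
  norm-scale k x = trans (∑-cong λ i → solve 2 (λ k x → k :* x :* (k :* x) := k :* k :* (x :* x)) refl k (x i)) (∑-* (k * k) _)

  opaque
    -- Induction on the dimension. A corner a ≤ 0 makes the first basis vector a witness. If a > 0,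
    -- a witness y for the Schur complement lifts to (-⟨b , y⟩ , a y), at which the completed square
    -- vanishes; and a definite complement makes the whole form definite.
    definite-or-not : ∀ {n} (M : SquareMatrix n) → Symmetric M →
                      PositiveDefinite M ⊎ (∃ λ x → 0# < ∥ x ∥² × form M x ≤ 0#)
    definite-or-not {zero}  M M-sym = inj₁ (1# , 1# , 0<1 , 0<1 , λ x → ≈⇒≤ (*-congˡ (trans (norm-empty x) (sym (form-empty M x)))))
    definite-or-not {suc n} M M-sym with <-or-≥ 0# (M zero zero)
    ... | inj₂ a≤0 = inj₂ (e₀ , <-by 0<1 norm-e₀ , ≤-trans (≈⇒≤ form-e₀) a≤0)
      where
      open Schur M M-sym
      e₀ : Vector Carrier (suc n)
      e₀ zero    = 1#
      e₀ (suc _) = 0#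
      norm-e₀ : 1# ≈ ∥ e₀ ∥² - 0#
      norm-e₀ = trans (solve 0 (:# 1 := (:# 1 :* :# 1 :+ :# 0) :- :# 0) refl)
        (+-congʳ (sym (trans (norm-suc e₀) (+-congˡ (∑-0 λ i → zeroˡ _)))))
      form-e₀ : form M e₀ ≈ a
      form-e₀ = trans (form-expand 1# (λ _ → 0#) e₀ refl (λ _ → refl))
        (trans (+-cong (*-congˡ (+-congˡ (∑-0 λ i → zeroʳ _))) (+-cong (*-congˡ (∑-0 λ i → zeroʳ _)) (∑-0 λ i → zeroˡ _)))
          (solve 1 (λ a → :# 1 :* (a :* :# 1 :+ :# 0) :+ (:# 1 :* :# 0 :+ :# 0) := a) refl a))
    ... | inj₁ 0<a with definite-or-not (Schur.complement M M-sym) (Schur.complement-sym M M-sym)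
    ...   | inj₂ (y , 0<∥y∥² , form≤0) = inj₂ (x , 0<∥x∥² , *-cancelˡ-≤ 0<a (≤-resp-≈ (sym form-x) (sym (zeroʳ a))
              (≤-by (square-nonneg a ⊗ ⌊ form≤0 ⌋) (solve 2 (λ a q → a :* a :* (:# 0 :- q) := :# 0 :- a :* a :* q) refl a (form complement y)))))
      where
      open Schur M M-sym
      s : Carrier
      s = ⟨ b , y ⟩
      x : Vector Carrier (suc n)
      x zero    = - s
      x (suc i) = a * y i
      0<∥x∥² : 0# < ∥ x ∥²
      0<∥x∥² = <-resp refl (sym (norm-suc x)) (square-nonneg (- s) ⊕⁺ <-resp refl (sym (norm-scale a y)) (*-positive (*-positive 0<a 0<a) 0<∥y∥²))
      form-x : a * form M x ≈ a * a * form complement y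
      form-x = trans (complete-square (- s) (λ i → a * y i) x refl (λ _ → refl))
        (trans (+-cong (*-cong u≈0 u≈0) (form-scale complement a y)) (solve 1 (λ q → :# 0 :* :# 0 :+ q := q) refl _))
        where
        u≈0 : a * - s + ⟨ b , (λ i → a * y i) ⟩ ≈ 0#
        u≈0 = trans (+-congˡ (trans (∑-cong λ i → solve 3 (λ b a y → b :* (a :* y) := a :* (b :* y)) refl (b i) a (y i)) (∑-* a _)))
                    (solve 2 (λ a s → a :* (:- s) :+ a :* s := :# 0) refl a s)
    ...   | inj₁ (ε , δ , 0<ε , 0<δ , definite) with dot-bound (Schur.b M M-sym)
    ...     | K , 0≤K , bound = inj₁
              ( ε * (a * a * δ) , L * (a * δ)
              , *-positive 0<ε 0<a²δ
              , *-positive 0<L (*-positive 0<a 0<δ)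
              , λ x → estimate x)
      where
      open Schur M M-sym
      L : Carrier
      -- With u = a x₀ + s and s = ⟨b , y⟩, a² x₀² = (u - s)² ≤ 2u² + 2K∥y∥². Multiplied by ε δ,
      -- these two terms are paid by the summands 2ε and 2δK of `L`; the summand a²δ pays for the
      -- ∥y∥² inside ∥x∥².
      L = # 2 * (δ * K) + # 2 * ε + a * a * δ
      0<a²δ : 0# < a * a * δ
      0<a²δ = *-positive (*-positive 0<a 0<a) 0<δ
      0≤ε : 0# ≤ ε
      0≤ε = <⇒≤ 0<ε
      0≤δ : 0# ≤ δ
      0≤δ = <⇒≤ 0<δ
      0<L : 0# < L
      0<L = (#≥0 2 ⊗ (0≤δ ⊗ 0≤K) ⊕ #≥0 2 ⊗ 0≤ε) ⊕⁺ 0<a²δ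
      estimate : ∀ x → ε * (a * a * δ) * ∥ x ∥² ≤ L * (a * δ) * form M x
      estimate x = ≤-trans (≈⇒≤ (*-congˡ (norm-suc x))) (≤-trans
        (≤-by (#≥0 2 ⊗ (0≤δ ⊗ 0≤K) ⊗ (0≤δ ⊗ square-nonneg u) ⊕ #≥0 2 ⊗ (0≤ε ⊗ 0≤ε ⊗ norm-nonneg y)
               ⊕ square-nonneg (a * δ * u) ⊕ 0≤ε ⊗ 0≤δ ⊗ square-nonneg (u + s)
               ⊕ #≥0 2 ⊗ (0≤ε ⊗ 0≤δ ⊗ ⌊ bound y ⌋))
          (solve 7 (λ a δ ε K x s N → let u = a :* x :+ s in
             :# 2 :* (δ :* K) :* (δ :* (u :* u)) :+ :# 2 :* (ε :* ε :* N)
               :+ (a :* δ :* u) :* (a :* δ :* u) :+ ε :* δ :* ((u :+ s) :* (u :+ s))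
               :+ :# 2 :* (ε :* δ :* (K :* N :- s :* s))
             := (:# 2 :* (δ :* K) :+ :# 2 :* ε :+ a :* a :* δ) :* (δ :* (u :* u) :+ ε :* N) :- ε :* (a :* a :* δ) :* (x :* x :+ N))
             refl a δ ε K (x zero) s ∥ y ∥²))
        (≤-trans (≤-by (<⇒≤ 0<L ⊗ ⌊ definite y ⌋)
           (solve 5 (λ L ε N q v → L :* (q :- ε :* N) := L :* (v :+ q) :- L :* (v :+ ε :* N)) refl L ε ∥ y ∥² (δ * form complement y) (δ * (u * u))))
         (≈⇒≤ (trans (solve 4 (λ L δ v q → L :* (δ :* v :+ δ :* q) := L :* δ :* (v :+ q)) refl L δ (u * u) (form complement y))
           (trans (*-congˡ (sym (complete-square (x zero) y x refl (λ _ → refl))))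
                  (solve 4 (λ L δ a q → L :* δ :* (a :* q) := L :* (a :* δ) :* q) refl L δ a (form M x)))))))
        where
        y : Vector Carrier n
        y = λ i → x (suc i)
        s u : Carrier
        s = ⟨ b , y ⟩
        u = a * x zero + s

-- The largest eigenvalue and a nonnegative eigenvector.

module Perron {c ℓ₁ ℓ₂} (ℝ : CompleteOrderedField c ℓ₁ ℓ₂) where
  open QuadraticForms ℝ public
  open Solver using (solve; _:=_; _:+_; _:*_; _:-_; :-_)

  PositiveSemidefinite : ∀ {n} → SquareMatrix n → Set _
  PositiveSemidefinite M = ∀ x → 0# ≤ form M x

  -- Evaluate the form at K x - M x for a bound K of the form.
  semidefinite-kernel : ∀ {n} {M : SquareMatrix n} → Symmetric M → PositiveSemidefinite M →
                        ∀ {x} → form M x ≤ 0# → ∀ i → (M · x) i ≈ 0#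
  semidefinite-kernel {n} {M} M-sym M≥0 {x} form≤0 with form-bound M
  ... | K , 0<K , bound = norm≈0⇒≈0 (*-cancelˡ-≤ 0<K
        (≤-by (≤-resp-≈ refl form-z (M≥0 z) ⊕ ⌊ bound y ⌋ ⊕ (<⇒≤ 0<K ⊗ <⇒≤ 0<K) ⊗ ⌊ form≤0 ⌋)
              (solve 4 (λ K q N p → (K :* K :* q :- :# 2 :* K :* N :+ p) :+ (K :* N :- p) :+ K :* K :* (:# 0 :- q) := K :* :# 0 :- K :* N)
                 refl K (form M x) ∥ y ∥² (form M y))))
    where
    y v z : Vector Carrier n
    y = M · x
    v = M · y
    z i = K * x i - y i
    image-z : ∀ i → (M · z) i ≈ K * y i - v i
    image-z i = trans (∑-cong λ j → solve 4 (λ m K x y → m :* (K :* x :- y) := K :* (m :* x) :- m :* y) refl (M i j) K (x j) (y j))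
                      (trans (∑-- _ _) (+-congʳ (∑-* K _)))
    form-z : form M z ≈ K * K * form M x - # 2 * K * ∥ y ∥² + form M y
    form-z = trans (∑-cong λ i → trans (*-congˡ (image-z i))
        (solve 4 (λ K x y v → (K :* x :- y) :* (K :* y :- v) := (K :* K :* (x :* y) :+ (:- K) :* (x :* v)) :+ ((:- K) :* (y :* y) :+ y :* v)) refl K (x i) (y i) (v i)))
      (trans (∑-+ _ _) (trans (+-cong (trans (∑-+ _ _) (+-cong (∑-* _ _) (trans (∑-* _ _) (*-congˡ (symmetric-adjoint M-sym x y)))))
                                      (trans (∑-+ _ _) (+-congʳ (∑-* _ _))))
        (solve 4 (λ K q N p → (K :* K :* q :+ (:- K) :* N) :+ ((:- K) :* N :+ p) := K :* K :* q :- :# 2 :* K :* N :+ p) refl K (form M x) ∥ y ∥² (form M y))))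

  𝟙 : ∀ {n} → SquareMatrix n
  𝟙 zero    zero    = 1#
  𝟙 zero    (suc _) = 0#
  𝟙 (suc _) zero    = 0#
  𝟙 (suc i) (suc j) = 𝟙 i j

  𝟙-sym : ∀ {n} → Symmetric (𝟙 {n})
  𝟙-sym zero    zero    = refl
  𝟙-sym zero    (suc _) = refl
  𝟙-sym (suc _) zero    = refl
  𝟙-sym (suc i) (suc j) = 𝟙-sym i j

  𝟙-image : ∀ {n} (x : Vector Carrier n) i → (𝟙 · x) i ≈ x i
  𝟙-image x zero    = trans (reflexive (∑-suc _)) (trans (+-cong (*-identityˡ _) (∑-0 λ j → zeroˡ _)) (+-identityʳ _))
  𝟙-image x (suc i) = trans (reflexive (∑-suc _)) (trans (+-cong (zeroˡ _) (𝟙-image (λ j → x (suc j)) i)) (+-identityˡ _))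

  shift : ∀ {n} → Carrier → SquareMatrix n → SquareMatrix n
  shift t A i j = t * 𝟙 i j - A i j

  shift-sym : ∀ {n} t {A : SquareMatrix n} → Symmetric A → Symmetric (shift t A)
  shift-sym t A-sym i j = +-cong (*-congˡ (𝟙-sym i j)) (-‿cong (A-sym i j))

  shift-image : ∀ {n} t (A : SquareMatrix n) x i → (shift t A · x) i ≈ t * x i - (A · x) i
  shift-image t A x i = trans (∑-cong λ j → solve 4 (λ t d a x → (t :* d :- a) :* x := t :* (d :* x) :- a :* x) refl t (𝟙 i j) (A i j) (x j))
    (trans (∑-- _ _) (+-congʳ (trans (∑-* t _) (*-congˡ (𝟙-image x i)))))

  form-shift : ∀ {n} t (A : SquareMatrix n) x → form (shift t A) x ≈ t * ∥ x ∥² - form A x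
  form-shift t A x = trans (∑-cong λ i → trans (*-congˡ (shift-image t A x i))
      (solve 3 (λ t x y → x :* (t :* x :- y) := t :* (x :* x) :- x :* y) refl t (x i) ((A · x) i)))
    (trans (∑-- _ _) (+-congʳ (∑-* t _)))

  minus-zero : ∀ {x y} → x - y ≈ 0# → y ≈ x
  minus-zero {x} {y} x-y≈0 = trans (solve 2 (λ x y → y := x :- (x :- y)) refl x y)
    (trans (+-congˡ (-‿cong x-y≈0)) (solve 1 (λ x → x :- :# 0 := x) refl x))

  form-eigenvector : ∀ {n} {A : SquareMatrix n} {μ x} → (∀ i → (A · x) i ≈ μ * x i) → form A x ≈ μ * ∥ x ∥²
  form-eigenvector {μ = μ} {x} Ax≈μx = trans (∑-cong λ i → trans (*-congˡ (Ax≈μx i))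
    (solve 2 (λ μ x → x :* (μ :* x) := μ :* (x :* x)) refl μ (x i))) (∑-* μ _)

  -- If A shifted by the supremum of the Rayleigh quotients were positive definite, a smaller
  -- number would still bound all quotients; so that shift has a kernel.
  module Rayleigh {n} (A : SquareMatrix n) (A-sym : Symmetric A)
                  {x₀ : Vector Carrier n} (0<∥x₀∥² : 0# < ∥ x₀ ∥²) where

    -- The downward closure of the set of Rayleigh quotients: it has the same supremum and is
    -- described without division.
    IsQuotientBound : Carrier → Set (c Level.⊔ ℓ₁ Level.⊔ ℓ₂)
    IsQuotientBound t = ∃ λ (x : Vector Carrier n) → 0# < ∥ x ∥² × t * ∥ x ∥² ≤ form A x

    quotient : ∀ x → 0# < ∥ x ∥² → ∃ λ t → t * ∥ x ∥² ≈ form A x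
    quotient x 0<∥x∥² with invertible ∥ x ∥² (λ ∥x∥²≈0 → <-irrefl (sym ∥x∥²≈0) 0<∥x∥²)
    ... | N⁻¹ , NN⁻¹≈1 = form A x * N⁻¹ , trans (*-assoc _ _ _) (trans (*-congˡ (trans (*-comm _ _) NN⁻¹≈1)) (*-identityʳ _))

    bounded : ∃ (UpperBound IsQuotientBound)
    bounded with form-bound A
    ... | K , _ , bound = K , λ { t (x , 0<∥x∥² , tN≤q) →
      *-cancelˡ-≤ 0<∥x∥² (≤-resp-≈ (*-comm _ _) (*-comm _ _) (≤-trans tN≤q (bound x))) }

    least-upper-bound : ∃ λ s → UpperBound IsQuotientBound s × (∀ b → UpperBound IsQuotientBound b → s ≤ b)
    least-upper-bound = supremum IsQuotientBound
      (proj₁ (quotient x₀ 0<∥x₀∥²) , x₀ , 0<∥x₀∥² , ≈⇒≤ (proj₂ (quotient x₀ 0<∥x₀∥²))) bounded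

    top : Carrier
    top = proj₁ least-upper-bound

    form≤top : ∀ x → form A x ≤ top * ∥ x ∥²
    form≤top x with <-or-≥ 0# ∥ x ∥²
    ... | inj₁ 0<∥x∥² with quotient x 0<∥x∥²
    ...   | t , tN≈q = ≤-trans (≈⇒≤ (sym tN≈q)) (≤-resp-≈ (*-comm _ _) (*-comm _ _)
              (≤-by (<⇒≤ 0<∥x∥² ⊗ ⌊ proj₁ (proj₂ least-upper-bound) t (x , 0<∥x∥² , ≈⇒≤ tN≈q) ⌋)
                    (solve 3 (λ N s t → N :* (s :- t) := N :* s :- N :* t) refl ∥ x ∥² top t)))
    form≤top x | inj₂ ∥x∥²≤0 with form-bound A
    ...   | K , _ , bound = ≤-trans (bound x) (≈⇒≤ (trans (*-congˡ N≈0) (trans (zeroʳ _) (sym (trans (*-congˡ N≈0) (zeroʳ _))))))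
      where
      N≈0 : ∥ x ∥² ≈ 0#
      N≈0 = ≤-antisym ∥x∥²≤0 (norm-nonneg x)

    shift-semidefinite : PositiveSemidefinite (shift top A)
    shift-semidefinite x = ≤-resp-≈ refl (sym (form-shift top A x)) ⌊ form≤top x ⌋

    top-eigenvalue : IsEigenvalue A top
    top-eigenvalue with definite-or-not (shift top A) (shift-sym top A-sym)
    ... | inj₂ (x , 0<∥x∥² , form≤0) = x , norm>0⇒nonzero 0<∥x∥² , λ i → trans (reflexive (≡.sym (∑≡sum _)))
            (minus-zero (trans (sym (shift-image top A x i)) (semidefinite-kernel (shift-sym top A-sym) shift-semidefinite form≤0 i)))
    ... | inj₁ (ε , δ , 0<ε , 0<δ , definite) with invertible δ (λ δ≈0 → <-irrefl (sym δ≈0) 0<δ)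
    ...   | δ⁻¹ , δδ⁻¹≈1 = ⊥-elim (≤⇒≯ δtop≤ (<-by 0<ε (solve 2 (λ ε s → ε := s :- (s :- ε)) refl ε (δ * top))))
      where
      smaller : Carrier
      -- This is top - ε / δ: definiteness of the shift keeps every quotient at least ε / δ below
      -- `top`.
      smaller = (δ * top - ε) * δ⁻¹
      δ*smaller : δ * smaller ≈ δ * top - ε
      δ*smaller = trans (solve 3 (λ d x e → d :* (x :* e) := x :* (d :* e)) refl δ (δ * top - ε) δ⁻¹)
                        (trans (*-congˡ δδ⁻¹≈1) (*-identityʳ _))
      smaller-bound : UpperBound IsQuotientBound smaller
      smaller-bound t (x , 0<∥x∥² , tN≤q) = *-cancelˡ-≤ 0<δ (≤-trans
        (*-cancelˡ-≤ 0<∥x∥² (≤-by (⌊ ≤-trans (definite x) (≈⇒≤ (*-congˡ (form-shift top A x))) ⌋ ⊕ <⇒≤ 0<δ ⊗ ⌊ tN≤q ⌋)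
          (solve 6 (λ d s N q e t → (d :* (s :* N :- q) :- e :* N) :+ d :* (q :- t :* N) := N :* (d :* s :- e) :- N :* (d :* t))
             refl δ top ∥ x ∥² (form A x) ε t)))
        (≈⇒≤ (sym δ*smaller)))
      δtop≤ : δ * top ≤ δ * top - ε
      δtop≤ = ≤-resp-≈ refl δ*smaller (≤-by (<⇒≤ 0<δ ⊗ ⌊ proj₂ (proj₂ least-upper-bound) smaller smaller-bound ⌋)
        (solve 3 (λ d s t → d :* (s :- t) := d :* s :- d :* t) refl δ smaller top))

  -- The supremum of the quotients is an eigenvalue, hence at most ρ. The eigenvector of ρ supplies
  -- the nonzero vector that makes the set of quotients inhabited.
  form≤largest-eigenvalue : ∀ {n} {A : SquareMatrix n} {ρ} → Symmetric A → IsLargestEigenvalue A ρ → ∀ x → form A x ≤ ρ * ∥ x ∥²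
  form≤largest-eigenvalue {A = A} {ρ} A-sym ((x₀ , x₀≉0 , _) , largest) x =
    ≤-trans (form≤top x) (≤-by (norm-nonneg x ⊗ ⌊ largest top top-eigenvalue ⌋)
      (solve 3 (λ N s t → N :* (t :- s) := t :* N :- s :* N) refl ∥ x ∥² top ρ))
    where open Rayleigh A A-sym (nonzero⇒norm>0 x₀≉0)

  absolute : ∀ x → ∃ λ y → 0# ≤ y × x ≤ y × (- x) ≤ y × y * y ≈ x * x
  absolute x with ≤-total 0# x
  ... | inj₁ 0≤x = x , 0≤x , ≤-refl , ≤-by (0≤x ⊕ 0≤x) (solve 1 (λ x → x :+ x := x :- (:- x)) refl x) , refl
  ... | inj₂ x≤0 = - x , ≤-by ⌊ x≤0 ⌋ (solve 1 (λ x → :# 0 :- x := (:- x) :- :# 0) refl x)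
                 , ≤-by (⌊ x≤0 ⌋ ⊕ ⌊ x≤0 ⌋) (solve 1 (λ x → (:# 0 :- x) :+ (:# 0 :- x) := (:- x) :- x) refl x) , ≤-refl
                 , solve 1 (λ x → (:- x) :* (:- x) := x :* x) refl x

  -- The products (u - x)(v + y) and (u + x)(v - y) are nonnegative and add up to 2uv - 2xy.
  product≤absolute : ∀ x y {u v} → x ≤ u → (- x) ≤ u → y ≤ v → (- y) ≤ v → x * y ≤ u * v
  product≤absolute x y {u} {v} x≤u -x≤u y≤v -y≤v = *-cancelˡ-≤ (#>0 1)
    (≤-by (⌊ x≤u ⌋ ⊗ ⌊ -y≤v ⌋ ⊕ ⌊ -x≤u ⌋ ⊗ ⌊ y≤v ⌋)
      (solve 4 (λ x y u v → (u :- x) :* (v :- (:- y)) :+ (u :- (:- x)) :* (v :- y) := :# 2 :* (u :* v) :- :# 2 :* (x :* y)) refl x y u v))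

  argmax : ∀ {n} (f : Fin n → Carrier) → Fin n → ∃ λ e → ∀ i → f i ≤ f e
  argmax {suc zero}    f _ = zero , λ { zero → ≤-refl }
  argmax {suc (suc n)} f _ with argmax (λ i → f (suc i)) zero
  ... | e , max with ≤-total (f zero) (f (suc e))
  ...   | inj₁ f₀≤fₑ = suc e , λ { zero → f₀≤fₑ ; (suc i) → max i }
  ...   | inj₂ fₑ≤f₀ = zero , λ { zero → ≤-refl ; (suc i) → ≤-trans (max i) fₑ≤f₀ }

  record PerronVector {n} (A : SquareMatrix n) (ρ : Carrier) : Set (c Level.⊔ ℓ₁ Level.⊔ ℓ₂) where
    field
      x           : Vector Carrier n
      top         : Fin n
      x≥0         : ∀ i → 0# ≤ x i
      x≤1         : ∀ i → x i ≤ 1#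
      x-top       : x top ≈ 1#
      eigenvector : ∀ i → (A · x) i ≈ ρ * x i

  -- Replacing an eigenvector y of ρ by its absolute values z keeps the norm and, since the entries
  -- of A are nonnegative, does not lower the form. So z attains the maximum ρ∥z∥² as well, lies in
  -- the kernel of the semidefinite ρ - A, and is again an eigenvector.
  perron : ∀ {n} {A : SquareMatrix n} {ρ} → Symmetric A → (∀ i j → 0# ≤ A i j) → IsLargestEigenvalue A ρ → PerronVector A ρ
  perron {n} {A} {ρ} A-sym A≥0 Aρ@((y , (k , yₖ≉0) , Ay≈ρy) , _) = record
    { x = x ; top = e
    ; x≥0 = λ i → 0≤k⁻¹ ⊗ z≥0 i
    ; x≤1 = λ i → ≤-trans (≤-by (0≤k⁻¹ ⊗ ⌊ proj₂ maximum i ⌋) (solve 3 (λ k a b → k :* (b :- a) := k :* b :- k :* a) refl k⁻¹ (z i) (z e))) (≈⇒≤ xₑ≈1)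
    ; x-top = xₑ≈1
    ; eigenvector = λ i → trans (∑-cong λ j → solve 3 (λ a k z → a :* (k :* z) := k :* (a :* z)) refl (A i j) k⁻¹ (z j))
        (trans (∑-* k⁻¹ _) (trans (*-congˡ (Az≈ρz i)) (solve 3 (λ k r z → k :* (r :* z) := r :* (k :* z)) refl k⁻¹ ρ (z i)))) }
    where
    z : Vector Carrier n
    z i = proj₁ (absolute (y i))
    z≥0 : ∀ i → 0# ≤ z i
    z≥0 i = proj₁ (proj₂ (absolute (y i)))
    y≤z : ∀ i → y i ≤ z i
    y≤z i = proj₁ (proj₂ (proj₂ (absolute (y i))))
    -y≤z : ∀ i → (- y i) ≤ z i
    -y≤z i = proj₁ (proj₂ (proj₂ (proj₂ (absolute (y i)))))
    z²≈y² : ∀ i → z i * z i ≈ y i * y i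
    z²≈y² i = proj₂ (proj₂ (proj₂ (proj₂ (absolute (y i)))))
    form-increases : form A y ≤ form A z
    form-increases = ∑-mono λ i → ≤-trans (≈⇒≤ (sym (∑-* _ _))) (≤-trans (∑-mono λ j →
      ≤-by (A≥0 i j ⊗ ⌊ product≤absolute (y i) (y j) (y≤z i) (-y≤z i) (y≤z j) (-y≤z j) ⌋)
        (solve 5 (λ a x y u v → a :* (u :* v :- x :* y) := u :* (a :* v) :- x :* (a :* y)) refl (A i j) (y i) (y j) (z i) (z j)))
      (≈⇒≤ (∑-* _ _)))
    shift-semidefinite : PositiveSemidefinite (shift ρ A)
    shift-semidefinite x = ≤-resp-≈ refl (sym (form-shift ρ A x)) ⌊ form≤largest-eigenvalue A-sym Aρ x ⌋
    form≤0 : form (shift ρ A) z ≤ 0#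
    form≤0 = ≤-by ⌊ form-increases ⌋ (trans (+-congˡ (-‿cong form-y))
        (trans (solve 2 (λ q p → q :- p := :# 0 :- (p :- q)) refl (form A z) (ρ * ∥ z ∥²)) (+-congˡ (-‿cong (sym (form-shift ρ A z))))))
      where
      form-y : form A y ≈ ρ * ∥ z ∥²
      form-y = trans (form-eigenvector λ i → trans (reflexive (∑≡sum _)) (Ay≈ρy i)) (*-congˡ (∑-cong λ i → sym (z²≈y² i)))
    Az≈ρz : ∀ i → (A · z) i ≈ ρ * z i
    Az≈ρz i = minus-zero (trans (sym (shift-image ρ A z i))
      (semidefinite-kernel (shift-sym ρ A-sym) shift-semidefinite form≤0 i))
    maximum : ∃ λ e → ∀ i → z i ≤ z e
    maximum = argmax z k
    e = proj₁ maximum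
    0<zₑ : 0# < z e
    0<zₑ with <-or-≥ 0# (z e)
    ... | inj₁ 0<zₑ = 0<zₑ
    ... | inj₂ zₑ≤0 = ⊥-elim (yₖ≉0 (square≈0⇒≈0 (trans (sym (z²≈y² k)) (trans (*-congˡ zₖ≈0) (zeroʳ _)))))
      where
      zₖ≈0 : z k ≈ 0#
      zₖ≈0 = ≤-antisym (≤-trans (proj₂ maximum k) zₑ≤0) (z≥0 k)
    inverse : ∃ λ k⁻¹ → z e * k⁻¹ ≈ 1#
    inverse = invertible (z e) (λ zₑ≈0 → <-irrefl (sym zₑ≈0) 0<zₑ)
    k⁻¹ = proj₁ inverse
    0≤k⁻¹ : 0# ≤ k⁻¹
    0≤k⁻¹ = *-cancelˡ-≤ 0<zₑ (≤-resp-≈ (sym (zeroʳ _)) (sym (proj₂ inverse)) 0≤1)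
    x : Vector Carrier n
    x i = k⁻¹ * z i
    xₑ≈1 : x e ≈ 1#
    xₑ≈1 = trans (*-comm _ _) (proj₂ inverse)

-- Sums restricted to a set of indices.

module RestrictedSums {c ℓ₁ ℓ₂} (ℝ : CompleteOrderedField c ℓ₁ ℓ₂) where
  open Perron ℝ public
  open Solver using (solve; _:=_; _:+_; _:*_; _:-_; :-_)

  -- Unfolds to the entries of `adjacencyMatrix`, so results about that matrix apply without
  -- conversion.
  ι : Bool → Carrier
  ι t = if t then 1# else 0#

  ι≥0 : ∀ t → 0# ≤ ι t
  ι≥0 false = ≤-refl
  ι≥0 true  = 0≤1

  ι≤1 : ∀ t → ι t ≤ 1#
  ι≤1 false = 0≤1
  ι≤1 true  = ≤-refl

  ι-mono : ∀ t {y z} → (t ≡ true → y ≤ z) → ι t * y ≤ ι t * z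
  ι-mono false y≤z = ≈⇒≤ (trans (zeroˡ _) (sym (zeroˡ _)))
  ι-mono true  y≤z = ≤-resp-≈ (sym (*-identityˡ _)) (sym (*-identityˡ _)) (y≤z ≡.refl)

  ι-cong : ∀ t {y z} → (t ≡ true → y ≈ z) → ι t * y ≈ ι t * z
  ι-cong false y≈z = trans (zeroˡ _) (sym (zeroˡ _))
  ι-cong true  y≈z = *-congˡ (y≈z ≡.refl)

  ι-nonneg : ∀ t {y} → (t ≡ true → 0# ≤ y) → 0# ≤ ι t * y
  ι-nonneg t 0≤y = ≤-trans (≈⇒≤ (sym (zeroʳ _))) (ι-mono t 0≤y)

  ι-true : ∀ {t} y → t ≡ true → ι t * y ≈ y
  ι-true y ≡.refl = *-identityˡ y

  ι*≤ : ∀ t {y} → 0# ≤ y → ι t * y ≤ y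
  ι*≤ false 0≤y = ≤-trans (≈⇒≤ (zeroˡ _)) 0≤y
  ι*≤ true  0≤y = ≈⇒≤ (*-identityˡ _)

  opaque
    ∑⟨_⟩ : ∀ {n} → (Fin n → Bool) → (Fin n → Carrier) → Carrier
    ∑⟨ P ⟩ f = ∑ λ i → ι (P i) * f i

    ∑⟨⟩≡ : ∀ {n} {P : Fin n → Bool} (f : Fin n → Carrier) → ∑⟨ P ⟩ f ≡ ∑ (λ i → ι (P i) * f i)
    ∑⟨⟩≡ f = ≡.refl

    ∑⟨⟩-mono : ∀ {n} {P : Fin n → Bool} {f g : Fin n → Carrier} → (∀ i → P i ≡ true → f i ≤ g i) → ∑⟨ P ⟩ f ≤ ∑⟨ P ⟩ g
    ∑⟨⟩-mono {P = P} f≤g = ∑-mono λ i → ι-mono (P i) (f≤g i)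

    ∑⟨⟩-cong : ∀ {n} {P : Fin n → Bool} {f g : Fin n → Carrier} → (∀ i → P i ≡ true → f i ≈ g i) → ∑⟨ P ⟩ f ≈ ∑⟨ P ⟩ g
    ∑⟨⟩-cong {P = P} f≈g = ∑-cong λ i → ι-cong (P i) (f≈g i)

    ∑⟨⟩-0 : ∀ {n} {P : Fin n → Bool} {f : Fin n → Carrier} → (∀ i → P i ≡ true → f i ≈ 0#) → ∑⟨ P ⟩ f ≈ 0#
    ∑⟨⟩-0 {P = P} f≈0 = ∑-0 λ i → trans (ι-cong (P i) (f≈0 i)) (zeroʳ _)

    ∑⟨⟩-nonneg : ∀ {n} {P : Fin n → Bool} {f : Fin n → Carrier} → (∀ i → P i ≡ true → 0# ≤ f i) → 0# ≤ ∑⟨ P ⟩ f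
    ∑⟨⟩-nonneg {P = P} 0≤f = ∑-nonneg λ i → ι-nonneg (P i) (0≤f i)

    ∑⟨⟩-+ : ∀ {n} {P : Fin n → Bool} (f g : Fin n → Carrier) → ∑⟨ P ⟩ (λ i → f i + g i) ≈ ∑⟨ P ⟩ f + ∑⟨ P ⟩ g
    ∑⟨⟩-+ f g = trans (∑-cong λ i → distribˡ _ _ _) (∑-+ _ _)

    ∑⟨⟩-- : ∀ {n} {P : Fin n → Bool} (f g : Fin n → Carrier) → ∑⟨ P ⟩ (λ i → f i - g i) ≈ ∑⟨ P ⟩ f - ∑⟨ P ⟩ g
    ∑⟨⟩-- f g = trans (∑-cong λ i → solve 3 (λ a f g → a :* (f :- g) := a :* f :- a :* g) refl _ (f i) (g i)) (∑-- _ _)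

    ∑⟨⟩-* : ∀ {n} {P : Fin n → Bool} k (f : Fin n → Carrier) → ∑⟨ P ⟩ (λ i → k * f i) ≈ k * ∑⟨ P ⟩ f
    ∑⟨⟩-* k f = trans (∑-cong λ i → solve 3 (λ a k f → a :* (k :* f) := k :* (a :* f)) refl _ k (f i)) (∑-* k _)

    term≤∑⟨⟩ : ∀ {n} {P : Fin n → Bool} {f : Fin n → Carrier} → (∀ i → P i ≡ true → 0# ≤ f i) → ∀ {i} → P i ≡ true → f i ≤ ∑⟨ P ⟩ f
    term≤∑⟨⟩ {P = P} 0≤f {i} Pi = ≤-trans (≈⇒≤ (sym (ι-true _ Pi))) (term≤∑ (λ i → ι-nonneg (P i) (0≤f i)) i)

    twoTerms≤∑⟨⟩ : ∀ {n} {P : Fin n → Bool} {f : Fin n → Carrier} → (∀ i → P i ≡ true → 0# ≤ f i) →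
                   ∀ {i j} → P i ≡ true → P j ≡ true → i ≢ j → f i + f j ≤ ∑⟨ P ⟩ f
    twoTerms≤∑⟨⟩ {P = P} 0≤f Pi Pj i≢j = ≤-trans (≈⇒≤ (sym (+-cong (ι-true _ Pi) (ι-true _ Pj)))) (twoTerms≤∑ (λ i → ι-nonneg (P i) (0≤f i)) i≢j)

    ∑⟨⟩≤∑ : ∀ {n} {P : Fin n → Bool} {f : Fin n → Carrier} → (∀ i → 0# ≤ f i) → ∑⟨ P ⟩ f ≤ ∑ f
    ∑⟨⟩≤∑ {P = P} 0≤f = ∑-mono λ i → ι*≤ (P i) (0≤f i)

    ∑⟨⟩-complement : ∀ {n} {P : Fin n → Bool} (f : Fin n → Carrier) → ∑ f ≈ ∑⟨ P ⟩ f + ∑⟨ (λ i → not (P i)) ⟩ f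
    ∑⟨⟩-complement {P = P} f = trans (∑-cong λ i → split (P i) (f i)) (∑-+ _ _)
      where
      split : ∀ t y → y ≈ ι t * y + ι (not t) * y
      split false y = sym (trans (+-cong (zeroˡ y) (*-identityˡ y)) (+-identityˡ y))
      split true  y = sym (trans (+-cong (*-identityˡ y) (zeroˡ y)) (+-identityʳ y))

    ∑⟨⟩-comm : ∀ {m n} {P : Fin m → Bool} {Q : Fin n → Bool} (f : Fin m → Fin n → Carrier) →
               ∑⟨ P ⟩ (λ i → ∑⟨ Q ⟩ (f i)) ≈ ∑⟨ Q ⟩ (λ j → ∑⟨ P ⟩ (λ i → f i j))
    ∑⟨⟩-comm {P = P} {Q} f = trans (∑-cong λ i → sym (∑-* _ _)) (trans (∑-comm _) (∑-cong λ j →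
      trans (∑-cong λ i → solve 3 (λ a b f → a :* (b :* f) := b :* (a :* f)) refl (ι (P i)) (ι (Q j)) (f i j)) (∑-* _ _)))

  threeTerms≤∑ : ∀ {n} {f : Fin n → Carrier} → (∀ i → 0# ≤ f i) →
                 ∀ {i j k} → i ≢ j → i ≢ k → j ≢ k → f i + f j + f k ≤ ∑ f
  threeTerms≤∑ {zero} 0≤f {i = ()}
  threeTerms≤∑ {suc n} {f} 0≤f {i} {j} {k} i≢j i≢k j≢k = ≤-trans (go i j k i≢j i≢k j≢k) (≈⇒≤ (reflexive (≡.sym (∑-suc f))))
    where
    f′ : Fin n → Carrier
    f′ l = f (suc l)
    0≤f′ : ∀ l → 0# ≤ f′ l
    0≤f′ l = 0≤f (suc l)
    pred≢ : ∀ {i j : Fin n} → suc i ≢ suc j → i ≢ j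
    pred≢ i≢j i≡j = i≢j (≡.cong suc i≡j)
    go : ∀ i j k → i ≢ j → i ≢ k → j ≢ k → f i + f j + f k ≤ f zero + ∑ f′
    go zero    zero    k       i≢j i≢k j≢k = ⊥-elim (i≢j ≡.refl)
    go zero    (suc j) zero    i≢j i≢k j≢k = ⊥-elim (i≢k ≡.refl)
    go zero    (suc j) (suc k) i≢j i≢k j≢k = ≤-trans (≈⇒≤ (+-assoc _ _ _)) (+-monoʳ-≤ _ (twoTerms≤∑ 0≤f′ (pred≢ j≢k)))
    go (suc i) zero    zero    i≢j i≢k j≢k = ⊥-elim (j≢k ≡.refl)
    go (suc i) zero    (suc k) i≢j i≢k j≢k = ≤-trans (≈⇒≤ (trans (+-congʳ (+-comm _ _)) (+-assoc _ _ _))) (+-monoʳ-≤ _ (twoTerms≤∑ 0≤f′ (pred≢ i≢k)))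
    go (suc i) (suc j) zero    i≢j i≢k j≢k = ≤-trans (≈⇒≤ (+-comm _ _)) (+-monoʳ-≤ _ (twoTerms≤∑ 0≤f′ (pred≢ i≢j)))
    go (suc i) (suc j) (suc k) i≢j i≢k j≢k = ≤-trans (threeTerms≤∑ 0≤f′ (pred≢ i≢j) (pred≢ i≢k) (pred≢ j≢k))
      (≤-by (0≤f zero) (solve 2 (λ x y → x := (x :+ y) :- y) refl (f zero) (∑ f′)))

-- Counting walks around the vertex of maximal value.

module MaximalVertex {c ℓ₁ ℓ₂} (ℝ : CompleteOrderedField c ℓ₁ ℓ₂) where
  open RestrictedSums ℝ public
  open Solver using (solve; _:=_; _:+_; _:*_; _:-_; :-_)

  -- Inclusion and exclusion at a single index: y is counted twice only on the intersection, and
  -- there K makes up for the second copy.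
  ι-overlap : ∀ s t {y K} → 0# ≤ y → y ≤ K → ι s * y + ι t * y ≤ y + K * (ι s * ι t)
  ι-overlap false false {y} {K} 0≤y y≤K = ≤-by 0≤y (solve 2 (λ y K → y := (y :+ K :* (:# 0 :* :# 0)) :- (:# 0 :* y :+ :# 0 :* y)) refl y K)
  ι-overlap false true  {y} {K} 0≤y y≤K = ≈⇒≤ (solve 2 (λ y K → :# 0 :* y :+ :# 1 :* y := y :+ K :* (:# 0 :* :# 1)) refl y K)
  ι-overlap true  false {y} {K} 0≤y y≤K = ≈⇒≤ (solve 2 (λ y K → :# 1 :* y :+ :# 0 :* y := y :+ K :* (:# 1 :* :# 0)) refl y K)
  ι-overlap true  true  {y} {K} 0≤y y≤K = ≤-by ⌊ y≤K ⌋ (solve 2 (λ y K → K :- y := (y :+ K :* (:# 1 :* :# 1)) :- (:# 1 :* y :+ :# 1 :* y)) refl y K)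

  module Split {n} (adj : Fin n → Fin n → Bool) (adj-sym : ∀ u v → adj u v ≡ adj v u)
               {ρ : Carrier} (0≤ρ : 0# ≤ ρ) (perronVector : PerronVector (λ u v → ι (adj u v)) ρ) where

    open PerronVector perronVector public renaming (top to e)

    a : Fin n → Fin n → Carrier
    a u v = ι (adj u v)

    a-sym : ∀ u v → a u v ≡ a v u
    a-sym u v = ≡.cong ι (adj-sym u v)

    N A : Fin n → Bool
    N v = adj e v
    A v = not (adj e v)

    -- transfer v is the part of ρ² x v carried by walks of length two from v through A into N.
    degreeᴺ weightᴺ weightᴬ transfer : Fin n → Carrier
    degreeᴺ u  = ∑⟨ N ⟩ λ v → a v u
    weightᴺ u  = ∑⟨ N ⟩ λ v → a u v * x v
    weightᴬ u  = ∑⟨ A ⟩ λ v → a u v * x v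
    transfer v = ∑⟨ A ⟩ λ u → a v u * weightᴺ u

    -- In the notation of the overview, `degreeᴺ` is d_N, `weightᴺ` is p, `transfer` is T_v and
    -- `totalTransfer` is T. Edges are summed in both orders, so `edgesᴬ` is 2 e(A).
    totalTransfer edgesᴬ deficit excess spread : Carrier
    totalTransfer = ∑⟨ A ⟩ weightᴺ
    edgesᴬ        = ∑⟨ A ⟩ λ u → ∑⟨ A ⟩ λ v → a u v
    deficit       = ∑⟨ A ⟩ λ u → degreeᴺ u * (1# - x u)
    excess        = ∑⟨ N ⟩ λ u → ∑⟨ N ⟩ λ v → a u v * (x u + x v - 1#)
    spread        = ∑⟨ N ⟩ λ v → x v * (totalTransfer - transfer v)

    eigen : ∀ u → ρ * x u ≈ ∑ λ v → a u v * x v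
    eigen u = sym (eigenvector u)

    ∑ᴺx≈ρ : ∑⟨ N ⟩ x ≈ ρ
    ∑ᴺx≈ρ = trans (reflexive (∑⟨⟩≡ x)) (trans (eigenvector e) (trans (*-congˡ x-top) (*-identityʳ ρ)))

    eigen-split : ∀ u → ρ * x u ≈ weightᴺ u + weightᴬ u
    eigen-split u = trans (eigen u) (∑⟨⟩-complement _)

    weightᴺ-e : weightᴺ e ≈ ρ
    weightᴺ-e = trans (∑⟨⟩-cong λ v Nv → ι-true (x v) Nv) ∑ᴺx≈ρ

    ax≥0 : ∀ u v → 0# ≤ a u v * x v
    ax≥0 u v = ι≥0 _ ⊗ x≥0 v

    weightᴺ≥0 : ∀ u → 0# ≤ weightᴺ u
    weightᴺ≥0 u = ∑⟨⟩-nonneg λ v _ → ax≥0 u v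

    weightᴬ≥0 : ∀ u → 0# ≤ weightᴬ u
    weightᴬ≥0 u = ∑⟨⟩-nonneg λ v _ → ax≥0 u v

    weightᴺ≤ρx : ∀ u → weightᴺ u ≤ ρ * x u
    weightᴺ≤ρx u = ≤-by (weightᴬ≥0 u) (trans (solve 2 (λ p g → g := (p :+ g) :- p) refl _ _) (+-congʳ (sym (eigen-split u))))

    ρx≤ρ : ∀ u → ρ * x u ≤ ρ
    ρx≤ρ u = ≤-by (0≤ρ ⊗ ⌊ x≤1 u ⌋) (solve 2 (λ ρ x → ρ :* (:# 1 :- x) := ρ :- ρ :* x) refl ρ (x u))

    weightᴺ≤ρ : ∀ u → weightᴺ u ≤ ρ
    weightᴺ≤ρ u = ≤-trans (weightᴺ≤ρx u) (ρx≤ρ u)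

    weightᴺ≤degreeᴺ : ∀ u → weightᴺ u ≤ degreeᴺ u
    weightᴺ≤degreeᴺ u = ∑⟨⟩-mono λ v _ → ≤-trans (≈⇒≤ (*-congʳ (reflexive (a-sym u v))))
      (≤-by (ι≥0 _ ⊗ ⌊ x≤1 v ⌋) (solve 2 (λ a x → a :* (:# 1 :- x) := a :- a :* x) refl (a v u) (x v)))

    deficit-term≥0 : ∀ u → 0# ≤ degreeᴺ u * (1# - x u)
    deficit-term≥0 u = ≤-trans (weightᴺ≥0 u) (weightᴺ≤degreeᴺ u) ⊗ ⌊ x≤1 u ⌋

    deficit≥0 : 0# ≤ deficit
    deficit≥0 = ∑⟨⟩-nonneg λ u _ → deficit-term≥0 u

    edgesᴬ≥0 : 0# ≤ edgesᴬ
    edgesᴬ≥0 = ∑⟨⟩-nonneg λ u _ → ∑⟨⟩-nonneg λ v _ → ι≥0 _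

    transfer≤total : ∀ v → transfer v ≤ totalTransfer
    transfer≤total v = ∑⟨⟩-mono λ u _ → ι*≤ _ (weightᴺ≥0 u)

    spread-term≥0 : ∀ v → 0# ≤ x v * (totalTransfer - transfer v)
    spread-term≥0 v = x≥0 v ⊗ ⌊ transfer≤total v ⌋

    degree-sum : ∑ (λ u → ∑ λ v → a u v) ≈ ∑⟨ N ⟩ (λ v → ∑⟨ N ⟩ (a v)) + ∑⟨ A ⟩ degreeᴺ + (∑⟨ A ⟩ degreeᴺ + edgesᴬ)
    degree-sum = trans (∑⟨⟩-complement {P = N} _) (+-cong
      (trans (∑⟨⟩-cong λ v _ → ∑⟨⟩-complement {P = N} _) (trans (∑⟨⟩-+ _ _) (+-congˡ (∑⟨⟩-comm _))))
      (trans (∑⟨⟩-cong λ v _ → ∑⟨⟩-complement {P = N} _) (trans (∑⟨⟩-+ _ _) (+-congʳ (∑⟨⟩-cong λ u _ → ∑⟨⟩-cong λ v _ → reflexive (a-sym u v))))))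

    -- Twice the edge count, against twice the sum ρ² = Σ x over the walks of length two from e.
    edge-count : ∀ {m} → # 2 * m ≈ ∑ (λ u → ∑ λ v → a u v) → m - 1# < ρ * ρ →
                 # 2 * deficit + edgesᴬ < # 2 + excess
    edge-count {m} 2m≈ m-1<ρ² = <-by (*-positive (#>0 1) ⌊ m-1<ρ² ⌋⁺) (trans
      (trans (solve 2 (λ m R → :# 2 :* (R :- (m :- :# 1)) := :# 2 :* R :+ :# 2 :- :# 2 :* m) refl m (ρ * ρ))
             (+-cong (+-congʳ (*-congˡ ρ²≈)) (-‿cong (trans 2m≈ degree-sum))))
      (trans (solve 5 (λ X Y NN C E → :# 2 :* (X :+ Y) :+ :# 2 :- (NN :+ C :+ (C :+ E)) := (:# 2 :+ (X :+ X :- NN)) :- (:# 2 :* (C :- Y) :+ E)) refl X Y NN C edgesᴬ)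
             (sym (+-cong (+-congˡ excess≈) (-‿cong (+-congʳ (*-congˡ deficit≈)))))))
      where
      X Y NN C : Carrier
      X  = ∑⟨ N ⟩ λ v → ∑⟨ N ⟩ λ u → a v u * x u
      Y  = ∑⟨ A ⟩ λ u → degreeᴺ u * x u
      NN = ∑⟨ N ⟩ λ v → ∑⟨ N ⟩ λ u → a v u
      C  = ∑⟨ A ⟩ degreeᴺ
      ρ²≈ : ρ * ρ ≈ X + Y
      ρ²≈ = trans (*-congˡ (sym ∑ᴺx≈ρ)) (trans (sym (∑⟨⟩-* ρ x)) (trans (∑⟨⟩-cong λ v _ → trans (eigen v) (∑⟨⟩-complement {P = N} _))
        (trans (∑⟨⟩-+ _ _) (+-congˡ (trans (∑⟨⟩-comm _) (∑⟨⟩-cong λ u _ → trans (∑⟨⟩-cong λ v _ → *-comm _ _) (trans (∑⟨⟩-* (x u) _) (*-comm _ _))))))))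
      deficit≈ : deficit ≈ C - Y
      deficit≈ = trans (∑⟨⟩-cong λ u _ → solve 2 (λ c x → c :* (:# 1 :- x) := c :- c :* x) refl (degreeᴺ u) (x u)) (∑⟨⟩-- _ _)
      excess≈ : excess ≈ X + X - NN
      excess≈ = trans (∑⟨⟩-cong λ u _ → trans (∑⟨⟩-cong λ v _ → solve 3 (λ a x y → a :* (x :+ y :- :# 1) := (a :* x :+ a :* y) :- a) refl (a u v) (x u) (x v))
                   (trans (∑⟨⟩-- _ _) (+-congʳ (∑⟨⟩-+ _ _))))
                 (trans (∑⟨⟩-- _ _) (+-congʳ (trans (∑⟨⟩-+ _ _) (+-congʳ
                   (trans (∑⟨⟩-comm _) (∑⟨⟩-cong λ v _ → ∑⟨⟩-cong λ u _ → *-congʳ (reflexive (a-sym u v))))))))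

    -- The values on N sum to ρ, so the T-part is Σ ρ p_u over A; exchanging the two summations
    -- turns Σ x_v T_v into Σ p_u².
    spread≈ : spread ≈ ∑⟨ A ⟩ λ u → weightᴺ u * (ρ - weightᴺ u)
    spread≈ = trans (∑⟨⟩-cong λ v _ → solve 3 (λ x T t → x :* (T :- t) := T :* x :- x :* t) refl (x v) totalTransfer (transfer v))
      (trans (∑⟨⟩-- _ _) (trans (+-cong (trans (∑⟨⟩-* _ _) (trans (*-congˡ ∑ᴺx≈ρ) (trans (*-comm _ _) (sym (∑⟨⟩-* ρ weightᴺ)))))
          (-‿cong (trans (∑⟨⟩-cong λ v _ → sym (∑⟨⟩-* (x v) _)) (trans (∑⟨⟩-comm _) (∑⟨⟩-cong λ u _ →
             trans (∑⟨⟩-cong λ v _ → trans (*-congˡ (*-congʳ (reflexive (a-sym v u)))) (solve 3 (λ x a w → x :* (a :* w) := w :* (a :* x)) refl (x v) (a u v) (weightᴺ u)))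
                   (∑⟨⟩-* (weightᴺ u) _))))))
      (trans (sym (∑⟨⟩-- _ _)) (∑⟨⟩-cong λ u _ → solve 2 (λ ρ p → ρ :* p :- p :* p := p :* (ρ :- p)) refl ρ (weightᴺ u)))))

    -- In ρ² x_v = Σ ρ x_u over the neighbours u of v, those in N give exactly ρ p_v, and for those
    -- in A the bound ρ x_u ≥ p_u forgets the walks that end in A.
    transfer-lower : ∀ v → ρ * weightᴺ v + transfer v ≤ ρ * (ρ * x v)
    transfer-lower v = ≤-trans (+-mono-≤ (≈⇒≤ (trans (sym (∑⟨⟩-* ρ _)) (∑⟨⟩-cong λ u _ → solve 3 (λ a ρ x → ρ :* (a :* x) := a :* (ρ :* x)) refl (a v u) ρ (x u))))
        (∑⟨⟩-mono λ u _ → ≤-by (ι≥0 _ ⊗ ⌊ weightᴺ≤ρx u ⌋) (solve 3 (λ a p q → a :* (p :- q) := a :* p :- a :* q) refl (a v u) (ρ * x u) (weightᴺ u))))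
      (≈⇒≤ (trans (sym (∑⟨⟩-complement _)) (trans (∑-cong λ u → solve 3 (λ a ρ x → a :* (ρ :* x) := ρ :* (a :* x)) refl (a v u) ρ (x u))
        (trans (∑-* ρ _) (*-congˡ (sym (eigen v)))))))

    neighbour≤weightᴺ : ∀ {u v} → N v ≡ true → adj u v ≡ true → x v ≤ weightᴺ u
    neighbour≤weightᴺ {u} Nv u~v = ≤-trans (≈⇒≤ (sym (ι-true _ u~v))) (term≤∑⟨⟩ (λ v _ → ax≥0 u v) Nv)

    transfer≤ρ²x : ∀ v → transfer v ≤ ρ * (ρ * x v)
    transfer≤ρ²x v = ≤-trans (≤-by (0≤ρ ⊗ weightᴺ≥0 v) (solve 2 (λ w t → w := (w :+ t) :- t) refl (ρ * weightᴺ v) (transfer v))) (transfer-lower v)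

    -- The walks forgotten by `transfer-lower` have their last step inside A and weight at most 1,
    -- so together they weigh at most `edgesᴬ`.
    transfer-upper : ∀ v → ρ * (ρ * x v) ≤ ρ * weightᴺ v + transfer v + edgesᴬ
    transfer-upper v = ≤-trans (≈⇒≤ (trans (*-congˡ (eigen-split v)) (trans (distribˡ _ _ _) (+-congˡ
        (trans (sym (∑⟨⟩-* ρ _)) (∑⟨⟩-cong λ u _ → trans (solve 3 (λ a ρ x → ρ :* (a :* x) := a :* (ρ :* x)) refl (a v u) ρ (x u)) (*-congˡ (eigen-split u))))))))
      (≤-trans (+-monoʳ-≤ _ (≤-trans (≈⇒≤ (trans (∑⟨⟩-cong λ u _ → distribˡ _ _ _) (∑⟨⟩-+ _ _)))
          (+-monoʳ-≤ _ (∑⟨⟩-mono λ u _ → ≤-trans (ι*≤ _ (weightᴬ≥0 u)) (∑⟨⟩-mono λ w _ →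
            ≤-by (ι≥0 _ ⊗ ⌊ x≤1 w ⌋) (solve 2 (λ a x → a :* (:# 1 :- x) := a :- a :* x) refl (a u w) (x w)))))))
        (≈⇒≤ (sym (+-assoc _ _ _))))

    A-e : adj e e ≡ false → A e ≡ true
    A-e ee = ≡.cong not ee

    module Codegree (r : Carrier) (codegree : ∀ {u v} → adj u v ≡ true → ∑ (λ w → a u w * a v w) ≤ r) where

      codegreeᴾ : ∀ {P : Fin n → Bool} {u v} → adj u v ≡ true → ∑⟨ P ⟩ (λ w → a u w * a v w) ≤ r
      codegreeᴾ u~v = ≤-trans (∑⟨⟩≤∑ λ w → ι≥0 _ ⊗ ι≥0 _) (codegree u~v)

      weights≤ : ∀ {u v} → adj u v ≡ true → weightᴺ u + weightᴺ v ≤ ρ + r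
      weights≤ {u} {v} u~v = ≤-trans (≈⇒≤ (sym (∑⟨⟩-+ _ _))) (≤-trans (∑⟨⟩-mono λ w _ →
          ≤-trans (ι-overlap (adj u w) (adj v w) (x≥0 w) (x≤1 w)) (≈⇒≤ (+-congˡ (*-identityˡ _))))
        (≤-trans (≈⇒≤ (∑⟨⟩-+ _ _)) (+-mono-≤ (≈⇒≤ ∑ᴺx≈ρ) (codegreeᴾ u~v))))

      transfers≤ : ∀ {u v} → adj u v ≡ true → transfer u + transfer v ≤ totalTransfer + ρ * r
      transfers≤ {u} {v} u~v = ≤-trans (≈⇒≤ (sym (∑⟨⟩-+ _ _))) (≤-trans (∑⟨⟩-mono λ w _ →
          ι-overlap (adj u w) (adj v w) (weightᴺ≥0 w) (weightᴺ≤ρ w))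
        (≤-trans (≈⇒≤ (trans (∑⟨⟩-+ _ _) (+-congˡ (∑⟨⟩-* ρ _)))) (+-monoʳ-≤ _
          (≤-by (0≤ρ ⊗ ⌊ codegreeᴾ u~v ⌋) (solve 3 (λ ρ r s → ρ :* (r :- s) := ρ :* r :- ρ :* s) refl ρ r _)))))

      -- Neighbours of v inside N are common neighbours of the adjacent vertices e and v.
      degreeᴺ≤r : ∀ {v} → N v ≡ true → degreeᴺ v ≤ r
      degreeᴺ≤r {v} Nv = ≤-trans (≈⇒≤ (trans (reflexive (∑⟨⟩≡ _)) (∑-cong λ w → *-congˡ (reflexive (a-sym w v))))) (codegree Nv)

      weightᴺ≤r : ∀ {v} → N v ≡ true → weightᴺ v ≤ r
      weightᴺ≤r Nv = ≤-trans (weightᴺ≤degreeᴺ _) (degreeᴺ≤r Nv)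

      -- By the eigenvalue equation ρ - p_u = ρ(1 - x_u) + `weightᴬ` u. As p_u is at most `degreeᴺ`
      -- u, the first part sums to at most ρ times `deficit`. The second is symmetrised over the
      -- edges uv inside A, where p_u + p_v ≤ ρ + r.
      spread-upper : # 2 * spread ≤ # 2 * ρ * deficit + (ρ + r) * edgesᴬ
      spread-upper = ≤-trans (≈⇒≤ (*-congˡ (trans spread≈ (trans (∑⟨⟩-cong λ u _ → term u) (∑⟨⟩-+ _ _)))))
        (≤-by (#≥0 2 ⊗ ⌊ bound₁ ⌋ ⊕ ⌊ bound₂ ⌋)
          (solve 5 (λ X Y ρ d w → :# 2 :* (ρ :* d :- X) :+ (w :- :# 2 :* Y) := (:# 2 :* ρ :* d :+ w) :- :# 2 :* (X :+ Y)) refl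
            (∑⟨ A ⟩ λ u → weightᴺ u * (ρ * (1# - x u))) (∑⟨ A ⟩ λ u → weightᴺ u * weightᴬ u) ρ deficit ((ρ + r) * edgesᴬ)))
        where
        term : ∀ u → weightᴺ u * (ρ - weightᴺ u) ≈ weightᴺ u * (ρ * (1# - x u)) + weightᴺ u * weightᴬ u
        term u = trans (*-congˡ (trans (solve 4 (λ ρ p g x → ρ :- p := (ρ :- (p :+ g)) :+ g) refl ρ (weightᴺ u) (weightᴬ u) (x u))
            (+-congʳ (+-congˡ (-‿cong (sym (eigen-split u)))))))
          (solve 4 (λ ρ p g x → p :* ((ρ :- ρ :* x) :+ g) := p :* (ρ :* (:# 1 :- x)) :+ p :* g) refl ρ (weightᴺ u) (weightᴬ u) (x u))
        bound₁ : ∑⟨ A ⟩ (λ u → weightᴺ u * (ρ * (1# - x u))) ≤ ρ * deficit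
        bound₁ = ≤-trans (∑⟨⟩-mono λ u _ → ≤-by (0≤ρ ⊗ ⌊ x≤1 u ⌋ ⊗ ⌊ weightᴺ≤degreeᴺ u ⌋)
            (solve 4 (λ ρ x p c → ρ :* (:# 1 :- x) :* (c :- p) := ρ :* (c :* (:# 1 :- x)) :- p :* (ρ :* (:# 1 :- x))) refl ρ (x u) (weightᴺ u) (degreeᴺ u)))
          (≈⇒≤ (∑⟨⟩-* ρ _))
        bound₂ : # 2 * ∑⟨ A ⟩ (λ u → weightᴺ u * weightᴬ u) ≤ (ρ + r) * edgesᴬ
        bound₂ = ≤-trans (≤-by (#≥0 2 ⊗ ⌊ half ⌋) (solve 2 (λ X Y → :# 2 :* (Y :- X) := (Y :+ Y) :- :# 2 :* X) refl _ _))
          (≤-trans (≈⇒≤ (trans (+-congˡ (trans (∑⟨⟩-comm _) (∑⟨⟩-cong λ v _ → ∑⟨⟩-cong λ u _ → *-congʳ (reflexive (a-sym u v)))))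
              (trans (sym (∑⟨⟩-+ _ _)) (∑⟨⟩-cong λ u _ → trans (sym (∑⟨⟩-+ _ _)) (∑⟨⟩-cong λ v _ → sym (distribˡ _ _ _))))))
          (≤-trans (∑⟨⟩-mono λ u _ → ≤-trans (∑⟨⟩-mono λ v _ → ≤-trans (ι-mono (adj u v) weights≤) (≈⇒≤ (*-comm _ _))) (≈⇒≤ (∑⟨⟩-* (ρ + r) _)))
            (≈⇒≤ (∑⟨⟩-* (ρ + r) _))))
          where
          half : ∑⟨ A ⟩ (λ u → weightᴺ u * weightᴬ u) ≤ ∑⟨ A ⟩ λ u → ∑⟨ A ⟩ λ v → a u v * weightᴺ u
          half = ∑⟨⟩-mono λ u _ → ≤-trans (≈⇒≤ (sym (∑⟨⟩-* (weightᴺ u) _))) (∑⟨⟩-mono λ v _ →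
            ≤-by (weightᴺ≥0 u ⊗ (ι≥0 _ ⊗ ⌊ x≤1 v ⌋)) (solve 3 (λ p a x → p :* (a :* (:# 1 :- x)) := a :* p :- p :* (a :* x)) refl (weightᴺ u) (a u v) (x v)))

-- Polynomial inequalities with explicit constants.

module Estimates {c ℓ₁ ℓ₂} (ℝ : CompleteOrderedField c ℓ₁ ℓ₂) where
  open MaximalVertex ℝ public
  open Solver using (solve; _:=_; _:+_; _:*_; _:-_; :-_)

  module Large {ρ r : Carrier} (1≤r : 1# ≤ r) (239r≤ρ : # 239 * r ≤ ρ) where

    0<r : 0# < r
    0<r = <-≤-trans 0<1 1≤r

    0≤r : 0# ≤ r
    0≤r = <⇒≤ 0<r

    0<ρ : 0# < ρ
    0<ρ = <-≤-trans (*-positive (#>0 238) 0<r) 239r≤ρ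

    0≤ρ : 0# ≤ ρ
    0≤ρ = <⇒≤ 0<ρ

    239≤ρ : # 239 ≤ ρ
    239≤ρ = ≤-by (⌊ 239r≤ρ ⌋ ⊕ #≥0 239 ⊗ ⌊ 1≤r ⌋) (solve 2 (λ ρ r → (ρ :- :# 239 :* r) :+ :# 239 :* (r :- :# 1) := ρ :- :# 239) refl ρ r)

    -- In the estimates T is totalTransfer, S is slack, E is edgesᴬ, F is spread, Q is deficit and β is cover.
    cover-small : ∀ {β T S E} → 0# ≤ β → β ≤ ρ → S ≤ # 2 + # 2 * (r * β) → E ≤ S →
                  β * (T - ρ * r) ≤ (ρ + r) * S → ρ * ρ ≤ # 2 * (ρ * r + T + E) → ρ * β ≤ # 5
    cover-small {β} {T} {S} {E} 0≤β β≤ρ S≤ E≤S βT≤ ρ²≤ =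
      *-cancelˡ-≤ (#>0 8) (≤-trans (*-cancelˡ-≤ 0<ρ main) (≤-by (#≥0 4) (solve 0 (:# 4 := :# 9 :* :# 5 :- :# 41) refl)))
      where
      lower : # 9 * (ρ * ρ) ≤ # 10 * (ρ * ρ - # 12 * (ρ * r) - # 4 * (r * r) - # 4)
      lower = ≤-by (0≤ρ ⊗ ⌊ 239r≤ρ ⌋ ⊕ #≥0 119 ⊗ (0≤r ⊗ ⌊ 239r≤ρ ⌋) ⊕ #≥0 28361 ⊗ square-nonneg r
                    ⊕ #≥0 40 ⊗ (square-nonneg (r - # 1) ⊕ #≥0 2 ⊗ ⌊ 1≤r ⌋))
        (solve 2 (λ ρ r → ρ :* (ρ :- :# 239 :* r) :+ :# 119 :* (r :* (ρ :- :# 239 :* r)) :+ :# 28361 :* (r :* r)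
                    :+ :# 40 :* ((r :- :# 1) :* (r :- :# 1) :+ :# 2 :* (r :- :# 1))
             := :# 10 :* (ρ :* ρ :- :# 12 :* (ρ :* r) :- :# 4 :* (r :* r) :- :# 4) :- :# 9 :* (ρ :* ρ)) refl ρ r)
      -- Heuristically T is at least about ρ²/2, so β ρ²/2 is at most about 2ρ and ρβ at most about
      -- 4. The lower-order terms cost a tenth of ρ² by `lower`, and the resulting 41/9 still lies
      -- below 5.
      main : ρ * (# 9 * (ρ * β)) ≤ ρ * # 41
      main = ≤-by (#≥0 20 ⊗ ⌊ βT≤ ⌋ ⊕ #≥0 20 ⊗ ((0≤ρ ⊕ 0≤r) ⊗ ⌊ S≤ ⌋) ⊕ #≥0 10 ⊗ (0≤β ⊗ ⌊ ρ²≤ ⌋) ⊕ #≥0 20 ⊗ (0≤β ⊗ ⌊ E≤S ⌋)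
                   ⊕ #≥0 20 ⊗ (0≤β ⊗ ⌊ S≤ ⌋) ⊕ #≥0 40 ⊗ (0≤β ⊗ 0≤r ⊗ ⌊ β≤ρ ⌋) ⊕ 0≤β ⊗ ⌊ lower ⌋ ⊕ ⌊ 239r≤ρ ⌋ ⊕ #≥0 199 ⊗ 0≤r)
        (solve 6 (λ ρ r β T S E →
            :# 20 :* ((ρ :+ r) :* S :- β :* (T :- ρ :* r)) :+ :# 20 :* ((ρ :+ r) :* (:# 2 :+ :# 2 :* (r :* β) :- S))
            :+ :# 10 :* (β :* (:# 2 :* (ρ :* r :+ T :+ E) :- ρ :* ρ)) :+ :# 20 :* (β :* (S :- E))
            :+ :# 20 :* (β :* (:# 2 :+ :# 2 :* (r :* β) :- S)) :+ :# 40 :* (β :* r :* (ρ :- β))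
            :+ β :* (:# 10 :* (ρ :* ρ :- :# 12 :* (ρ :* r) :- :# 4 :* (r :* r) :- :# 4) :- :# 9 :* (ρ :* ρ))
            :+ (ρ :- :# 239 :* r) :+ :# 199 :* r
          := ρ :* :# 41 :- ρ :* (:# 9 :* (ρ :* β))) refl ρ r β T S E)

    -- Since y ≤ 5/ρ, x is close to 1, and the walk bounds at both ends give T - t ≥ ρ² - O(ρ r).
    -- But y ≥ 3/(2ρ), because e contributes ρ to t, and y(T - t) ≤ F ≤ (ρ + r) 21/20; so T - t is
    -- at most 0.77 ρ².
    heavy-edge-impossible : ∀ {β T S E F t x y} → 0# ≤ β → ρ * β ≤ # 5 → S ≤ # 2 + # 2 * (r * β) → E ≤ S →
      # 2 * F ≤ (ρ + r) * S → t ≤ T → y * (T - t) ≤ F → 1# ≤ x + y → y ≤ β →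
      ρ * x + t ≤ ρ * (ρ * y) → ρ ≤ t → 0# ≤ x → ρ * (ρ * x) ≤ ρ * r + T + E → ⊥
    heavy-edge-impossible {β} {T} {S} {E} {F} {t} {x} {y} 0≤β ρβ≤5 S≤ E≤S F≤ t≤T ≤F 1≤x+y y≤β lower ρ≤t 0≤x upper =
      impossible ((⌊ 300[T-t]≤ ⌋ ⊕ #≥0 300 ⊗ ⌊ T-t≥ ⌋ ⊕ #≥0 56 ⊗ (0≤ρ ⊗ ⌊ 239≤ρ ⌋) ⊕ #≥0 10384 ⊗ ⌊ 239≤ρ ⌋ ⊕ #≥0 13 ⊗ (0≤ρ ⊗ ⌊ 239r≤ρ ⌋) ⊕ #≥0 2807 ⊗ (0≤ρ ⊗ 0≤r)) ⊕⁺ #>0 2480875)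
        (solve 4 (λ ρ r T t → :# 231 :* (ρ :* ρ) :- :# 300 :* (T :- t) :+ :# 300 :* ((T :- t) :- (ρ :* ρ :- :# 10 :* ρ :- ρ :* r :- :# 3))
            :+ :# 56 :* (ρ :* (ρ :- :# 239)) :+ :# 10384 :* (ρ :- :# 239) :+ :# 13 :* (ρ :* (ρ :- :# 239 :* r)) :+ :# 2807 :* (ρ :* r) :+ :# 2480876 := :# 0) refl ρ r T t)
      where
      ρy≤5 : ρ * y ≤ # 5
      ρy≤5 = ≤-trans (*-monoˡ-≤ 0≤ρ y≤β) ρβ≤5
      10S≤21 : # 10 * S ≤ # 21
      10S≤21 = *-cancelˡ-≤ (#>0 238) (≤-by (#≥0 2390 ⊗ ⌊ S≤ ⌋ ⊕ #≥0 20 ⊗ (0≤β ⊗ ⌊ 239r≤ρ ⌋) ⊕ #≥0 20 ⊗ ⌊ ρβ≤5 ⌋ ⊕ #≥0 139)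
        (solve 4 (λ ρ r β S → :# 2390 :* (:# 2 :+ :# 2 :* (r :* β) :- S) :+ :# 20 :* (β :* (ρ :- :# 239 :* r)) :+ :# 20 :* (:# 5 :- ρ :* β) :+ :# 139
          := :# 239 :* :# 21 :- :# 239 :* (:# 10 :* S)) refl ρ r β S))
      1≤2x : 1# ≤ # 2 * x
      1≤2x = *-cancelˡ-≤ 0<ρ (≤-by (#≥0 2 ⊗ (0≤ρ ⊗ ⌊ 1≤x+y ⌋) ⊕ #≥0 2 ⊗ ⌊ ρy≤5 ⌋ ⊕ ⌊ 239≤ρ ⌋ ⊕ #≥0 229)
        (solve 3 (λ ρ x y → :# 2 :* (ρ :* (x :+ y :- :# 1)) :+ :# 2 :* (:# 5 :- ρ :* y) :+ (ρ :- :# 239) :+ :# 229 := ρ :* (:# 2 :* x) :- ρ :* :# 1) refl ρ x y))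
      3≤2ρy : # 3 ≤ # 2 * (ρ * y)
      3≤2ρy = *-cancelˡ-≤ 0<ρ (≤-by (#≥0 2 ⊗ ⌊ lower ⌋ ⊕ #≥0 2 ⊗ ⌊ ρ≤t ⌋ ⊕ 0≤ρ ⊗ ⌊ 1≤2x ⌋)
        (solve 4 (λ ρ x y t → :# 2 :* (ρ :* (ρ :* y) :- (ρ :* x :+ t)) :+ :# 2 :* (t :- ρ) :+ ρ :* (:# 2 :* x :- :# 1) := ρ :* (:# 2 :* (ρ :* y)) :- ρ :* :# 3) refl ρ x y t))
      T-t≥ : ρ * ρ - # 10 * ρ - ρ * r - # 3 ≤ T - t
      T-t≥ = ≤-by (⌊ upper ⌋ ⊕ ⌊ E≤S ⌋ ⊕ 0≤3-S ⊕ 0≤ρ ⊗ (0≤ρ ⊗ ⌊ 1≤x+y ⌋) ⊕ ⌊ lower ⌋ ⊕ 0≤ρ ⊗ 0≤x ⊕ #≥0 2 ⊗ (0≤ρ ⊗ ⌊ ρy≤5 ⌋))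
        (solve 8 (λ ρ r x y t T E S → (ρ :* r :+ T :+ E :- ρ :* (ρ :* x)) :+ (S :- E) :+ (:# 3 :- S) :+ ρ :* (ρ :* (x :+ y :- :# 1)) :+ (ρ :* (ρ :* y) :- (ρ :* x :+ t))
              :+ ρ :* x :+ :# 2 :* (ρ :* (:# 5 :- ρ :* y))
           := (T :- t) :- (ρ :* ρ :- :# 10 :* ρ :- ρ :* r :- :# 3)) refl ρ r x y t T E S)
        where
        0≤3-S : 0# ≤ # 3 - S
        0≤3-S = ⌊ *-cancelˡ-≤ (#>0 9) (≤-trans 10S≤21 (≤-by (#≥0 9) (solve 0 (:# 9 := :# 10 :* :# 3 :- :# 21) refl))) ⌋
      300[T-t]≤ : # 300 * (T - t) ≤ # 231 * (ρ * ρ)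
      300[T-t]≤ = ≤-by (#≥0 100 ⊗ (⌊ t≤T ⌋ ⊗ ⌊ 3≤2ρy ⌋) ⊕ #≥0 200 ⊗ (0≤ρ ⊗ ⌊ ≤F ⌋) ⊕ #≥0 100 ⊗ (0≤ρ ⊗ ⌊ F≤ ⌋) ⊕ #≥0 10 ⊗ (0≤ρ ⊗ (0≤ρ ⊕ 0≤r) ⊗ ⌊ 10S≤21 ⌋)
                         ⊕ 0≤ρ ⊗ (#≥0 21 ⊗ ⌊ 239r≤ρ ⌋ ⊕ #≥0 4809 ⊗ 0≤r))
        (solve 7 (λ ρ r y t T S F → :# 100 :* ((T :- t) :* (:# 2 :* (ρ :* y) :- :# 3)) :+ :# 200 :* (ρ :* (F :- y :* (T :- t))) :+ :# 100 :* (ρ :* ((ρ :+ r) :* S :- :# 2 :* F))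
               :+ :# 10 :* (ρ :* (ρ :+ r) :* (:# 21 :- :# 10 :* S)) :+ ρ :* (:# 21 :* (ρ :- :# 239 :* r) :+ :# 4809 :* r)
           := :# 231 :* (ρ :* ρ) :- :# 300 :* (T :- t)) refl ρ r y t T S F)

    -- Since Tp is within ρ of T, Tq is at most ρ + ρr, so q is multiplied by at least U = T - 2ρ -
    -- ρr, up to ρ. With 1 + p ≤ ρq this yields pU < 4ρr, and ρ²p > T - ρ = V then gives VU < 4ρ³r.
    -- If T ≥ ρ²/7, however, V and U are at least 232/1673 and 218/1673 of ρ², where 1673 = 7 · 239,
    -- and the product is too large.
    total-small : ∀ {p q T Tp Tq} → ¬ (# 7 * T < ρ * ρ) → T - Tp < ρ → Tp ≤ T → Tp + Tq ≤ T + ρ * r → 0# ≤ p → 0# ≤ q →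
      p * (T - Tp) + q * (T - Tq) < ρ * (p + q) → 1# + p ≤ ρ * q → ρ * (ρ * p) ≤ ρ * r + T → Tp ≤ ρ * (ρ * p) → ⊥
    total-small {p} {q} {T} {Tp} {Tq} 7T≮ρ² T-Tp<ρ Tp≤T Tp+Tq≤ 0≤p 0≤q spread< 1+p≤ upper lower =
      impossible ((0≤1673V-232ρ² ⊗ 0≤1673U ⊕ #≥0 232 ⊗ (square-nonneg ρ ⊗ ⌊ U-bound ⌋) ⊕ #≥0 46844 ⊗ (0≤ρ ⊗ square-nonneg ρ ⊗ ⌊ 239r≤ρ ⌋)
                   ⊕ #≥0 3732 ⊗ (square-nonneg ρ ⊗ square-nonneg ρ)) ⊕⁺ *-positive (#>0 2798928) ⌊ VU< ⌋⁺)
        (solve 4 (λ ρ r U V →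
            (:# 1673 :* V :- :# 232 :* (ρ :* ρ)) :* (:# 1673 :* U) :+ :# 232 :* (ρ :* ρ :* (:# 1673 :* U :- :# 218 :* (ρ :* ρ)))
              :+ :# 46844 :* (ρ :* (ρ :* ρ) :* (ρ :- :# 239 :* r)) :+ :# 3732 :* (ρ :* ρ :* (ρ :* ρ)) :+ :# 2798929 :* (ρ :* ρ :* (:# 4 :* (ρ :* r)) :- V :* U)
            := :# 0) refl ρ r U V)
      where
      U V : Carrier
      U = T - # 2 * ρ - ρ * r
      V = T - ρ
      0≤r-1 = ⌊ 1≤r ⌋
      ρ²≤7T : ρ * ρ ≤ # 7 * T
      ρ²≤7T = ≮⇒≥ 7T≮ρ²
      U-bound : # 218 * (ρ * ρ) ≤ # 1673 * U
      U-bound = ≤-by (#≥0 239 ⊗ ⌊ ρ²≤7T ⌋ ⊕ #≥0 21 ⊗ (0≤ρ ⊗ ⌊ 239r≤ρ ⌋) ⊕ #≥0 3346 ⊗ (0≤ρ ⊗ 0≤r-1))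
        (solve 3 (λ ρ r T → :# 239 :* (:# 7 :* T :- ρ :* ρ) :+ :# 21 :* (ρ :* (ρ :- :# 239 :* r)) :+ :# 3346 :* (ρ :* (r :- :# 1))
           := :# 1673 :* (T :- :# 2 :* ρ :- ρ :* r) :- :# 218 :* (ρ :* ρ)) refl ρ r T)
      V-bound : # 232 * (ρ * ρ) ≤ # 1673 * V
      V-bound = ≤-by (#≥0 239 ⊗ ⌊ ρ²≤7T ⌋ ⊕ #≥0 7 ⊗ (0≤ρ ⊗ ⌊ 239r≤ρ ⌋) ⊕ #≥0 1673 ⊗ (0≤ρ ⊗ 0≤r-1))
        (solve 3 (λ ρ r T → :# 239 :* (:# 7 :* T :- ρ :* ρ) :+ :# 7 :* (ρ :* (ρ :- :# 239 :* r)) :+ :# 1673 :* (ρ :* (r :- :# 1))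
           := :# 1673 :* (T :- ρ) :- :# 232 :* (ρ :* ρ)) refl ρ r T)
      0≤1673V-232ρ² : 0# ≤ # 1673 * V - # 232 * (ρ * ρ)
      0≤1673V-232ρ² = ⌊ V-bound ⌋
      0≤1673U : 0# ≤ # 1673 * U
      0≤1673U = ≤-trans (#≥0 218 ⊗ square-nonneg ρ) U-bound
      0≤U : 0# ≤ U
      0≤U = *-cancelˡ-≤ (#>0 1672) (≤-trans (≈⇒≤ (zeroʳ _)) 0≤1673U)
      pU< : p * U < # 4 * (ρ * r)
      pU< = <-by ((0≤U ⊗ ⌊ 1+p≤ ⌋ ⊕ 0≤ρ ⊗ (0≤p ⊗ ⌊ Tp≤T ⌋) ⊕ 0≤ρ ⊗ (0≤q ⊗ (⌊ Tp+Tq≤ ⌋ ⊕ <⇒≤ ⌊ T-Tp<ρ ⌋⁺))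
                    ⊕ ⌊ upper ⌋ ⊕ #≥0 2 ⊗ (0≤ρ ⊗ 0≤r-1)) ⊕⁺ *-positive 0<ρ ⌊ spread< ⌋⁺)
        (solve 7 (λ ρ r p q T Tp Tq → let U = T :- :# 2 :* ρ :- ρ :* r in
             U :* (ρ :* q :- (:# 1 :+ p)) :+ ρ :* (p :* (T :- Tp)) :+ ρ :* (q :* ((T :+ ρ :* r :- (Tp :+ Tq)) :+ (ρ :- (T :- Tp))))
               :+ (ρ :* r :+ T :- ρ :* (ρ :* p)) :+ :# 2 :* (ρ :* (r :- :# 1)) :+ ρ :* (ρ :* (p :+ q) :- (p :* (T :- Tp) :+ q :* (T :- Tq)))
           := :# 4 :* (ρ :* r) :- p :* U) refl ρ r p q T Tp Tq)
      VU< : V * U < ρ * ρ * (# 4 * (ρ * r))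
      VU< = <-by ((0≤U ⊗ (⌊ lower ⌋ ⊕ <⇒≤ ⌊ T-Tp<ρ ⌋⁺)) ⊕⁺ *-positive (*-positive 0<ρ 0<ρ) ⌊ pU< ⌋⁺)
        (solve 6 (λ ρ r p T Tp U → U :* ((ρ :* (ρ :* p) :- Tp) :+ (ρ :- (T :- Tp))) :+ ρ :* ρ :* (:# 4 :* (ρ :* r) :- p :* U)
           := ρ :* ρ :* (:# 4 :* (ρ :* r)) :- (T :- ρ) :* U) refl ρ r p T Tp U)

    -- 1/7 + 1/239 < 3/20.
    endpoint-small : ∀ {x T} → # 7 * T < ρ * ρ → ρ * (ρ * x) ≤ ρ * r + T → # 20 * x ≤ # 3
    endpoint-small {x} {T} 7T<ρ² upper = *-cancelˡ-≤ (*-positive (#>0 6) (*-positive 0<ρ 0<ρ))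
      (≤-by (#≥0 140 ⊗ ⌊ upper ⌋ ⊕ #≥0 20 ⊗ <⇒≤ ⌊ 7T<ρ² ⌋⁺ ⊕ 0≤ρ ⊗ ⌊ 239r≤ρ ⌋ ⊕ #≥0 99 ⊗ (0≤ρ ⊗ 0≤r))
        (solve 4 (λ ρ r x T → :# 140 :* (ρ :* r :+ T :- ρ :* (ρ :* x)) :+ :# 20 :* (ρ :* ρ :- :# 7 :* T) :+ ρ :* (ρ :- :# 239 :* r) :+ :# 99 :* (ρ :* r)
          := :# 7 :* (ρ :* ρ) :* :# 3 :- :# 7 :* (ρ :* ρ) :* (:# 20 :* x)) refl ρ r x T))

    -- s = |A|, d = |N|, and X is the sum of x over the (ordered) edges inside N.
    many-neighbours : ∀ {s d T X} → # 7 * T < ρ * ρ → # 7 * (ρ * s) ≤ # 10 * T → # 7 * X ≤ # 3 → 0# ≤ d →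
                      ρ * (ρ * ρ) ≤ ρ * X + d * T → T ≤ ρ * s → # 342 * ρ ≤ # 70 * d × # 7 * (ρ * ρ) ≤ # 3 + # 7 * (d * s)
    many-neighbours {s} {d} {T} {X} 7T<ρ² 7ρs≤10T 7X≤3 0≤d ρ³≤ T≤ρs = 342ρ≤70d , 7ρ²≤
      where
      7ρ²≤ : # 7 * (ρ * ρ) ≤ # 3 + # 7 * (d * s)
      7ρ²≤ = *-cancelˡ-≤ 0<ρ (≤-by (#≥0 7 ⊗ ⌊ ρ³≤ ⌋ ⊕ #≥0 7 ⊗ (0≤d ⊗ ⌊ T≤ρs ⌋) ⊕ 0≤ρ ⊗ ⌊ 7X≤3 ⌋)
        (solve 5 (λ ρ s d T X → :# 7 :* (ρ :* X :+ d :* T :- ρ :* (ρ :* ρ)) :+ :# 7 :* (d :* (ρ :* s :- T)) :+ ρ :* (:# 3 :- :# 7 :* X)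
           := ρ :* (:# 3 :+ :# 7 :* (d :* s)) :- ρ :* (:# 7 :* (ρ :* ρ))) refl ρ s d T X))
      49s≤10ρ : # 49 * s ≤ # 10 * ρ
      49s≤10ρ = *-cancelˡ-≤ 0<ρ (≤-by (#≥0 7 ⊗ ⌊ 7ρs≤10T ⌋ ⊕ #≥0 10 ⊗ <⇒≤ ⌊ 7T<ρ² ⌋⁺)
        (solve 3 (λ ρ s T → :# 7 :* (:# 10 :* T :- :# 7 :* (ρ :* s)) :+ :# 10 :* (ρ :* ρ :- :# 7 :* T) := ρ :* (:# 10 :* ρ) :- ρ :* (:# 49 :* s)) refl ρ s T))
      -- Inserting s ≤ 10ρ/49 into 7ρ² ≤ 3 + 7ds gives 343ρ² ≤ 70dρ + 147; giving up one ρ² pays for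
      -- the 147.
      342ρ≤70d : # 342 * ρ ≤ # 70 * d
      342ρ≤70d = *-cancelˡ-≤ 0<ρ (≤-by (#≥0 49 ⊗ ⌊ 7ρ²≤ ⌋ ⊕ #≥0 7 ⊗ (0≤d ⊗ ⌊ 49s≤10ρ ⌋) ⊕ ((⌊ 239≤ρ ⌋ ⊕ #≥0 239) ⊗ ⌊ 239≤ρ ⌋ ⊕ #≥0 239 ⊗ ⌊ 239≤ρ ⌋ ⊕ #≥0 56974))
        (solve 3 (λ ρ s d → :# 49 :* (:# 3 :+ :# 7 :* (d :* s) :- :# 7 :* (ρ :* ρ)) :+ :# 7 :* (d :* (:# 10 :* ρ :- :# 49 :* s))
             :+ (((ρ :- :# 239) :+ :# 239) :* (ρ :- :# 239) :+ :# 239 :* (ρ :- :# 239) :+ :# 56974) := ρ :* (:# 70 :* d) :- ρ :* (:# 342 :* ρ)) refl ρ s d))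

    value-large : ∀ {c Q x} → # 10 * Q < # 3 → c * (1# - x) ≤ Q → 1# ≤ c → x ≤ 1# → # 7 ≤ # 10 * x
    value-large {c} {Q} {x} 10Q<3 c[1-x]≤Q 1≤c x≤1 = ≤-by (<⇒≤ ⌊ 10Q<3 ⌋⁺ ⊕ #≥0 10 ⊗ ⌊ c[1-x]≤Q ⌋ ⊕ #≥0 10 ⊗ (⌊ 1≤c ⌋ ⊗ ⌊ x≤1 ⌋))
      (solve 3 (λ Q c x → (:# 3 :- :# 10 :* Q) :+ :# 10 :* (Q :- c :* (:# 1 :- x)) :+ :# 10 :* ((c :- :# 1) :* (:# 1 :- x)) := :# 10 :* x :- :# 7) refl Q c x)

    -- From c ≥ ρx, x ≥ 7/10 and c(1 - x) < 3/10 follows ρ(1 - x) ≤ 3/7. So at most 3ρ/7 vertices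
    -- are missed, which is less than d/10 because d is at least 342ρ/70.
    degree-large : ∀ {d c Q x} → # 342 * ρ ≤ # 70 * d → # 10 * Q < # 3 → c * (1# - x) ≤ Q → 1# ≤ c → x ≤ 1# → ρ * x ≤ c →
                   d - c ≤ ρ * (ρ * (1# - x)) → # 9 * d ≤ # 10 * c
    degree-large {d} {c} {Q} {x} 342ρ≤70d 10Q<3 c[1-x]≤Q 1≤c x≤1 ρx≤c d-c≤ = *-cancelˡ-≤ (#>0 6)
      (≤-by (#≥0 70 ⊗ ⌊ d-c≤ ⌋ ⊕ #≥0 10 ⊗ (0≤ρ ⊗ ⌊ 7ρ[1-x]≤3 ⌋) ⊕ ⌊ 10d-3ρ≥ ⌋)
        (solve 4 (λ ρ d c x → :# 70 :* (ρ :* (ρ :* (:# 1 :- x)) :- (d :- c)) :+ :# 10 :* (ρ :* (:# 3 :- :# 7 :* (ρ :* (:# 1 :- x)))) :+ (:# 7 :* d :- :# 30 :* ρ)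
           := :# 7 :* (:# 10 :* c) :- :# 7 :* (:# 9 :* d)) refl ρ d c x))
      where
      10d-3ρ≥ : # 30 * ρ ≤ # 7 * d
      10d-3ρ≥ = *-cancelˡ-≤ (#>0 9) (≤-by (⌊ 342ρ≤70d ⌋ ⊕ #≥0 42 ⊗ 0≤ρ)
        (solve 2 (λ ρ d → (:# 70 :* d :- :# 342 :* ρ) :+ :# 42 :* ρ := :# 10 :* (:# 7 :* d) :- :# 10 :* (:# 30 :* ρ)) refl ρ d))
      7≤10x : # 7 ≤ # 10 * x
      7≤10x = value-large 10Q<3 c[1-x]≤Q 1≤c x≤1
      7ρ[1-x]≤3 : # 7 * (ρ * (1# - x)) ≤ # 3
      7ρ[1-x]≤3 = ≤-by (<⇒≤ ⌊ 10Q<3 ⌋⁺ ⊕ #≥0 10 ⊗ ⌊ c[1-x]≤Q ⌋ ⊕ #≥0 10 ⊗ (⌊ x≤1 ⌋ ⊗ ⌊ ρx≤c ⌋) ⊕ 0≤ρ ⊗ (⌊ x≤1 ⌋ ⊗ ⌊ 7≤10x ⌋))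
        (solve 4 (λ ρ Q c x → (:# 3 :- :# 10 :* Q) :+ :# 10 :* (Q :- c :* (:# 1 :- x)) :+ :# 10 :* ((:# 1 :- x) :* (c :- ρ :* x)) :+ ρ :* ((:# 1 :- x) :* (:# 10 :* x :- :# 7))
           := :# 3 :- :# 7 :* (ρ :* (:# 1 :- x))) refl ρ Q c x)

    -- A vertex of N with value y and k ≥ 1 non-neighbours in A is too expensive; Z = Σ (1 - x) over A.
    missing-impossible : ∀ {s d k y Z} → # 342 * ρ ≤ # 70 * d → # 7 * (ρ * ρ) ≤ # 3 + # 7 * (d * s) →
                         # 9 * (d * Z) < # 3 → y * k ≤ ρ * Z → # 3 * ρ + # 7 * (ρ * (s - k)) ≤ # 10 * (ρ * (ρ * y)) →
                         1# ≤ k → 1# ≤ s - k → ⊥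
    missing-impossible {s} {d} {k} {y} {Z} 342ρ≤70d 7ρ²≤ 9dZ<3 yk≤ρZ value 1≤k 1≤s-k =
      impossible (<⇒≤ 30d< ⊕⁺ positive) (solve 2 (λ ρ d → (:# 90 :- :# 210 :* d) :+ (:# 210 :* d :- :# 90) := :# 0) refl ρ d)
      where
      0≤d : 0# ≤ d
      0≤d = *-cancelˡ-≤ (#>0 69) (≤-trans (≈⇒≤ (zeroʳ _)) (≤-trans (#≥0 342 ⊗ 0≤ρ) 342ρ≤70d))
      3+7[s-k]≤ : # 3 + # 7 * (s - k) ≤ # 10 * (ρ * y)
      3+7[s-k]≤ = *-cancelˡ-≤ 0<ρ (≤-by ⌊ value ⌋
        (solve 4 (λ ρ s k y → :# 10 :* (ρ :* (ρ :* y)) :- (:# 3 :* ρ :+ :# 7 :* (ρ :* (s :- k))) := ρ :* (:# 10 :* (ρ :* y)) :- ρ :* (:# 3 :+ :# 7 :* (s :- k))) refl ρ s k y))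
      -- The product k(3 + 7(s - k)) exceeds its value 7s - 4 at k = 1 by 7(k - 1)(s - k - 1) + 3(k
      -- - 1), which is nonnegative in the given range.
      7s-4≤ : # 7 * s - # 4 ≤ # 10 * (ρ * (ρ * Z))
      7s-4≤ = ≤-by (#≥0 10 ⊗ (0≤ρ ⊗ ⌊ yk≤ρZ ⌋) ⊕ (⌊ 1≤k ⌋ ⊕ 0≤1) ⊗ ⌊ 3+7[s-k]≤ ⌋ ⊕ #≥0 7 ⊗ (⌊ 1≤k ⌋ ⊗ ⌊ 1≤s-k ⌋) ⊕ #≥0 3 ⊗ ⌊ 1≤k ⌋)
        (solve 5 (λ ρ s k y Z → :# 10 :* (ρ :* (ρ :* Z :- y :* k)) :+ ((k :- :# 1) :+ :# 1) :* (:# 10 :* (ρ :* y) :- (:# 3 :+ :# 7 :* (s :- k)))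
              :+ :# 7 :* ((k :- :# 1) :* (s :- k :- :# 1)) :+ :# 3 :* (k :- :# 1)
           := :# 10 :* (ρ :* (ρ :* Z)) :- (:# 7 :* s :- :# 4)) refl ρ s k y Z)
      -- As s ≥ 2, 7s - 4 ≥ (s + 1) 10/3, so dZ < 1/3 forces d(s + 1) < ρ². Against ds ≥ ρ² - 3/7
      -- this leaves d < 3/7.
      30d< : 0# < # 90 - # 210 * d
      30d< = <-by ((#≥0 63 ⊗ (0≤d ⊗ ⌊ 7s-4≤ ⌋) ⊕ #≥0 30 ⊗ ⌊ 7ρ²≤ ⌋ ⊕ #≥0 231 ⊗ (0≤d ⊗ (⌊ 1≤s-k ⌋ ⊕ ⌊ 1≤k ⌋)))
                     ⊕⁺ *-positive (#>0 69) (*-positive (*-positive 0<ρ 0<ρ) ⌊ 9dZ<3 ⌋⁺))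
        (solve 5 (λ ρ s d k Z → :# 63 :* (d :* (:# 10 :* (ρ :* (ρ :* Z)) :- (:# 7 :* s :- :# 4))) :+ :# 30 :* ((:# 3 :+ :# 7 :* (d :* s)) :- :# 7 :* (ρ :* ρ))
               :+ :# 231 :* (d :* ((s :- k :- :# 1) :+ (k :- :# 1))) :+ :# 70 :* (ρ :* ρ :* (:# 3 :- :# 9 :* (d :* Z)))
           := (:# 90 :- :# 210 :* d) :- :# 0) refl ρ s d k Z)
      positive : 0# < # 210 * d - # 90
      positive = <-by ((#≥0 3 ⊗ ⌊ 342ρ≤70d ⌋ ⊕ #≥0 1026 ⊗ ⌊ 239≤ρ ⌋) ⊕⁺ #>0 245123)
        (solve 2 (λ ρ d → :# 3 :* (:# 70 :* d :- :# 342 :* ρ) :+ :# 1026 :* (ρ :- :# 239) :+ :# 245124 := (:# 210 :* d :- :# 90) :- :# 0) refl ρ d)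

-- The structure forced by ρ² > m - 1.

module Extremal {c ℓ₁ ℓ₂} (ℝ : CompleteOrderedField c ℓ₁ ℓ₂) where
  open Estimates ℝ public
  open Solver using (solve; _:=_; _:+_; _:*_; _:-_; :-_)

  module Cases {n} (adj : Fin n → Fin n → Bool) (adj-sym : ∀ u v → adj u v ≡ adj v u) (adj-irrefl : ∀ v → adj v v ≡ false)
               {ρ r : Carrier} (1≤r : 1# ≤ r) (239r≤ρ : # 239 * r ≤ ρ)
               (perronVector : PerronVector (λ u v → ι (adj u v)) ρ)
               (codegree : ∀ {u v} → adj u v ≡ true → ∑ (λ w → ι (adj u w) * ι (adj v w)) ≤ r)
               {m : Carrier} (size : # 2 * m ≈ ∑ (λ u → ∑ λ v → ι (adj u v))) (m-1<ρ² : m - 1# < ρ * ρ) where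

    open Large 1≤r 239r≤ρ public
    open Split adj adj-sym 0≤ρ perronVector public
    open Codegree r codegree public

    adj⇒≢ : ∀ {u v} → adj u v ≡ true → u ≢ v
    adj⇒≢ {u} u~u ≡.refl with ≡.trans (≡.sym u~u) (adj-irrefl u)
    ... | ()

    flip : ∀ {u v} → adj u v ≡ true → adj v u ≡ true
    flip {u} {v} u~v = ≡.trans (adj-sym v u) u~v

    Ae : A e ≡ true
    Ae = A-e (adj-irrefl e)

    slack : Carrier
    slack = # 2 * deficit + edgesᴬ

    slack< : slack < # 2 + excess
    slack< = edge-count size m-1<ρ²

    slack≥0 : 0# ≤ slack
    slack≥0 = #≥0 2 ⊗ deficit≥0 ⊕ edgesᴬ≥0

    edgesᴬ≤slack : edgesᴬ ≤ slack
    edgesᴬ≤slack = ≤-by (#≥0 2 ⊗ deficit≥0) (solve 2 (λ Q E → :# 2 :* Q := (:# 2 :* Q :+ E) :- E) refl deficit edgesᴬ)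

    spread≤slack : # 2 * spread ≤ (ρ + r) * slack
    spread≤slack = ≤-trans spread-upper (≤-by (#≥0 2 ⊗ (0≤r ⊗ deficit≥0))
      (solve 4 (λ ρ r Q E → :# 2 :* (r :* Q) := (ρ :+ r) :* (:# 2 :* Q :+ E) :- (:# 2 :* ρ :* Q :+ (ρ :+ r) :* E)) refl ρ r deficit edgesᴬ))

    -- The vertex e of A is adjacent to v and alone contributes `weightᴺ` e, which is ρ.
    ρ≤transfer : ∀ {v} → N v ≡ true → ρ ≤ transfer v
    ρ≤transfer {v} Nv = ≤-trans (≈⇒≤ (trans (sym weightᴺ-e) (sym (ι-true _ (flip Nv)))))
      (term≤∑⟨⟩ {f = λ u → a v u * weightᴺ u} (λ u _ → ι≥0 _ ⊗ weightᴺ≥0 u) Ae)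

    1≤ρx : ∀ {v} → N v ≡ true → 1# ≤ ρ * x v
    1≤ρx {v} Nv = ≤-trans (≈⇒≤ (trans (sym x-top) (sym (ι-true _ (flip Nv))))) (≤-trans (term≤∑ (λ u → ax≥0 v u) e) (≈⇒≤ (sym (eigen v))))

    value-upper : ∀ {v} → N v ≡ true → ρ * (ρ * x v) ≤ ρ * r + totalTransfer + edgesᴬ
    value-upper {v} Nv = ≤-trans (transfer-upper v) (+-monoˡ-≤ _ (+-mono-≤ (*-monoˡ-≤ 0≤ρ (weightᴺ≤r Nv)) (transfer≤total v)))

    value-lower : ∀ {u v} → N v ≡ true → adj u v ≡ true → ρ * x v + transfer u ≤ ρ * (ρ * x u)
    value-lower {u} Nv u~v = ≤-trans (+-monoˡ-≤ _ (*-monoˡ-≤ 0≤ρ (neighbour≤weightᴺ Nv u~v))) (transfer-lower u)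

    -- The vertices of N with few transfers cover the edges inside N.
    covering : Fin n → Bool
    covering v with <-or-≥ (totalTransfer + ρ * r) (# 2 * transfer v)
    ... | inj₁ _ = false
    ... | inj₂ _ = true

    covering-true : ∀ {v} → covering v ≡ true → # 2 * transfer v ≤ totalTransfer + ρ * r
    covering-true {v} eq with <-or-≥ (totalTransfer + ρ * r) (# 2 * transfer v)
    covering-true () | inj₁ _
    covering-true _  | inj₂ few = few

    covering-false : ∀ {v} → covering v ≡ false → totalTransfer + ρ * r < # 2 * transfer v
    covering-false {v} eq with <-or-≥ (totalTransfer + ρ * r) (# 2 * transfer v)
    covering-false _  | inj₁ many = many
    covering-false () | inj₂ _

    covering-edge : ∀ {u v} → adj u v ≡ true → covering u ≡ true ⊎ covering v ≡ true
    covering-edge {u} {v} u~v with covering u in eqᵤ | covering v in eqᵥ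
    ... | true  | _     = inj₁ ≡.refl
    ... | false | true  = inj₂ ≡.refl
    ... | false | false = ⊥-elim (impossible ((⌊ transfers≤ u~v ⌋ ⊕ ⌊ transfers≤ u~v ⌋ ⊕ <⇒≤ ⌊ covering-false eqᵤ ⌋⁺) ⊕⁺ ⌊ covering-false eqᵥ ⌋⁺)
            (solve 3 (λ K s t → (K :- (s :+ t)) :+ (K :- (s :+ t)) :+ (:# 2 :* s :- K) :+ (:# 2 :* t :- K) := :# 0) refl (totalTransfer + ρ * r) (transfer u) (transfer v)))

    coveringValue : Fin n → Carrier
    coveringValue v = ι (covering v) * x v

    coveringValue≥0 : ∀ v → 0# ≤ coveringValue v
    coveringValue≥0 v = ι≥0 _ ⊗ x≥0 v

    cover : Carrier
    cover = ∑⟨ N ⟩ coveringValue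

    cover≥0 : 0# ≤ cover
    cover≥0 = ∑⟨⟩-nonneg λ v _ → coveringValue≥0 v

    cover≤ρ : cover ≤ ρ
    cover≤ρ = ≤-trans (∑⟨⟩-mono λ v _ → ι*≤ _ (x≥0 v)) (≈⇒≤ ∑ᴺx≈ρ)

    -- On each edge some endpoint is covering, and the value of the other is at most 1; so x u + x v
    -- - 1 is bounded by the covering values. Each of these is charged by at most r edges, in two
    -- orders.
    excess≤cover : excess ≤ # 2 * (r * cover)
    excess≤cover = ≤-trans (∑⟨⟩-mono λ u Nu → ∑⟨⟩-mono λ v Nv → ι-mono (adj u v) (edge u v))
      (≤-trans (≈⇒≤ (trans (∑⟨⟩-cong λ u _ → trans (∑⟨⟩-cong λ v _ → distribˡ _ _ _) (∑⟨⟩-+ _ _)) (trans (∑⟨⟩-+ _ _)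
        (+-congʳ (trans (∑⟨⟩-comm _) (∑⟨⟩-cong λ v _ → ∑⟨⟩-cong λ u _ → *-congʳ (reflexive (a-sym u v))))))))
      (≤-by (#≥0 2 ⊗ ⌊ half ⌋) (solve 2 (λ X Y → :# 2 :* (Y :- X) := :# 2 :* Y :- (X :+ X)) refl _ _)))
      where
      edge : ∀ u v → adj u v ≡ true → x u + x v - 1# ≤ coveringValue u + coveringValue v
      edge u v u~v with covering-edge u~v
      ... | inj₁ eq = ≤-by (coveringValue≥0 v ⊕ ⌊ x≤1 v ⌋) (trans (solve 3 (λ p q b → b :+ (:# 1 :- q) := (p :+ b) :- (p :+ q :- :# 1)) refl (x u) (x v) (coveringValue v))
              (+-congʳ (+-congʳ (sym (ι-true (x u) eq)))))
      ... | inj₂ eq = ≤-by (coveringValue≥0 u ⊕ ⌊ x≤1 u ⌋) (trans (solve 3 (λ p q b → b :+ (:# 1 :- p) := (b :+ q) :- (p :+ q :- :# 1)) refl (x u) (x v) (coveringValue u))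
              (+-congʳ (+-congˡ (sym (ι-true (x v) eq)))))
      half : ∑⟨ N ⟩ (λ u → ∑⟨ N ⟩ λ v → a u v * coveringValue v) ≤ r * cover
      half = ≤-trans (≈⇒≤ (∑⟨⟩-comm _)) (≤-trans (∑⟨⟩-mono λ v Nv → ≤-trans (≈⇒≤ (trans (∑⟨⟩-cong λ u _ → *-comm _ _) (∑⟨⟩-* (coveringValue v) _)))
          (≤-trans (*-monoˡ-≤ (coveringValue≥0 v) (degreeᴺ≤r Nv)) (≈⇒≤ (*-comm _ _))))
        (≈⇒≤ (∑⟨⟩-* r _)))

    slack≤cover : slack ≤ # 2 + # 2 * (r * cover)
    slack≤cover = ≤-trans (<⇒≤ slack<) (+-monoʳ-≤ _ excess≤cover)

    -- For a covering vertex T - T_v is at least (T - ρr)/2; the other vertices only add nonnegative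
    -- terms.
    cover≤spread : cover * (totalTransfer - ρ * r) ≤ # 2 * spread
    cover≤spread = ≤-trans (≈⇒≤ (trans (*-comm _ _) (sym (∑⟨⟩-* _ _)))) (≤-trans (∑⟨⟩-mono λ v _ → term v) (≈⇒≤ (∑⟨⟩-* (# 2) _)))
      where
      term : ∀ v → (totalTransfer - ρ * r) * coveringValue v ≤ # 2 * (x v * (totalTransfer - transfer v))
      term v with covering v in eq
      ... | true  = ≤-by (x≥0 v ⊗ ⌊ covering-true eq ⌋) (solve 4 (λ T K x t → x :* ((T :+ K) :- :# 2 :* t) := :# 2 :* (x :* (T :- t)) :- (T :- K) :* (:# 1 :* x))
                      refl totalTransfer (ρ * r) (x v) (transfer v))
      ... | false = ≤-by (#≥0 2 ⊗ spread-term≥0 v) (solve 4 (λ T K x t → :# 2 :* (x :* (T :- t)) := :# 2 :* (x :* (T :- t)) :- (T :- K) :* (:# 0 :* x))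
                      refl totalTransfer (ρ * r) (x v) (transfer v))

    covered-heavy-edge-impossible : ∀ {u v} → N u ≡ true → N v ≡ true → adj u v ≡ true → 1# < x u + x v → covering v ≡ true → ⊥
    covered-heavy-edge-impossible {u} {v} Nu Nv u~v heavy cv = heavy-edge-impossible cover≥0
      (cover-small cover≥0 cover≤ρ slack≤cover edgesᴬ≤slack (≤-trans cover≤spread spread≤slack)
        -- Heaviness supplies the lower bound for T that `cover-small` requires: ρ² is less than
        -- ρ²(x u + x v), and both halves are bounded by `value-upper`.
        (≤-by (⌊ value-upper Nu ⌋ ⊕ ⌊ value-upper Nv ⌋ ⊕ 0≤ρ ⊗ (0≤ρ ⊗ <⇒≤ ⌊ heavy ⌋⁺))
          (solve 4 (λ ρ p q K → (K :- ρ :* (ρ :* p)) :+ (K :- ρ :* (ρ :* q)) :+ ρ :* (ρ :* (p :+ q :- :# 1)) := :# 2 :* K :- ρ :* ρ) refl ρ (x u) (x v) _)))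
      slack≤cover edgesᴬ≤slack spread≤slack (transfer≤total v) (term≤∑⟨⟩ (λ v _ → spread-term≥0 v) Nv) (<⇒≤ heavy)
      (≤-trans (≈⇒≤ (sym (ι-true _ cv))) (term≤∑⟨⟩ (λ v _ → coveringValue≥0 v) Nv))
      (value-lower Nu (flip u~v)) (ρ≤transfer Nv) (x≥0 u) (value-upper Nu)

    light-edge : ∀ {u v} → N u ≡ true → N v ≡ true → adj u v ≡ true → x u + x v ≤ 1#
    light-edge {u} {v} Nu Nv u~v with <-or-≥ 1# (x u + x v)
    ... | inj₂ light = light
    ... | inj₁ heavy with covering-edge u~v
    ...   | inj₁ cu = ⊥-elim (covered-heavy-edge-impossible Nv Nu (flip u~v) (<-resp refl (+-comm _ _) heavy) cu)
    ...   | inj₂ cv = ⊥-elim (covered-heavy-edge-impossible Nu Nv u~v heavy cv)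

    -- An edge inside A is counted once from each end, so a single one already gives 2.
    edgesᴬ<2⇒independent : edgesᴬ < # 2 → ∀ {w z} → A w ≡ true → A z ≡ true → adj w z ≡ false
    edgesᴬ<2⇒independent E<2 {w} {z} Aw Az with adj w z in w~z
    ... | false = ≡.refl
    ... | true  = ⊥-elim (≤⇒≯ (≤-trans (≤-by (⌊ row Az w~z ⌋ ⊕ ⌊ row Aw (flip w~z) ⌋) (solve 2 (λ s t → (s :- :# 1) :+ (t :- :# 1) := (s :+ t) :- :# 2) refl _ _))
                    (twoTerms≤∑⟨⟩ (λ u _ → ∑⟨⟩-nonneg λ v _ → ι≥0 _) Aw Az (adj⇒≢ w~z))) E<2)
      where
      row : ∀ {w z} → A z ≡ true → adj w z ≡ true → 1# ≤ ∑⟨ A ⟩ (a w)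
      row {w} Az w~z = ≤-trans (≈⇒≤ (reflexive (≡.cong ι (≡.sym w~z)))) (term≤∑⟨⟩ (λ v _ → ι≥0 (adj w v)) Az)

    edgeless⇒bipartition : (∀ {u v} → N u ≡ true → N v ≡ true → adj u v ≡ false) → ∀ {w z} → A w ≡ true → A z ≡ true → adj w z ≡ false
    edgeless⇒bipartition edgeless = edgesᴬ<2⇒independent (≤-<-trans edgesᴬ≤slack (<-resp refl (trans (+-congˡ excess≈0) (+-identityʳ _)) slack<))
      where
      excess≈0 : excess ≈ 0#
      excess≈0 = ∑⟨⟩-0 λ u Nu → ∑⟨⟩-0 λ v Nv → trans (*-congʳ (reflexive (≡.cong ι (edgeless Nu Nv)))) (zeroˡ _)

    module EdgeInside {u v} (Nu : N u ≡ true) (Nv : N v ≡ true) (u~v : adj u v ≡ true)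
                      (neighbour : ∀ w → ∃ λ z → adj w z ≡ true) where

      excess≤edge : excess ≤ # 2 * (x u + x v - 1#)
      excess≤edge = ≤-by ⌊ ≤-trans (+-mono-≤ (row Nu Nv u~v) (row Nv Nu (flip u~v))) (twoTerms≤∑⟨⟩ (λ i Ni → row≥0 Ni) Nu Nv (adj⇒≢ u~v)) ⌋
        (trans (+-congʳ total) (solve 3 (λ X p q → (:- X) :- ((:# 1 :- p :- q) :+ (:# 1 :- q :- p)) := :# 2 :* (p :+ q :- :# 1) :- X) refl excess (x u) (x v)))
        where
        slackness : Fin n → Fin n → Carrier
        slackness i j = a i j * (1# - x i - x j)
        nonneg : ∀ {i j} → N i ≡ true → N j ≡ true → 0# ≤ slackness i j
        nonneg {i} {j} Ni Nj = ι-nonneg (adj i j) λ i~j → ≤-by ⌊ light-edge Ni Nj i~j ⌋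
          (solve 2 (λ p q → :# 1 :- (p :+ q) := (:# 1 :- p :- q) :- :# 0) refl (x i) (x j))
        row≥0 : ∀ {i} → N i ≡ true → 0# ≤ ∑⟨ N ⟩ (slackness i)
        row≥0 Ni = ∑⟨⟩-nonneg λ j Nj → nonneg Ni Nj
        row : ∀ {i j} → N i ≡ true → N j ≡ true → adj i j ≡ true → 1# - x i - x j ≤ ∑⟨ N ⟩ (slackness i)
        row Ni Nj i~j = ≤-trans (≈⇒≤ (sym (ι-true _ i~j))) (term≤∑⟨⟩ (λ j Nj → nonneg Ni Nj) Nj)
        total : ∑⟨ N ⟩ (λ i → ∑⟨ N ⟩ (slackness i)) ≈ - excess
        total = trans (∑⟨⟩-cong λ i _ → trans (∑⟨⟩-cong λ j _ → solve 3 (λ a p q → a :* (:# 1 :- p :- q) := (:- :# 1) :* (a :* (p :+ q :- :# 1))) refl (a i j) (x i) (x j)) (∑⟨⟩-* (- 1#) _))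
          (trans (∑⟨⟩-* (- 1#) _) (solve 1 (λ X → (:- :# 1) :* X := :- X) refl excess))

      slack<edge : slack < # 2 * (x u + x v)
      slack<edge = <-by (⌊ excess≤edge ⌋ ⊕⁺ ⌊ slack< ⌋⁺)
        (solve 4 (λ X S p q → (:# 2 :* (p :+ q :- :# 1) :- X) :+ (:# 2 :+ X :- S) := :# 2 :* (p :+ q) :- S) refl excess slack (x u) (x v))

      independentᴬ : ∀ {w z} → A w ≡ true → A z ≡ true → adj w z ≡ false
      independentᴬ = edgesᴬ<2⇒independent (≤-<-trans edgesᴬ≤slack (<-≤-trans slack<edge
        (≤-by (#≥0 2 ⊗ ⌊ light-edge Nu Nv u~v ⌋) (solve 1 (λ s → :# 2 :* (:# 1 :- s) := :# 2 :- :# 2 :* s) refl _))))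

      edgesᴬ≈0 : edgesᴬ ≈ 0#
      edgesᴬ≈0 = ∑⟨⟩-0 λ w Aw → ∑⟨⟩-0 λ z Az → reflexive (≡.cong ι (independentᴬ Aw Az))

      weightᴺ≈ρx : ∀ {w} → A w ≡ true → weightᴺ w ≈ ρ * x w
      weightᴺ≈ρx {w} Aw = sym (trans (eigen-split w) (trans (+-congˡ (∑⟨⟩-0 λ z Az → trans (*-congʳ (reflexive (≡.cong ι (independentᴬ Aw Az)))) (zeroˡ _))) (+-identityʳ _)))

      value-upper′ : ∀ {w} → N w ≡ true → ρ * (ρ * x w) ≤ ρ * r + totalTransfer
      value-upper′ Nw = ≤-trans (value-upper Nw) (≈⇒≤ (trans (+-congˡ edgesᴬ≈0) (+-identityʳ _)))

      -- Both e, of value 1, and z are neighbours of w.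
      1+x≤ρx : ∀ {w z} → N w ≡ true → N z ≡ true → adj w z ≡ true → 1# + x z ≤ ρ * x w
      1+x≤ρx {w} {z} Nw Nz w~z = *-cancelˡ-≤ 0<ρ (≤-trans (≤-by ⌊ ρ≤transfer Nw ⌋ (solve 3 (λ ρ z t → t :- ρ := (ρ :* z :+ t) :- ρ :* (:# 1 :+ z)) refl ρ (x z) (transfer w))) (value-lower Nz w~z))

      spread<edge : spread < ρ * (x u + x v)
      spread<edge = *-cancelˡ-< (#>0 1) (≤-<-trans (≤-trans spread-upper (≈⇒≤ (+-congˡ (*-congˡ edgesᴬ≈0))))
        (<-by (*-positive 0<ρ ⌊ slack<edge ⌋⁺) (trans (*-congˡ (+-congˡ (-‿cong (+-congˡ edgesᴬ≈0))))
          (solve 5 (λ ρ r p q Q → ρ :* (:# 2 :* (p :+ q) :- (:# 2 :* Q :+ :# 0)) := :# 2 :* (ρ :* (p :+ q)) :- (:# 2 :* ρ :* Q :+ (ρ :+ r) :* :# 0)) refl ρ r (x u) (x v) deficit))))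

      spread-edge : x u * (totalTransfer - transfer u) + x v * (totalTransfer - transfer v) < ρ * (x u + x v)
      spread-edge = ≤-<-trans (twoTerms≤∑⟨⟩ (λ v _ → spread-term≥0 v) Nu Nv (adj⇒≢ u~v)) spread<edge

      -- If T - T_u and T - T_v were both at least ρ, `spread-edge` would fail. So one of them is
      -- below ρ, and `total-small` applies with that endpoint in the role of p.
      7T<ρ² : # 7 * totalTransfer < ρ * ρ
      7T<ρ² with <-or-≥ (# 7 * totalTransfer) (ρ * ρ)
      ... | inj₁ small = small
      ... | inj₂ large with <-or-≥ (totalTransfer - transfer u) ρ | <-or-≥ (totalTransfer - transfer v) ρ
      ...   | inj₁ few | _        = ⊥-elim (total-small (≤⇒≯ large) few (transfer≤total u) (transfers≤ u~v) (x≥0 u) (x≥0 v) spread-edge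
                (1+x≤ρx Nv Nu (flip u~v)) (value-upper′ Nu) (transfer≤ρ²x u))
      ...   | inj₂ _   | inj₁ few = ⊥-elim (total-small (≤⇒≯ large) few (transfer≤total v) (transfers≤ (flip u~v)) (x≥0 v) (x≥0 u)
                (<-resp (+-comm _ _) (*-congˡ (+-comm _ _)) spread-edge) (1+x≤ρx Nu Nv u~v) (value-upper′ Nv) (transfer≤ρ²x v))
      ...   | inj₂ manyᵤ | inj₂ manyᵥ = ⊥-elim (≤⇒≯ (≤-by (x≥0 u ⊗ ⌊ manyᵤ ⌋ ⊕ x≥0 v ⊗ ⌊ manyᵥ ⌋)
                (solve 5 (λ ρ p q s t → p :* (s :- ρ) :+ q :* (t :- ρ) := (p :* s :+ q :* t) :- ρ :* (p :+ q)) refl ρ (x u) (x v) (totalTransfer - transfer u) (totalTransfer - transfer v))) spread-edge)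

      20x≤3 : ∀ {w} → N w ≡ true → # 20 * x w ≤ # 3
      20x≤3 Nw = endpoint-small 7T<ρ² (value-upper′ Nw)

      orderedEdges : Carrier
      orderedEdges = ∑⟨ N ⟩ λ w → ∑⟨ N ⟩ λ z → a w z

      -- Each ordered edge contributes at most 3/10 - 1 to `excess`, which is greater than -2
      -- because `slack` is nonnegative.
      7orderedEdges<20 : # 7 * orderedEdges < # 20
      7orderedEdges<20 = <-by ((⌊ bound ⌋ ⊕ #≥0 10 ⊗ slack≥0) ⊕⁺ *-positive (#>0 9) ⌊ slack< ⌋⁺)
        (solve 3 (λ O X S → ((:# 0 :- :# 10 :* X) :- :# 7 :* O) :+ :# 10 :* S :+ :# 10 :* (:# 2 :+ X :- S) := :# 20 :- :# 7 :* O) refl orderedEdges excess slack)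
        where
        bound : # 7 * orderedEdges ≤ 0# - # 10 * excess
        bound = *-cancelˡ-≤ (#>0 1) (≤-trans (≈⇒≤ (trans (sym (*-assoc _ _ _)) (trans (sym (∑⟨⟩-* _ _)) (∑⟨⟩-cong λ w _ → sym (∑⟨⟩-* _ _)))))
          (≤-trans (∑⟨⟩-mono λ w Nw → ∑⟨⟩-mono λ z Nz → ≤-by (ι≥0 (adj w z) ⊗ (⌊ 20x≤3 Nw ⌋ ⊕ ⌊ 20x≤3 Nz ⌋))
              (solve 3 (λ a p q → a :* ((:# 3 :- :# 20 :* p) :+ (:# 3 :- :# 20 :* q)) := (:- :# 20) :* (a :* (p :+ q :- :# 1)) :- :# 2 :* :# 7 :* a) refl (a w z) (x w) (x z)))
            (≈⇒≤ (trans (∑⟨⟩-cong λ w _ → ∑⟨⟩-* _ _) (trans (∑⟨⟩-* _ _) (solve 1 (λ X → (:- :# 20) :* X := :# 2 :* (:# 0 :- :# 10 :* X)) refl excess))))))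

      -- The rows of u, v and w would each hold an ordered edge, which makes three, and 7 · 3 > 20.
      unique-edge : ∀ {w z} → N w ≡ true → N z ≡ true → adj w z ≡ true → w ≢ u → w ≢ v → ⊥
      unique-edge {w} {z} Nw Nz w~z w≢u w≢v = ≤⇒≯ (≤-trans (≤-by (#≥0 1 ⊕ #≥0 7 ⊗ (row Nu Nv u~v ⊕ row Nv Nu (flip u~v) ⊕ row Nw Nz w~z))
          (solve 3 (λ p q s → :# 1 :+ :# 7 :* ((p :- :# 1) :+ (q :- :# 1) :+ (s :- :# 1)) := :# 7 :* (p :+ q :+ s) :- :# 20) refl _ _ _))
          (*-monoˡ-≤ (#≥0 7) (≤-trans (threeTerms≤∑ (λ i → ι-nonneg (N i) λ _ → ∑⟨⟩-nonneg λ j _ → ι≥0 _) (adj⇒≢ u~v) (λ u≡w → w≢u (≡.sym u≡w)) (λ v≡w → w≢v (≡.sym v≡w)))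
            (≈⇒≤ (sym (reflexive (∑⟨⟩≡ _))))))) 7orderedEdges<20
        where
        row : ∀ {i j} → N i ≡ true → N j ≡ true → adj i j ≡ true → 0# ≤ ι (N i) * ∑⟨ N ⟩ (a i) - 1#
        row {i} Ni Nj i~j = ⌊ ≤-trans (≈⇒≤ (reflexive (≡.cong ι (≡.sym i~j)))) (≤-trans (term≤∑⟨⟩ (λ j _ → ι≥0 (adj i j)) Nj) (≈⇒≤ (sym (ι-true _ Ni)))) ⌋

      2≤orderedEdges : # 2 ≤ orderedEdges
      2≤orderedEdges = ≤-trans (≤-by (⌊ row Nv u~v ⌋ ⊕ ⌊ row Nu (flip u~v) ⌋) (solve 2 (λ p q → (p :- :# 1) :+ (q :- :# 1) := (p :+ q) :- :# 2) refl _ _))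
        (twoTerms≤∑⟨⟩ (λ i _ → ∑⟨⟩-nonneg λ j _ → ι≥0 _) Nu Nv (adj⇒≢ u~v))
        where
        row : ∀ {i j} → N j ≡ true → adj i j ≡ true → 1# ≤ ∑⟨ N ⟩ (a i)
        row {i} Nj i~j = ≤-trans (≈⇒≤ (reflexive (≡.cong ι (≡.sym i~j)))) (term≤∑⟨⟩ (λ j _ → ι≥0 (adj i j)) Nj)

      weightInside : Carrier
      weightInside = ∑⟨ N ⟩ weightᴺ

      7weightInside≤3 : # 7 * weightInside ≤ # 3
      7weightInside≤3 = *-cancelˡ-≤ (#>0 19) (≤-by (#≥0 7 ⊗ ⌊ bound ⌋ ⊕ #≥0 3 ⊗ <⇒≤ ⌊ 7orderedEdges<20 ⌋⁺)
        (solve 2 (λ X O → :# 7 :* (:# 3 :* O :- :# 20 :* X) :+ :# 3 :* (:# 20 :- :# 7 :* O) := :# 20 :* :# 3 :- :# 20 :* (:# 7 :* X)) refl weightInside orderedEdges))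
        where
        bound : # 20 * weightInside ≤ # 3 * orderedEdges
        bound = ≤-trans (≈⇒≤ (trans (sym (∑⟨⟩-* _ _)) (∑⟨⟩-cong λ w _ → sym (∑⟨⟩-* _ _))))
          (≤-trans (∑⟨⟩-mono λ w Nw → ∑⟨⟩-mono λ z Nz → ≤-by (ι≥0 (adj w z) ⊗ ⌊ 20x≤3 Nz ⌋)
              (solve 2 (λ a q → a :* (:# 3 :- :# 20 :* q) := :# 3 :* a :- :# 20 :* (a :* q)) refl (a w z) (x z)))
            (≈⇒≤ (trans (∑⟨⟩-cong λ w _ → ∑⟨⟩-* _ _) (∑⟨⟩-* _ _))))

      10deficit<3 : # 10 * deficit < # 3
      10deficit<3 = *-cancelˡ-< (#>0 1) (<-by ((#≥0 10 ⊗ edgesᴬ≥0 ⊕ ⌊ 20x≤3 Nu ⌋ ⊕ ⌊ 20x≤3 Nv ⌋) ⊕⁺ *-positive (#>0 9) ⌊ slack<edge ⌋⁺)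
        (solve 4 (λ Q E p q → :# 10 :* E :+ (:# 3 :- :# 20 :* p) :+ (:# 3 :- :# 20 :* q) :+ :# 10 :* (:# 2 :* (p :+ q) :- (:# 2 :* Q :+ E))
           := :# 2 :* :# 3 :- :# 2 :* (:# 10 :* Q)) refl deficit edgesᴬ (x u) (x v)))

      N-or-A : ∀ z → N z ≡ true ⊎ A z ≡ true
      N-or-A z with adj e z
      ... | true  = inj₁ ≡.refl
      ... | false = inj₂ ≡.refl

      neighbour∈N : ∀ {w z} → A w ≡ true → adj w z ≡ true → N z ≡ true
      neighbour∈N {w} {z} Aw w~z = [ (λ Nz → Nz) , (λ Az → contradiction (≡.trans (≡.sym w~z) (independentᴬ Aw Az)) λ ()) ]′ (N-or-A z)

      1≤degreeᴺ : ∀ {w} → A w ≡ true → 1# ≤ degreeᴺ w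
      1≤degreeᴺ {w} Aw = ≤-trans (≈⇒≤ (reflexive (≡.cong ι (≡.sym (flip w~z))))) (term≤∑⟨⟩ (λ z _ → ι≥0 (adj z w)) (neighbour∈N Aw w~z))
        where
        w~z : adj w (proj₁ (neighbour w)) ≡ true
        w~z = proj₂ (neighbour w)

      deficit-term : ∀ {w} → A w ≡ true → degreeᴺ w * (1# - x w) ≤ deficit
      deficit-term Aw = term≤∑⟨⟩ (λ w _ → deficit-term≥0 w) Aw

      7≤10x : ∀ {w} → A w ≡ true → # 7 ≤ # 10 * x w
      7≤10x {w} Aw = value-large 10deficit<3 (deficit-term Aw) (1≤degreeᴺ Aw) (x≤1 w)

      orderᴬ orderᴺ defectᴬ : Carrier
      orderᴬ  = ∑⟨ A ⟩ λ _ → 1#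
      orderᴺ  = ∑⟨ N ⟩ λ _ → 1#
      defectᴬ = ∑⟨ A ⟩ λ w → 1# - x w

      7ρ≤10weightᴺ : ∀ {w} → A w ≡ true → # 7 * ρ ≤ # 10 * weightᴺ w
      7ρ≤10weightᴺ {w} Aw = ≤-trans (≤-by (0≤ρ ⊗ ⌊ 7≤10x Aw ⌋) (solve 2 (λ ρ x → ρ :* (:# 10 :* x :- :# 7) := :# 10 :* (ρ :* x) :- :# 7 :* ρ) refl ρ (x w)))
        (≈⇒≤ (*-congˡ (sym (weightᴺ≈ρx Aw))))

      order-bounds : # 342 * ρ ≤ # 70 * orderᴺ × # 7 * (ρ * ρ) ≤ # 3 + # 7 * (orderᴺ * orderᴬ)
      order-bounds = many-neighbours 7T<ρ² 7ρs≤10T 7weightInside≤3 (∑⟨⟩-nonneg λ _ _ → 0≤1) ρ³≤ T≤ρs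
        where
        7ρs≤10T : # 7 * (ρ * orderᴬ) ≤ # 10 * totalTransfer
        7ρs≤10T = ≤-trans (≈⇒≤ (trans (sym (*-assoc _ _ _)) (sym (∑⟨⟩-* _ _)))) (≤-trans (∑⟨⟩-mono λ w Aw → ≤-trans (≈⇒≤ (*-identityʳ _)) (7ρ≤10weightᴺ Aw)) (≈⇒≤ (∑⟨⟩-* _ _)))
        T≤ρs : totalTransfer ≤ ρ * orderᴬ
        T≤ρs = ≤-trans (∑⟨⟩-mono λ w _ → ≤-trans (weightᴺ≤ρ w) (≈⇒≤ (sym (*-identityʳ _)))) (≈⇒≤ (∑⟨⟩-* _ _))
        -- The upper walk bound for ρ² x_w, summed over N, where the values add up to ρ.
        ρ³≤ : ρ * (ρ * ρ) ≤ ρ * weightInside + orderᴺ * totalTransfer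
        ρ³≤ = ≤-trans (≈⇒≤ (trans (*-congˡ (*-congˡ (sym ∑ᴺx≈ρ))) (trans (*-congˡ (sym (∑⟨⟩-* _ _))) (sym (∑⟨⟩-* _ _)))))
          (≤-trans (∑⟨⟩-mono λ w _ → ≤-trans (transfer-upper w) (+-mono-≤ (+-monoʳ-≤ _ (≤-trans (transfer≤total w) (≈⇒≤ (sym (*-identityʳ _))))) (≈⇒≤ edgesᴬ≈0)))
            (≈⇒≤ (trans (∑⟨⟩-cong λ w _ → +-identityʳ _) (trans (∑⟨⟩-+ _ _) (+-cong (∑⟨⟩-* _ _) (trans (∑⟨⟩-* _ _) (*-comm _ _)))))))

      missing-weight : ∀ w → ∑⟨ N ⟩ (λ z → (1# - a w z) * x z) ≈ ρ - weightᴺ w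
      missing-weight w = trans (∑⟨⟩-cong λ z _ → solve 2 (λ a x → (:# 1 :- a) :* x := x :- a :* x) refl (a w z) (x z)) (trans (∑⟨⟩-- _ _) (+-congʳ ∑ᴺx≈ρ))

      -- A vertex z of N not adjacent to w has ρ x z ≥ 1, so the number of such z is at most ρ times
      -- their total value ρ(1 - x w).
      9orderᴺ≤10degreeᴺ : ∀ {w} → A w ≡ true → # 9 * orderᴺ ≤ # 10 * degreeᴺ w
      9orderᴺ≤10degreeᴺ {w} Aw = degree-large (proj₁ order-bounds) 10deficit<3 (deficit-term Aw) (1≤degreeᴺ Aw) (x≤1 w)
        (≤-trans (≈⇒≤ (sym (weightᴺ≈ρx Aw))) (weightᴺ≤degreeᴺ w))
        (≤-trans (≈⇒≤ (sym (∑⟨⟩-- _ _))) (≤-trans (∑⟨⟩-mono λ z Nz → ≤-trans (≈⇒≤ (+-congˡ (-‿cong (reflexive (a-sym z w)))))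
            (≤-by (⌊ ι≤1 (adj w z) ⌋ ⊗ ⌊ 1≤ρx Nz ⌋) (solve 3 (λ ρ a x → (:# 1 :- a) :* (ρ :* x :- :# 1) := ρ :* ((:# 1 :- a) :* x) :- (:# 1 :- a)) refl ρ (a w z) (x z))))
          (≈⇒≤ (trans (∑⟨⟩-* ρ _) (*-congˡ (trans (missing-weight w) (trans (+-congˡ (-‿cong (weightᴺ≈ρx Aw))) (solve 2 (λ ρ x → ρ :- ρ :* x := ρ :* (:# 1 :- x)) refl ρ (x w)))))))))

      9dZ<3 : # 9 * (orderᴺ * defectᴬ) < # 3
      9dZ<3 = ≤-<-trans (≤-trans (≈⇒≤ (trans (sym (*-assoc _ _ _)) (sym (∑⟨⟩-* _ _)))) (≤-trans (∑⟨⟩-mono λ w Aw →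
          ≤-by (⌊ x≤1 w ⌋ ⊗ ⌊ 9orderᴺ≤10degreeᴺ Aw ⌋) (solve 3 (λ x d c → (:# 1 :- x) :* (:# 10 :* c :- :# 9 :* d) := :# 10 :* (c :* (:# 1 :- x)) :- :# 9 :* d :* (:# 1 :- x)) refl (x w) orderᴺ (degreeᴺ w)))
        (≈⇒≤ (∑⟨⟩-* _ _)))) 10deficit<3

      complete : ∀ {y w} → N y ≡ true → A w ≡ true → adj y w ≡ true
      complete {y} {w} Ny Aw with adj y w in y≁w
      ... | true  = ≡.refl
      ... | false = ⊥-elim (missing-impossible (proj₁ order-bounds) (proj₂ order-bounds) 9dZ<3 yk≤ρZ value 1≤k 1≤s-k)
        where
        k : Carrier
        k = ∑⟨ A ⟩ λ z → 1# - a y z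
        s-k≈ : orderᴬ - k ≈ ∑⟨ A ⟩ (a y)
        s-k≈ = trans (sym (∑⟨⟩-- _ _)) (∑⟨⟩-cong λ z _ → solve 1 (λ a → :# 1 :- (:# 1 :- a) := a) refl (a y z))
        1-a≥0 : ∀ w z → 0# ≤ 1# - a w z
        1-a≥0 w z = ⌊ ι≤1 (adj w z) ⌋
        1≤k : 1# ≤ k
        1≤k = ≤-trans (≈⇒≤ (trans (solve 0 (:# 1 := :# 1 :- :# 0) refl) (+-congˡ (-‿cong (reflexive (≡.cong ι (≡.sym y≁w))))))) (term≤∑⟨⟩ (λ z _ → 1-a≥0 y z) Aw)
        1≤s-k : 1# ≤ orderᴬ - k
        1≤s-k = ≤-trans (≈⇒≤ (reflexive (≡.cong ι (≡.sym (flip Ny))))) (≤-trans (term≤∑⟨⟩ (λ z _ → ι≥0 (adj y z)) Ae) (≈⇒≤ (sym s-k≈)))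
        -- The non-neighbours of y are one row of the missing pairs between N and A, whose total
        -- value is Σ (ρ - p_z) = ρZ.
        yk≤ρZ : x y * k ≤ ρ * defectᴬ
        yk≤ρZ = ≤-trans (≈⇒≤ (trans (*-congˡ (∑⟨⟩-cong λ z _ → +-congˡ (-‿cong (reflexive (a-sym y z))))) (sym (∑⟨⟩-* _ _)))) (≤-trans
          (term≤∑⟨⟩ {f = λ y → ∑⟨ A ⟩ λ z → x y * (1# - a z y)} (λ y _ → ∑⟨⟩-nonneg λ z _ → x≥0 y ⊗ 1-a≥0 z y) Ny)
          (≈⇒≤ (trans (∑⟨⟩-comm _) (trans (∑⟨⟩-cong λ z Az → trans (∑⟨⟩-cong λ y _ → *-comm _ _) (trans (missing-weight z)
            (trans (+-congˡ (-‿cong (weightᴺ≈ρx Az))) (solve 2 (λ ρ x → ρ :- ρ :* x := ρ :* (:# 1 :- x)) refl ρ (x z))))) (∑⟨⟩-* _ _)))))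
        value : # 3 * ρ + # 7 * (ρ * (orderᴬ - k)) ≤ # 10 * (ρ * (ρ * x y))
        value = ≤-trans (≤-by ⌊ surplus ⌋ (trans (+-congʳ surplus≈) (trans (solve 3 (λ t ρ s → (:# 10 :* t :- :# 7 :* ρ :* s) :- :# 3 :* ρ := :# 10 :* t :- (:# 3 :* ρ :+ :# 7 :* (ρ :* s))) refl (transfer y) ρ (∑⟨ A ⟩ (a y)))
            (+-congˡ (-‿cong (+-congˡ (*-congˡ (*-congˡ (sym s-k≈)))))))))
          (*-monoˡ-≤ (#≥0 10) (transfer≤ρ²x y))
          where
          surplusTerm : Fin n → Carrier
          surplusTerm z = a y z * (# 10 * weightᴺ z - # 7 * ρ)
          surplus≈ : ∑⟨ A ⟩ surplusTerm ≈ # 10 * transfer y - # 7 * ρ * ∑⟨ A ⟩ (a y)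
          surplus≈ = trans (∑⟨⟩-cong λ z _ → solve 3 (λ a w ρ → a :* (:# 10 :* w :- :# 7 :* ρ) := :# 10 :* (a :* w) :- :# 7 :* ρ :* a) refl (a y z) (weightᴺ z) ρ)
            (trans (∑⟨⟩-- _ _) (+-cong (∑⟨⟩-* _ _) (-‿cong (∑⟨⟩-* _ _))))
          -- Every neighbour of y in A carries at least 7ρ/10, and e carries the full ρ; the surplus
          -- 3ρ/10 of e is kept.
          surplus : # 3 * ρ ≤ ∑⟨ A ⟩ surplusTerm
          surplus = ≤-trans (≈⇒≤ (trans (solve 1 (λ ρ → :# 3 :* ρ := :# 10 :* ρ :- :# 7 :* ρ) refl ρ) (trans (+-congʳ (*-congˡ (sym weightᴺ-e))) (sym (ι-true _ (flip Ny))))))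
            (term≤∑⟨⟩ (λ z Az → ι≥0 _ ⊗ ⌊ 7ρ≤10weightᴺ Az ⌋) Ae)

-- Counting and sorting vertices by a predicate.

count : ∀ {n} → (Fin n → Bool) → ℕ
count {zero}  P = 0
count {suc n} P = if P zero then suc (count (P ∘ suc)) else count (P ∘ suc)

count-true : ∀ {n} (P : Fin (suc n) → Bool) → P zero ≡ true → count P ≡ suc (count (P ∘ suc))
count-true P P₀ rewrite P₀ = ≡.refl

count-false : ∀ {n} (P : Fin (suc n) → Bool) → P zero ≡ false → count P ≡ count (P ∘ suc)
count-false P P₀ rewrite P₀ = ≡.refl

-- The sizes are fields equated with `count`: the recursion can then build them with plain `suc`,
-- and a user can match the equations with `refl`.
record Partition {n} (P : Fin n → Bool) : Set where
  field
    trues falses : ℕ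
    trues≡count  : trues ≡ count P
    falses≡count : falses ≡ count (not ∘ P)
    sort         : Fin n ↔ (Fin trues ⊎ Fin falses)

  open Inverse sort public using (to; from; strictlyInverseˡ; strictlyInverseʳ)

  field
    from-inj₁ : ∀ k → P (from (inj₁ k)) ≡ true
    from-inj₂ : ∀ k → P (from (inj₂ k)) ≡ false

  from-injective : ∀ {x y} → from x ≡ from y → x ≡ y
  from-injective {x} {y} eq = ≡.trans (≡.sym (strictlyInverseˡ x)) (≡.trans (≡.cong to eq) (strictlyInverseˡ y))

partition : ∀ {n} (P : Fin n → Bool) → Partition P
partition {zero}  P = record
  { trues = 0 ; falses = 0 ; trues≡count = ≡.refl ; falses≡count = ≡.refl
  ; sort = mk↔ₛ′ (λ ()) (λ { (inj₁ ()) ; (inj₂ ()) }) (λ { (inj₁ ()) ; (inj₂ ()) }) λ ()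
  ; from-inj₁ = λ () ; from-inj₂ = λ () }
partition {suc n} P with partition (P ∘ suc) | P zero in P₀
... | rest | true = record
  { trues = suc trues ; falses = falses
  ; trues≡count = ≡.trans (≡.cong suc trues≡count) (≡.sym (count-true P P₀))
  ; falses≡count = ≡.trans falses≡count (≡.sym (count-false (not ∘ P) (≡.cong not P₀)))
  ; sort = mk↔ₛ′ to′ from′ to′-from′ from′-to′
  ; from-inj₁ = λ { zero → P₀ ; (suc k) → from-inj₁ k } ; from-inj₂ = from-inj₂ }
  where
  open Partition rest
  to′ : Fin (suc n) → Fin (suc trues) ⊎ Fin falses
  to′ zero    = inj₁ zero
  to′ (suc i) = ⊎-map suc id (to i)
  from′ : Fin (suc trues) ⊎ Fin falses → Fin (suc n)
  from′ (inj₁ zero)    = zero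
  from′ (inj₁ (suc k)) = suc (from (inj₁ k))
  from′ (inj₂ k)       = suc (from (inj₂ k))
  to′-from′ : ∀ y → to′ (from′ y) ≡ y
  to′-from′ (inj₁ zero)    = ≡.refl
  to′-from′ (inj₁ (suc k)) = ≡.cong (⊎-map suc id) (strictlyInverseˡ (inj₁ k))
  to′-from′ (inj₂ k)       = ≡.cong (⊎-map suc id) (strictlyInverseˡ (inj₂ k))
  from′-shift : ∀ y → from′ (⊎-map suc id y) ≡ suc (from y)
  from′-shift (inj₁ k) = ≡.refl
  from′-shift (inj₂ k) = ≡.refl
  from′-to′ : ∀ i → from′ (to′ i) ≡ i
  from′-to′ zero    = ≡.refl
  from′-to′ (suc i) = ≡.trans (from′-shift (to i)) (≡.cong suc (strictlyInverseʳ i))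
... | rest | false = record
  { trues = trues ; falses = suc falses
  ; trues≡count = ≡.trans trues≡count (≡.sym (count-false P P₀))
  ; falses≡count = ≡.trans (≡.cong suc falses≡count) (≡.sym (count-true (not ∘ P) (≡.cong not P₀)))
  ; sort = mk↔ₛ′ to′ from′ to′-from′ from′-to′
  ; from-inj₁ = from-inj₁ ; from-inj₂ = λ { zero → P₀ ; (suc k) → from-inj₂ k } }
  where
  open Partition rest
  to′ : Fin (suc n) → Fin trues ⊎ Fin (suc falses)
  to′ zero    = inj₂ zero
  to′ (suc i) = ⊎-map id suc (to i)
  from′ : Fin trues ⊎ Fin (suc falses) → Fin (suc n)
  from′ (inj₁ k)       = suc (from (inj₁ k))
  from′ (inj₂ zero)    = zero
  from′ (inj₂ (suc k)) = suc (from (inj₂ k))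
  to′-from′ : ∀ y → to′ (from′ y) ≡ y
  to′-from′ (inj₁ k)       = ≡.cong (⊎-map id suc) (strictlyInverseˡ (inj₁ k))
  to′-from′ (inj₂ zero)    = ≡.refl
  to′-from′ (inj₂ (suc k)) = ≡.cong (⊎-map id suc) (strictlyInverseˡ (inj₂ k))
  from′-shift : ∀ y → from′ (⊎-map id suc y) ≡ suc (from y)
  from′-shift (inj₁ k) = ≡.refl
  from′-shift (inj₂ k) = ≡.refl
  from′-to′ : ∀ i → from′ (to′ i) ≡ i
  from′-to′ zero    = ≡.refl
  from′-to′ (suc i) = ≡.trans (from′-shift (to i)) (≡.cong suc (strictlyInverseʳ i))

T⇒≡ : ∀ {b} → T b → b ≡ true
T⇒≡ = Equivalence.to Bool.T-≡

≡⇒T : ∀ {b} → b ≡ true → T b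
≡⇒T = Equivalence.from Bool.T-≡

∧-true : ∀ {a b} → a ∧ b ≡ true → a ≡ true × b ≡ true
∧-true {true} {true} _ = ≡.refl , ≡.refl

-- Books from common neighbours.

module _ (G : Graph) where
  open Graph G using (adj) renaming (sym to adj-sym; irrefl to adj-irrefl)

  book⊑ : ∀ {u v k} → adj u v ≡ true → k ℕ.≤ count (λ w → adj u w ∧ adj v w) → book k ⊑ G
  book⊑ {u} {v} {k} u~v k≤ = record
    { embed     = embed ∘ splitAt 2
    ; injective = λ {x} {y} eq → ≡.trans (≡.sym (Fin.join-splitAt 2 k x)) (≡.trans (≡.cong (Fin.join 2 k) (embed-injective (splitAt 2 x) (splitAt 2 y) eq)) (Fin.join-splitAt 2 k y))
    ; edge      = λ x y → edge (splitAt 2 x) (splitAt 2 y) }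
    where
    open Partition (partition λ w → adj u w ∧ adj v w)
    apex : Fin k → Graph.Vertex G
    apex i = from (inj₁ (inject≤ i (≡.subst (k ℕ.≤_) (≡.sym trues≡count) k≤)))
    u~apex : ∀ i → adj u (apex i) ≡ true
    u~apex i = proj₁ (∧-true (from-inj₁ _))
    v~apex : ∀ i → adj v (apex i) ≡ true
    v~apex i = proj₂ (∧-true {adj u (apex i)} (from-inj₁ _))
    adjacent-≢ : ∀ {x y} → adj x y ≡ true → x ≢ y
    adjacent-≢ {x} x~x ≡.refl = contradiction (≡.trans (≡.sym x~x) (adj-irrefl x)) λ ()
    flip : ∀ {x y} → adj x y ≡ true → adj y x ≡ true
    flip {x} {y} x~y = ≡.trans (adj-sym y x) x~y
    embed : Fin 2 ⊎ Fin k → Graph.Vertex G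
    embed (inj₁ zero)       = u
    embed (inj₁ (suc zero)) = v
    embed (inj₂ i)          = apex i
    embed-injective : ∀ x y → embed x ≡ embed y → x ≡ y
    embed-injective (inj₁ zero)       (inj₁ zero)       eq = ≡.refl
    embed-injective (inj₁ zero)       (inj₁ (suc zero)) eq = contradiction eq (adjacent-≢ u~v)
    embed-injective (inj₁ (suc zero)) (inj₁ zero)       eq = contradiction eq (adjacent-≢ (flip u~v))
    embed-injective (inj₁ (suc zero)) (inj₁ (suc zero)) eq = ≡.refl
    embed-injective (inj₁ zero)       (inj₂ j)          eq = contradiction eq (adjacent-≢ (u~apex j))
    embed-injective (inj₁ (suc zero)) (inj₂ j)          eq = contradiction eq (adjacent-≢ (v~apex j))
    embed-injective (inj₂ i)          (inj₁ zero)       eq = contradiction eq (adjacent-≢ (flip (u~apex i)))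
    embed-injective (inj₂ i)          (inj₁ (suc zero)) eq = contradiction eq (adjacent-≢ (flip (v~apex i)))
    embed-injective (inj₂ i)          (inj₂ j)          eq =
      ≡.cong inj₂ (Fin.inject≤-injective _ _ i j (inj₁-injective (from-injective eq)))
    edge : ∀ x y → T (bookAdj x y) → T (adj (embed x) (embed y))
    edge (inj₁ zero)       (inj₁ (suc zero)) _ = ≡⇒T u~v
    edge (inj₁ (suc zero)) (inj₁ zero)       _ = ≡⇒T (flip u~v)
    edge (inj₁ zero)       (inj₁ zero)       ()
    edge (inj₁ (suc zero)) (inj₁ (suc zero)) ()
    edge (inj₁ zero)       (inj₂ j)          _ = ≡⇒T (u~apex j)
    edge (inj₁ (suc zero)) (inj₂ j)          _ = ≡⇒T (v~apex j)
    edge (inj₂ i)          (inj₁ zero)       _ = ≡⇒T (flip (u~apex i))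
    edge (inj₂ i)          (inj₁ (suc zero)) _ = ≡⇒T (flip (v~apex i))

-- Recognising the exceptional graphs up to isomorphism.

transpose-source : ∀ {n} (i j : Fin n) → transpose i j ⟨$⟩ʳ i ≡ j
transpose-source i j rewrite dec-true (i Fin.≟ i) ≡.refl = ≡.refl

transpose-fixes : ∀ {n} {i j k : Fin n} → k ≢ i → k ≢ j → transpose i j ⟨$⟩ʳ k ≡ k
transpose-fixes {i = i} {j} {k} k≢i k≢j rewrite dec-false (k Fin.≟ i) k≢i | dec-false (k Fin.≟ j) k≢j = ≡.refl

permutation-injective : ∀ {n} (π : Permutation n n) {i j} → π ⟨$⟩ʳ i ≡ π ⟨$⟩ʳ j → i ≡ j
permutation-injective π {i} {j} eq = ≡.trans (≡.sym (Inverse.strictlyInverseʳ π i)) (≡.trans (≡.cong (Inverse.from π) eq) (Inverse.strictlyInverseʳ π j))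

-- `S⁺` places its extra edge between vertices 0 and 1 of the second part. The second transposition
-- leaves 0 alone, because the image of j under the first differs from 0.
move-to-front : ∀ {n} {i j : Fin n} → i ≢ j → ∃ λ (π : Permutation n n) → toℕ (π ⟨$⟩ʳ i) ≡ 0 × toℕ (π ⟨$⟩ʳ j) ≡ 1
move-to-front {suc zero}    {zero} {zero} i≢j = contradiction ≡.refl i≢j
move-to-front {suc (suc n)} {i}    {j}    i≢j = π₁ ∘ₚ π₂ , ≡.cong toℕ i↦0 , ≡.cong toℕ (transpose-source j′ (suc zero))
  where
  π₁ π₂ : Permutation (suc (suc n)) (suc (suc n))
  π₁ = transpose i zero
  j′ : Fin (suc (suc n))
  j′ = π₁ ⟨$⟩ʳ j
  π₂ = transpose j′ (suc zero)
  0≢j′ : zero ≢ j′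
  0≢j′ 0≡j′ = i≢j (permutation-injective π₁ (≡.trans (transpose-source i zero) 0≡j′))
  i↦0 : π₂ ⟨$⟩ʳ (π₁ ⟨$⟩ʳ i) ≡ zero
  i↦0 = ≡.trans (≡.cong (π₂ ⟨$⟩ʳ_) (transpose-source i zero)) (transpose-fixes 0≢j′ λ ())

extraEdge-true : ∀ a b → extraEdge a b ≡ true → (a ≡ 0 × b ≡ 1) ⊎ (a ≡ 1 × b ≡ 0)
extraEdge-true 0             1             _ = inj₁ (≡.refl , ≡.refl)
extraEdge-true 1             0             _ = inj₂ (≡.refl , ≡.refl)
extraEdge-true 0             0             ()
extraEdge-true 0             (suc (suc _)) ()
extraEdge-true 1             1             ()
extraEdge-true 1             (suc (suc _)) ()
extraEdge-true (suc (suc _)) _             ()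

module _ (G : Graph) (A : Graph.Vertex G → Bool) where
  open Graph G using (Vertex; adj) renaming (sym to adj-sym)

  -- A becomes the first part, of size s. Vertices are sorted by A, and the second part is then
  -- permuted to bring u and v to the positions 0 and 1.
  complete-bipartite-plus-edge : ∀ {u v} → u ≢ v → A u ≡ false → A v ≡ false → adj u v ≡ true →
    (∀ {x y} → A x ≡ true → A y ≡ true → adj x y ≡ false) →
    (∀ {x y} → A x ≡ false → A y ≡ true → adj x y ≡ true) →
    (∀ {x y} → A x ≡ false → A y ≡ false → adj x y ≡ true → (x ≡ u × y ≡ v) ⊎ (x ≡ v × y ≡ u)) →
    ∀ {m} (eq : m ∸ 1 ≡ count (not ∘ A) ℕ.* count A) → G ≅ S⁺ m (count A) (divides (count (not ∘ A)) eq)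
  complete-bipartite-plus-edge {u} {v} u≢v Au Av u~v independent complete unique {m} eq = isomorphism (partition A)
    where
    isomorphism : Partition A → G ≅ S⁺ m (count A) (divides (count (not ∘ A)) eq)
    -- Matching the size equations with `refl` turns the two index types into exactly the parts of
    -- `S⁺`.
    isomorphism record { trues = .(count A) ; falses = .(count (not ∘ A)) ; trues≡count = ≡.refl ; falses≡count = ≡.refl
                       ; sort = sort ; from-inj₁ = from-inj₁ ; from-inj₂ = from-inj₂ } = record
      { bijection = mk↔ₛ′ (Fin.join s t ∘ φ) (φ⁻¹ ∘ splitAt s)
          (λ k → ≡.trans (≡.cong (Fin.join s t) (φ-φ⁻¹ (splitAt s k))) (Fin.join-splitAt s t k))
          (λ x → ≡.trans (≡.cong φ⁻¹ (Fin.splitAt-join s t (φ x))) (φ⁻¹-φ x))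
      ; adj-≡ = λ x y → ≡.trans (adj≡ x y) (≡.sym (≡.cong₂ S⁺Adj (Fin.splitAt-join s t (φ x)) (Fin.splitAt-join s t (φ y)))) }
      where
      s t : ℕ
      s = count A
      t = count (not ∘ A)
      open Inverse sort using (to; from; strictlyInverseˡ; strictlyInverseʳ)
      outside : ∀ {x} → A x ≡ false → ∃ λ i → from (inj₂ i) ≡ x
      outside {x} Ax = index (to x) (strictlyInverseʳ x)
        where
        index : ∀ y → from y ≡ x → ∃ λ i → from (inj₂ i) ≡ x
        index (inj₁ k) ≡.refl = contradiction (≡.trans (≡.sym (from-inj₁ k)) Ax) λ ()
        index (inj₂ i) eq     = i , eq
      i j : Fin t
      i = proj₁ (outside Au)
      j = proj₁ (outside Av)
      i≢j : i ≢ j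
      i≢j i≡j = u≢v (≡.trans (≡.sym (proj₂ (outside Au))) (≡.trans (≡.cong (from ∘ inj₂) i≡j) (proj₂ (outside Av))))
      front : ∃ λ (π : Permutation t t) → toℕ (π ⟨$⟩ʳ i) ≡ 0 × toℕ (π ⟨$⟩ʳ j) ≡ 1
      front = move-to-front i≢j
      π : Permutation t t
      π = proj₁ front
      open Inverse π using () renaming (to to πᵗ; from to πᶠ; strictlyInverseˡ to πˡ; strictlyInverseʳ to πʳ)
      φ : Vertex → Fin s ⊎ Fin t
      φ x = ⊎-map id πᵗ (to x)
      φ⁻¹ : Fin s ⊎ Fin t → Vertex
      φ⁻¹ y = from (⊎-map id πᶠ y)
      φ-φ⁻¹ : ∀ y → φ (φ⁻¹ y) ≡ y
      φ-φ⁻¹ (inj₁ k) = ≡.cong (⊎-map id πᵗ) (strictlyInverseˡ (inj₁ k))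
      φ-φ⁻¹ (inj₂ k) = ≡.trans (≡.cong (⊎-map id πᵗ) (strictlyInverseˡ (inj₂ (πᶠ k)))) (≡.cong inj₂ (πˡ k))
      φ⁻¹-φ : ∀ x → φ⁻¹ (φ x) ≡ x
      φ⁻¹-φ x = ≡.trans (≡.cong from (unpermute (to x))) (strictlyInverseʳ x)
        where
        unpermute : ∀ y → ⊎-map id πᶠ (⊎-map id πᵗ y) ≡ y
        unpermute (inj₁ k) = ≡.refl
        unpermute (inj₂ k) = ≡.cong inj₂ (πʳ k)
      toℕ-injective : ∀ {k l} {p} → toℕ (πᵗ k) ≡ p → toℕ (πᵗ l) ≡ p → k ≡ l
      toℕ-injective k↦ l↦ = permutation-injective π (Fin.toℕ-injective (≡.trans k↦ (≡.sym l↦)))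
      inner : ∀ k l → adj (from (inj₂ k)) (from (inj₂ l)) ≡ extraEdge (toℕ (πᵗ k)) (toℕ (πᵗ l))
      inner k l with adj (from (inj₂ k)) (from (inj₂ l)) in k~l | extraEdge (toℕ (πᵗ k)) (toℕ (πᵗ l)) in extra
      ... | true  | true  = ≡.refl
      ... | false | false = ≡.refl
      ... | true  | false = contradiction (≡.trans (≡.sym (placed (unique (from-inj₂ k) (from-inj₂ l) k~l))) extra) λ ()
        where
        index : ∀ {k x} (Ax : A x ≡ false) → from (inj₂ k) ≡ x → k ≡ proj₁ (outside Ax)
        index {k} Ax eq = inj₂-injective (≡.trans (≡.sym (strictlyInverseˡ (inj₂ k)))
          (≡.trans (≡.cong to (≡.trans eq (≡.sym (proj₂ (outside Ax))))) (strictlyInverseˡ _)))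
        placed : (from (inj₂ k) ≡ u × from (inj₂ l) ≡ v) ⊎ (from (inj₂ k) ≡ v × from (inj₂ l) ≡ u) →
                 extraEdge (toℕ (πᵗ k)) (toℕ (πᵗ l)) ≡ true
        placed (inj₁ (k≡u , l≡v)) = ≡.cong₂ extraEdge (≡.trans (≡.cong (toℕ ∘ πᵗ) (index Au k≡u)) (proj₁ (proj₂ front)))
                                                      (≡.trans (≡.cong (toℕ ∘ πᵗ) (index Av l≡v)) (proj₂ (proj₂ front)))
        placed (inj₂ (k≡v , l≡u)) = ≡.cong₂ extraEdge (≡.trans (≡.cong (toℕ ∘ πᵗ) (index Av k≡v)) (proj₂ (proj₂ front)))
                                                      (≡.trans (≡.cong (toℕ ∘ πᵗ) (index Au l≡u)) (proj₁ (proj₂ front)))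
      ... | false | true  = contradiction (≡.trans (≡.sym k~l) (adjacent (extraEdge-true _ _ extra))) λ ()
        where
        adjacent : ∀ {k l} → (toℕ (πᵗ k) ≡ 0 × toℕ (πᵗ l) ≡ 1) ⊎ (toℕ (πᵗ k) ≡ 1 × toℕ (πᵗ l) ≡ 0) → adj (from (inj₂ k)) (from (inj₂ l)) ≡ true
        adjacent (inj₁ (k↦0 , l↦1)) = ≡.trans (≡.cong₂ adj
          (≡.trans (≡.cong (from ∘ inj₂) (toℕ-injective k↦0 (proj₁ (proj₂ front)))) (proj₂ (outside Au)))
          (≡.trans (≡.cong (from ∘ inj₂) (toℕ-injective l↦1 (proj₂ (proj₂ front)))) (proj₂ (outside Av)))) u~v
        adjacent (inj₂ (k↦1 , l↦0)) = ≡.trans (≡.cong₂ adj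
          (≡.trans (≡.cong (from ∘ inj₂) (toℕ-injective k↦1 (proj₂ (proj₂ front)))) (proj₂ (outside Av)))
          (≡.trans (≡.cong (from ∘ inj₂) (toℕ-injective l↦0 (proj₁ (proj₂ front)))) (proj₂ (outside Au)))) (≡.trans (adj-sym v u) u~v)
      sorted : ∀ y z → adj (from y) (from z) ≡ S⁺Adj (⊎-map id πᵗ y) (⊎-map id πᵗ z)
      sorted (inj₁ k) (inj₁ l) = independent (from-inj₁ k) (from-inj₁ l)
      sorted (inj₁ k) (inj₂ l) = ≡.trans (adj-sym _ _) (complete (from-inj₂ l) (from-inj₁ k))
      sorted (inj₂ k) (inj₁ l) = complete (from-inj₂ k) (from-inj₁ l)
      sorted (inj₂ k) (inj₂ l) = inner k l
      adj≡ : ∀ x y → adj x y ≡ S⁺Adj (φ x) (φ y)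
      adj≡ x y = ≡.trans (≡.sym (≡.cong₂ adj (strictlyInverseʳ x) (strictlyInverseʳ y))) (sorted (to x) (to y))

-- From graph hypotheses to field inequalities, and back.

module Graphs {c ℓ₁ ℓ₂} (ℝ : CompleteOrderedField c ℓ₁ ℓ₂) where
  open Extremal ℝ public
  open Solver using (solve; _:=_; _:+_; _:*_; _:-_; :-_)

  ∑ι≈count : ∀ {n} (P : Fin n → Bool) → ∑ (λ i → ι (P i)) ≈ # count P
  ∑ι≈count {zero}  P = reflexive (∑-empty _)
  ∑ι≈count {suc n} P = trans (reflexive (∑-suc _)) (trans (+-congˡ (∑ι≈count (P ∘ suc))) (step (P zero)))
    where
    step : ∀ b {k} → ι b + # k ≈ # (if b then suc k else k)
    step true {k} = sym (#-suc k)
    step false    = +-identityˡ _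

  ι-∧ : ∀ s t → ι (s ∧ t) ≈ ι s * ι t
  ι-∧ true  t = sym (*-identityˡ _)
  ι-∧ false t = sym (zeroˡ _)

  module _ {ℓ} {X : Set ℓ} where

    ∑ᴸ : (X → Carrier) → List X → Carrier
    ∑ᴸ f = foldr (λ x s → f x + s) 0#

    ∑ᴸ-++ : ∀ f xs ys → ∑ᴸ f (xs ++ ys) ≈ ∑ᴸ f xs + ∑ᴸ f ys
    ∑ᴸ-++ f []       ys = sym (+-identityˡ _)
    ∑ᴸ-++ f (x ∷ xs) ys = trans (+-congˡ (∑ᴸ-++ f xs ys)) (sym (+-assoc _ _ _))

    ∑ᴸ-tabulate : ∀ {n} f (g : Fin n → X) → ∑ᴸ f (tabulate g) ≈ ∑ (λ i → f (g i))
    ∑ᴸ-tabulate {zero}  f g = sym (reflexive (∑-empty _))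
    ∑ᴸ-tabulate {suc n} f g = trans (+-congˡ (∑ᴸ-tabulate f (g ∘ suc))) (sym (reflexive (∑-suc _)))

    length-filter : ∀ {p} {P : Pred X p} (P? : Decidable P) xs → # (length (filter P? xs)) ≈ ∑ᴸ (λ x → ι (does (P? x))) xs
    length-filter P? []       = refl
    length-filter P? (x ∷ xs) with does (P? x)
    ... | true  = trans (#-suc (length (filter P? xs))) (+-congˡ (length-filter P? xs))
    ... | false = trans (length-filter P? xs) (sym (+-identityˡ _))

  ∑ᴸ-map : ∀ {ℓ ℓ′} {X : Set ℓ} {Y : Set ℓ′} f (g : X → Y) xs → ∑ᴸ f (map g xs) ≈ ∑ᴸ (λ x → f (g x)) xs
  ∑ᴸ-map f g []       = refl
  ∑ᴸ-map f g (x ∷ xs) = +-congˡ (∑ᴸ-map f g xs)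

  ∑ᴸ-cartesianProduct : ∀ {ℓ ℓ′} {X : Set ℓ} {Y : Set ℓ′} (f : X × Y → Carrier) xs ys →
                        ∑ᴸ f (cartesianProduct xs ys) ≈ ∑ᴸ (λ x → ∑ᴸ (λ y → f (x , y)) ys) xs
  ∑ᴸ-cartesianProduct f []       ys = refl
  ∑ᴸ-cartesianProduct f (x ∷ xs) ys = trans (∑ᴸ-++ f (map (x ,_) ys) (cartesianProduct xs ys)) (+-cong (∑ᴸ-map f (x ,_) ys) (∑ᴸ-cartesianProduct f xs ys))

  module _ (G : Graph) where
    open Graph G using (order; Vertex; adj; size) renaming (sym to adj-sym; irrefl to adj-irrefl)

    -- `size` lists pairs with u < v only; an adjacent pair is therefore listed in exactly one of
    -- its two orders.
    handshake : # 2 * # size ≈ ∑ (λ u → ∑ λ v → ι (adj u v))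
    handshake = trans (solve 1 (λ m → :# 2 :* m := m :+ m) refl (# size)) (trans (+-cong size≈ (trans size≈ (∑-comm _)))
      (trans (sym (∑-+ _ _)) (∑-cong λ u → trans (sym (∑-+ _ _)) (∑-cong λ v → both u v))))
      where
      listed : Vertex → Vertex → Bool
      listed u v = does (u Fin.<? v) ∧ adj u v
      size≈ : # size ≈ ∑ (λ u → ∑ λ v → ι (listed u v))
      size≈ = trans (length-filter _ (cartesianProduct (allFin order) (allFin order)))
        (trans (∑ᴸ-cartesianProduct _ (allFin order) (allFin order))
        (trans (∑ᴸ-tabulate {X = Vertex} _ id) (∑-cong λ u → ∑ᴸ-tabulate {X = Vertex} _ id)))
      both : ∀ u v → ι (listed u v) + ι (listed v u) ≈ ι (adj u v)
      both u v with Fin.<-cmp u v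
      ... | tri< u<v _ v≮u rewrite dec-true (u Fin.<? v) u<v | dec-false (v Fin.<? u) v≮u = +-identityʳ _
      ... | tri> u≮v _ v<u rewrite dec-false (u Fin.<? v) u≮v | dec-true (v Fin.<? u) v<u = trans (+-identityˡ _) (reflexive (≡.cong ι (adj-sym v u)))
      ... | tri≈ u≮u ≡.refl _ rewrite dec-false (u Fin.<? u) u≮u | adj-irrefl u = +-identityˡ _

    book-free⇒codegree : ∀ {r} → (book (r ℕ.+ 1) -Free) G → ∀ {u v} → adj u v ≡ true → ∑ (λ w → ι (adj u w) * ι (adj v w)) ≤ # r
    book-free⇒codegree {r} free {u} {v} u~v = ≤-trans (≈⇒≤ (trans (∑-cong λ w → sym (ι-∧ (adj u w) (adj v w))) (∑ι≈count _))) (#-mono-≤ few)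
      where
      few : count (λ w → adj u w ∧ adj v w) ℕ.≤ r
      few with ℕₚ.≤-<-connex (count (λ w → adj u w ∧ adj v w)) r
      ... | inj₁ few  = few
      ... | inj₂ many = contradiction (book⊑ G u~v (ℕₚ.≤-trans (ℕₚ.≤-reflexive (ℕₚ.+-comm r 1)) many)) free

    -- The edges form a matching, so a vertex can be coloured by whether its neighbour comes
    -- earlier.
    unique-neighbours⇒bipartite : (∀ {u v w} → adj u v ≡ true → adj u w ≡ true → v ≡ w) → Bipartite G
    unique-neighbours⇒bipartite unique = side , alternates
      where
      earlier? : ∀ u → Dec (∃ λ v → v Fin.< u × adj u v ≡ true)
      earlier? u = Fin.any? λ v → v Fin.<? u ×-dec adj u v Bool.≟ true
      side : Vertex → Bool
      side u = does (earlier? u)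
      later : ∀ {u v} → u Fin.< v → adj u v ≡ true → side u ≢ side v
      later {u} {v} u<v u~v same = contradiction (≡.trans (≡.sym u-first) (≡.trans same v-second)) λ ()
        where
        v-second : side v ≡ true
        v-second = dec-true (earlier? v) (u , u<v , ≡.trans (adj-sym v u) u~v)
        u-first : side u ≡ false
        u-first = dec-false (earlier? u) λ { (w , w<u , u~w) → ℕₚ.<-asym u<v (≡.subst (Fin._< u) (unique u~w u~v) w<u) }
      alternates : ∀ u v → Graph.Edge G u v → side u ≢ side v
      alternates u v Euv with Fin.<-cmp u v
      ... | tri< u<v _ _    = later u<v (T⇒≡ Euv)
      ... | tri≈ _ ≡.refl _ = contradiction (≡.trans (≡.sym (T⇒≡ Euv)) (adj-irrefl u)) λ ()
      ... | tri> _ _ v<u    = λ same → later v<u (≡.trans (adj-sym v u) (T⇒≡ Euv)) (≡.sym same)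

    -- If ρ ≤ 1, the value 1 spreads from the maximal vertex to all vertices, so no vertex has two neighbours.
    spectral-radius>1 : ∀ {ρ} → Connected G → ¬ Bipartite G → PerronVector (adjacencyMatrix ℝ G) ρ → 1# < ρ
    spectral-radius>1 {ρ} connected nonbipartite perronVector with <-or-≥ 1# ρ
    ... | inj₁ 1<ρ = 1<ρ
    ... | inj₂ ρ≤1 = contradiction (unique-neighbours⇒bipartite unique) nonbipartite
      where
      open PerronVector perronVector
      ρx≤x : ∀ u → ρ * x u ≤ x u
      ρx≤x u = ≤-by (x≥0 u ⊗ ⌊ ρ≤1 ⌋) (solve 2 (λ ρ x → x :* (:# 1 :- ρ) := x :- ρ :* x) refl ρ (x u))
      product≥0 : ∀ u v → 0# ≤ ι (adj u v) * x v
      product≥0 u v = ι≥0 _ ⊗ x≥0 v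
      spread-one : ∀ {u v} → Star (Graph.Edge G) u v → 1# ≤ x u → 1# ≤ x v
      spread-one Star.ε                 1≤x = 1≤x
      spread-one (_◅_ {u} {w} Euw walk) 1≤x = spread-one walk (≤-trans 1≤x (≤-trans
        (≈⇒≤ (sym (ι-true (x u) (≡.trans (adj-sym w u) (T⇒≡ Euw))))) (≤-trans (term≤∑ (product≥0 w) u) (≤-trans (≈⇒≤ (eigenvector w)) (ρx≤x w)))))
      1≤x : ∀ v → 1# ≤ x v
      1≤x v = spread-one (connected top v) (≈⇒≤ (sym x-top))
      unique : ∀ {u v w} → adj u v ≡ true → adj u w ≡ true → v ≡ w
      unique {u} {v} {w} u~v u~w with v Fin.≟ w
      ... | yes v≡w = v≡w
      ... | no  v≢w = ⊥-elim (≤⇒≯ (≤-trans (+-mono-≤ (1≤x v) (1≤x w)) (≤-trans (≈⇒≤ (sym (+-cong (ι-true _ u~v) (ι-true _ u~w))))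
            (≤-trans (twoTerms≤∑ (product≥0 u) v≢w) (≤-trans (≈⇒≤ (eigenvector u)) (≤-trans (ρx≤x u) (x≤1 u))))))
            (<-by 0<1 (solve 0 (:# 1 := (:# 1 :+ :# 1) :- :# 1) refl)))

  -- Here 240² = 57600 exceeds 239² by 479, more than the lost 1. The bound ρ > 1 excludes a
  -- negative number with a large square.
  spectral-radius-large : ∀ {r m ρ} → 1 ℕ.≤ r → (240 ℕ.* r) ℕ.^ 2 ℕ.≤ m → 1# < ρ → # m - 1# < ρ * ρ → # 239 * # r ≤ ρ
  spectral-radius-large {r} {m} {ρ} 1≤r m≥ 1<ρ m-1<ρ² with <-or-≥ ρ (# 239 * # r)
  ... | inj₂ large = large
  ... | inj₁ small = ⊥-elim (impossible
        (((⌊ m≥′ ⌋ ⊕ <⇒≤ ⌊ small ⌋⁺ ⊗ (#≥0 239 ⊗ #≥0 r ⊕ (0≤1 ⊕ <⇒≤ ⌊ 1<ρ ⌋⁺)) ⊕ #≥0 479 ⊗ (⌊ #-mono-≤ 1≤r ⌋ ⊗ (⌊ #-mono-≤ 1≤r ⌋ ⊕ #≥0 2))) ⊕ #≥0 478) ⊕⁺ ⌊ m-1<ρ² ⌋⁺)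
        (solve 3 (λ r m ρ → (m :- :# 57600 :* (r :* r)) :+ (:# 239 :* r :- ρ) :* (:# 239 :* r :+ (:# 1 :+ (ρ :- :# 1))) :+ :# 479 :* ((r :- :# 1) :* ((r :- :# 1) :+ :# 2))
             :+ :# 478 :+ (ρ :* ρ :- (m :- :# 1)) := :# 0) refl (# r) (# m) ρ))
    where
    square : (240 ℕ.* r) ℕ.^ 2 ≡ 57600 ℕ.* (r ℕ.* r)
    square = ≡.trans (≡.cong (240 ℕ.* r ℕ.*_) (ℕₚ.*-identityʳ (240 ℕ.* r))) (ℕₚ.[m*n]*[o*p]≡[m*o]*[n*p] 240 r 240 r)
    m≥′ : # 57600 * (# r * # r) ≤ # m
    m≥′ = ≤-trans (≈⇒≤ (sym (trans (#-* 57600 (r ℕ.* r)) (*-congˡ (#-* r r))))) (#-mono-≤ (≡.subst (ℕ._≤ m) square m≥))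

  inverse-positive : ∀ {x} → 0# < x → 0# < x ⁻¹
  inverse-positive {x} 0<x with x ≟ 0#
  ... | yes x≈0 = contradiction 0<x (<-irrefl (sym x≈0))
  ... | no  x≉0 with <-or-≥ 0# (proj₁ (invertible x x≉0))
  ...   | inj₁ 0<x⁻¹ = 0<x⁻¹
  ...   | inj₂ x⁻¹≤0 = ⊥-elim (≤⇒≯ (≤-trans (≈⇒≤ (sym (proj₂ (invertible x x≉0)))) (≤-trans (*-monoˡ-≤ (<⇒≤ 0<x) x⁻¹≤0) (≈⇒≤ (zeroʳ x)))) 0<1)

  -- Any ρ² > m - 1 already forces one of the exceptional graphs.
  module Exceptional (r m : ℕ) (G : Graph) {ρ : Carrier} (1≤r : 1 ℕ.≤ r) (connected : Connected G) (nonbipartite : ¬ Bipartite G)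
                     (size≡m : Graph.size G ≡ m) (m≥ : (240 ℕ.* r) ℕ.^ 2 ℕ.≤ m) (free : (book (r ℕ.+ 1) -Free) G)
                     (perronVector : PerronVector (adjacencyMatrix ℝ G) ρ) (m-1<ρ² : # m - 1# < ρ * ρ) where
    open Graph G using (adj) renaming (sym to adj-sym; irrefl to adj-irrefl)

    open Cases adj adj-sym adj-irrefl {ρ} {# r} (#-mono-≤ 1≤r)
      (spectral-radius-large 1≤r m≥ (spectral-radius>1 G connected nonbipartite perronVector) m-1<ρ²)
      perronVector (book-free⇒codegree G free) {# m} (trans (*-congˡ (reflexive (≡.cong #_ (≡.sym size≡m)))) (handshake G)) m-1<ρ²

    edgeInside? : Dec (∃ λ u → ∃ λ v → N u ≡ true × N v ≡ true × adj u v ≡ true)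
    edgeInside? = Fin.any? λ u → Fin.any? λ v → N u Bool.≟ true ×-dec N v Bool.≟ true ×-dec adj u v Bool.≟ true

    edgeless-impossible : ¬ (∃ λ u → ∃ λ v → N u ≡ true × N v ≡ true × adj u v ≡ true) → ⊥
    edgeless-impossible none = nonbipartite (N , λ u v Euv → separate (T⇒≡ Euv))
      where
      edgeless : ∀ {u v} → N u ≡ true → N v ≡ true → adj u v ≡ false
      edgeless {u} {v} Nu Nv = Bool.¬-not λ u~v → none (u , v , Nu , Nv , u~v)
      separate : ∀ {u v} → adj u v ≡ true → N u ≢ N v
      separate {u} {v} u~v same = separate′ (N u) (N v) ≡.refl ≡.refl same
        where
        separate′ : ∀ s t → N u ≡ s → N v ≡ t → s ≢ t
        separate′ true  true  Nu Nv _ = contradiction (≡.trans (≡.sym u~v) (edgeless Nu Nv)) λ ()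
        separate′ false false Nu Nv _ = contradiction (≡.trans (≡.sym u~v) (edgeless⇒bipartition edgeless (≡.cong not Nu) (≡.cong not Nv))) λ ()

    module _ {u v} (Nu : N u ≡ true) (Nv : N v ≡ true) (u~v : adj u v ≡ true) where

      neighbour : ∀ w → ∃ λ z → adj w z ≡ true
      neighbour w = first (connected w u)
        where
        first : Star (Graph.Edge G) w u → ∃ λ z → adj w z ≡ true
        first Star.ε              = v , u~v
        first (_◅_ {j = z} Ewz _) = z , T⇒≡ Ewz

      open EdgeInside Nu Nv u~v neighbour

      s t : ℕ
      s = count A
      t = count (not ∘ A)

      A⇒N : ∀ {w} → A w ≡ false → N w ≡ true
      A⇒N {w} Aw = Bool.not-injective Aw

      endpoint : ∀ {w z} → N w ≡ true → N z ≡ true → adj w z ≡ true → w ≡ u ⊎ w ≡ v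
      endpoint {w} Nw Nz w~z with w Fin.≟ u | w Fin.≟ v
      ... | yes w≡u | _       = inj₁ w≡u
      ... | no _    | yes w≡v = inj₂ w≡v
      ... | no w≢u  | no w≢v  = ⊥-elim (unique-edge Nw Nz w~z w≢u w≢v)

      edge-unique : ∀ {w z} → A w ≡ false → A z ≡ false → adj w z ≡ true → (w ≡ u × z ≡ v) ⊎ (w ≡ v × z ≡ u)
      edge-unique Aw Az w~z with endpoint (A⇒N Aw) (A⇒N Az) w~z | endpoint (A⇒N Az) (A⇒N Aw) (flip w~z)
      ... | inj₁ w≡u | inj₂ z≡v = inj₁ (w≡u , z≡v)
      ... | inj₂ w≡v | inj₁ z≡u = inj₂ (w≡v , z≡u)
      ... | inj₁ ≡.refl | inj₁ ≡.refl = contradiction ≡.refl (adj⇒≢ w~z)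
      ... | inj₂ ≡.refl | inj₂ ≡.refl = contradiction ≡.refl (adj⇒≢ w~z)

      1≤s : 1 ℕ.≤ s
      1≤s = #-cancel-≤ (≤-trans (≈⇒≤ (reflexive (≡.cong ι (≡.sym Ae)))) (≤-trans (term≤∑ (λ w → ι≥0 (A w)) e) (≈⇒≤ (∑ι≈count A))))

      -- By completeness every vertex of A is a common neighbour of the adjacent vertices u and v.
      s≤r : s ℕ.≤ r
      s≤r = #-cancel-≤ (≤-trans (≈⇒≤ (sym (∑ι≈count A))) (≤-trans (∑-mono λ w → common w) (book-free⇒codegree G free u~v)))
        where
        common : ∀ w → ι (A w) ≤ ι (adj u w) * ι (adj v w)
        common w = ≤-trans (≈⇒≤ (sym (*-identityʳ _))) (≤-trans (ι-mono (A w) λ Aw →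
            ≈⇒≤ (trans (sym (*-identityˡ 1#)) (*-cong (reflexive (≡.cong ι (≡.sym (complete Nu Aw)))) (reflexive (≡.cong ι (≡.sym (complete Nv Aw)))))))
          (ι*≤ (A w) (ι≥0 _ ⊗ ι≥0 _)))

      degree-total : ∑⟨ A ⟩ degreeᴺ ≈ # t * # s
      degree-total = trans (∑⟨⟩-cong λ w Aw → trans (trans (∑⟨⟩-cong λ z Nz → reflexive (≡.cong ι (complete Nz Aw))) order≈) (sym (*-identityʳ _)))
        (trans (∑⟨⟩-* _ _) (*-congˡ (trans (reflexive (∑⟨⟩≡ _)) (trans (∑-cong λ w → *-identityʳ _) (∑ι≈count A)))))
        where
        order≈ : ∑⟨ N ⟩ (λ _ → 1#) ≈ # t
        order≈ = trans (reflexive (∑⟨⟩≡ _)) (trans (∑-cong λ w → trans (*-identityʳ _) (reflexive (≡.cong ι (≡.sym (Bool.not-involutive (N w)))))) (∑ι≈count (not ∘ A)))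

      2m≈ : # 2 * # m ≈ orderedEdges + # 2 * # (t ℕ.* s)
      2m≈ = trans (trans (*-congˡ (reflexive (≡.cong #_ (≡.sym size≡m)))) (handshake G)) (trans degree-sum
        (trans (+-cong (+-congˡ C≈) (+-cong C≈ edgesᴬ≈0)) (solve 2 (λ O C → O :+ C :+ (C :+ :# 0) := O :+ :# 2 :* C) refl orderedEdges (# (t ℕ.* s)))))
        where
        C≈ : ∑⟨ A ⟩ degreeᴺ ≈ # (t ℕ.* s)
        C≈ = trans degree-total (sym (#-* t s))

      -- From 2m = `orderedEdges` + 2ts and 2 ≤ `orderedEdges` < 20/7, m lies in [ts + 1 , ts +
      -- 10/7), which contains a single natural number.
      m≡ : m ≡ suc (t ℕ.* s)
      m≡ = ℕₚ.≤-antisym (ℕₚ.≤-pred (ℕₚ.≰⇒> λ large → ≤⇒≯ (#-mono-≤ large) below)) (#-cancel-≤ above)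
        where
        k = t ℕ.* s
        above : # suc k ≤ # m
        above = *-cancelˡ-≤ (#>0 1) (≤-by ⌊ 2≤orderedEdges ⌋ (trans (solve 2 (λ O K → O :- :# 2 := (O :+ :# 2 :* K) :- :# 2 :* (:# 1 :+ K)) refl orderedEdges (# k))
          (+-cong (sym 2m≈) (-‿cong (*-congˡ (sym (#-suc k)))))))
        below : # m < # suc (suc k)
        below = *-cancelˡ-< (#>0 13) (<-by (#≥0 8 ⊕⁺ ⌊ 7orderedEdges<20 ⌋⁺)
          (trans (solve 2 (λ O K → :# 8 :+ (:# 20 :- :# 7 :* O) := :# 14 :* (:# 1 :+ (:# 1 :+ K)) :- :# 7 :* (O :+ :# 2 :* K)) refl orderedEdges (# k))
            (+-cong (*-congˡ (sym (trans (#-suc (suc k)) (+-congˡ (#-suc k)))))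
              (-‿cong (trans (*-congˡ (sym 2m≈)) (solve 1 (λ m → :# 7 :* (:# 2 :* m) := :# 14 :* m) refl (# m)))))))

      exceptional : ∃ λ s → 1 ℕ.≤ s × s ℕ.≤ r × Σ (s ∣ m ∸ 1) λ s∣m-1 → G ≅ S⁺ m s s∣m-1
      exceptional = s , 1≤s , s≤r , divides t m-1≡ , complete-bipartite-plus-edge G A (adj⇒≢ u~v) (≡.cong not Nu) (≡.cong not Nv) u~v
          independentᴬ (λ Aw Az → complete (A⇒N Aw) Az) edge-unique {m} m-1≡
        where
        m-1≡ : m ∸ 1 ≡ t ℕ.* s
        m-1≡ = ≡.cong (_∸ 1) m≡

    exceptional-graph : ∃ λ s → 1 ℕ.≤ s × s ℕ.≤ r × Σ (s ∣ m ∸ 1) λ s∣m-1 → G ≅ S⁺ m s s∣m-1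
    exceptional-graph with edgeInside?
    ... | yes (u , v , Nu , Nv , u~v) = exceptional Nu Nv u~v
    ... | no  none                    = ⊥-elim (edgeless-impossible none)

theorem1p4 : ∀ {c ℓ₁ ℓ₂} (ℝ : CompleteOrderedField c ℓ₁ ℓ₂) →
    let open CompleteOrderedField ℝ in
    (r m : ℕ) (G : Graph) (ρ : Carrier) →
    1 ℕ.≤ r →
    Connected G →
    ¬ Bipartite G →
    Graph.size G ≡ m →
    (240 ℕ.* r) ℕ.^ 2 ℕ.≤ m →
    IsSpectralRadius ℝ G ρ →
    (book (r ℕ.+ 1) -Free) G →
    ¬ (∃ λ s → 1 ℕ.≤ s × s ℕ.≤ r × Σ (s ∣ m ∸ 1) λ s∣m-1 → G ≅ S⁺ m s s∣m-1) →
    ρ * ρ < fromℕ m - 1# + fromℕ 2 / (ρ - 1#)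
theorem1p4 ℝ r m G ρ 1≤r connected nonbipartite size≡m m≥ spectral free notExceptional = conclusion
  where
  open Graphs ℝ
  open Solver using (solve; _:=_; _:+_; _:*_; _:-_)
  perronVector : PerronVector (adjacencyMatrix ℝ G) ρ
  perronVector = perron (λ i j → reflexive (≡.cong ι (Graph.sym G i j))) (λ i j → ι≥0 (Graph.adj G i j)) spectral
  0<gap : 0# < fromℕ 2 / (ρ - 1#)
  0<gap = *-positive (<-resp refl (#≈fromℕ 2) (#>0 1)) (inverse-positive ⌊ spectral-radius>1 G connected nonbipartite perronVector ⌋⁺)
  conclusion : ρ * ρ < fromℕ m - 1# + fromℕ 2 / (ρ - 1#)
  conclusion with <-or-≥ (# m - 1#) (ρ * ρ)
  ... | inj₁ m-1<ρ² = contradiction (Exceptional.exceptional-graph r m G 1≤r connected nonbipartite size≡m m≥ free perronVector m-1<ρ²) notExceptional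
  -- Outside the exceptional family even ρ² ≤ m - 1 holds; the positive fraction, positive because ρ
  -- > 1, makes the inequality strict.
  ... | inj₂ ρ²≤m-1 = <-by (⌊ ρ²≤m-1 ⌋ ⊕⁺ 0<gap) (trans (solve 3 (λ M R D → (M :- R) :+ D := (M :+ D) :- R) refl (# m - 1#) (ρ * ρ) (fromℕ 2 / (ρ - 1#)))
        (+-congʳ (+-congʳ (+-congʳ (#≈fromℕ m)))))
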